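{- Let $\Gamma$ be a Shilla distance-regular graph with $b(\Gamma)=b$ and smallest eigenvalue $\theta_3$. Then $\theta_3<-b^2+2$ if and only if $b=2$.
   Context: A connected graph $\Gamma$ of diameter $D$ is distance-regular if there are integers $b_i,c_i$ ($0\le i\le D$) such that for any two vertices $x,y$ at distance $i$, exactly $c_i$ neighbours of $y$ are at distance $i-1$ from $x$ and exactly $b_i$ neighbours of $y$ are at distance $i+1$ from $x$. Then $\Gamma$ is regular of valency $k=b_0$, and $a_i:=k-b_i-c_i$. Its eigenvalues (of the adjacency matrix) are $k=\theta_0>\theta_1>\dots>\theta_D$. A Shilla distance-regular graph is a distance-regular graph of diameter $3$ whose second largest eigenvalue satisfies $\theta_1=a_3$; for such graphs $k=(a_3-a_1)a_3$ and $b(\Gamma):=a_3-a_1=k/a_3$. -}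

module Defs where

open import Algebra.Bundles using (CommutativeMonoid)
open import Level using (0ℓ)
open import Data.Bool.Base using (if_then_else_)
open import Data.Nat.Base as ℕ using (ℕ; zero; suc)
import Data.Nat.Properties as ℕ
open import Data.Integer.Base as ℤ using (ℤ; +_)
open import Data.Rational.Base as ℚ using (ℚ; 0ℚ; 1ℚ; ½; ∣_∣)
import Data.Rational.Properties as ℚ
open import Data.Fin.Base as Fin using (Fin; toℕ)
open import Data.Fin.Patterns using (0F; 1F; 3F)
open import Data.Fin.Subset as Subset using (Subset; _∈_)
open import Data.Product.Base using (Σ; ∃; ∃₂; _×_; _,_)
open import Data.Sum.Base using (_⊎_)
open import Data.Vec.Functional using (Vector; foldr)
open import Function.Bundles using (_⇔_)
open import Relation.Binary.Core using (Rel)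
open import Relation.Binary.Definitions using (Symmetric; Irreflexive; Decidable)
open import Relation.Binary.PropositionalEquality
open import Relation.Nullary.Decidable.Core using (does)

-- Reals are Cauchy sequences of rationals, taken up to the equality _≈_ below.

IsCauchy : (ℕ → ℚ) → Set
IsCauchy x = ∀ ε → 0ℚ ℚ.< ε →
  ∃ λ N → ∀ m n → N ℕ.≤ m → N ℕ.≤ n → ∣ x m ℚ.- x n ∣ ℚ.≤ ε

record ℝ : Set where
  constructor mkℝ
  field
    seq    : ℕ → ℚ
    cauchy : IsCauchy seq

open ℝ public

infix  4 _≈_ _<_ _#_
infixl 6 _+_
infixl 7 _*_

record _≈_ (x y : ℝ) : Set where
  constructor mk≈
  field
    close : ∀ ε → 0ℚ ℚ.< ε →
      ∃ λ N → ∀ n → N ℕ.≤ n → ∣ seq x n ℚ.- seq y n ∣ ℚ.≤ ε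

record _<_ (x y : ℝ) : Set where
  constructor mk<
  field
    separated : ∃ λ ε → 0ℚ ℚ.< ε ×
      ∃ λ N → ∀ n → N ℕ.≤ n → seq x n ℚ.+ ε ℚ.≤ seq y n

-- Apartness, the constructively positive form of x ≠ y.
_#_ : Rel ℝ 0ℓ
x # y = x < y ⊎ y < x

private
  0<½* : ∀ {ε} → 0ℚ ℚ.< ε → 0ℚ ℚ.< ½ ℚ.* ε
  0<½* {ε} 0<ε = subst (ℚ._< ½ ℚ.* ε) (ℚ.*-zeroʳ ½) (ℚ.*-monoʳ-<-pos ½ 0<ε)

  halves : ∀ ε → ½ ℚ.* ε ℚ.+ ½ ℚ.* ε ≡ ε
  halves ε = trans (sym (ℚ.*-distribʳ-+ ε ½ ½)) (ℚ.*-identityˡ ε)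

  -+-cancel : ∀ p q → (p ℚ.- q) ℚ.+ q ≡ p
  -+-cancel p q = begin
    (p ℚ.- q) ℚ.+ q        ≡⟨ ℚ.+-assoc p (ℚ.- q) q ⟩
    p ℚ.+ (ℚ.- q ℚ.+ q)    ≡⟨ cong (p ℚ.+_) (ℚ.+-inverseˡ q) ⟩
    p ℚ.+ 0ℚ               ≡⟨ ℚ.+-identityʳ p ⟩
    p                      ∎
    where open ≡-Reasoning

  +-difference : ∀ p q r s →
    (p ℚ.+ q) ℚ.- (r ℚ.+ s) ≡ (p ℚ.- r) ℚ.+ (q ℚ.- s)
  +-difference p q r s = trans
    (cong ((p ℚ.+ q) ℚ.+_) (ℚ.neg-distrib-+ r s))
    (interchange p q (ℚ.- r) (ℚ.- s))
    where
    open import Algebra.Properties.CommutativeSemigroup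
      (CommutativeMonoid.commutativeSemigroup ℚ.+-0-commutativeMonoid)
      using (interchange)

  *-difference : ∀ p q r s →
    p ℚ.* q ℚ.- r ℚ.* s ≡ p ℚ.* (q ℚ.- s) ℚ.+ s ℚ.* (p ℚ.- r)
  *-difference p q r s = sym (begin
    p ℚ.* (q ℚ.- s) ℚ.+ s ℚ.* (p ℚ.- r)
      ≡⟨ cong₂ ℚ._+_ (distrib p q s) (distrib s p r) ⟩
    (p ℚ.* q ℚ.- p ℚ.* s) ℚ.+ (s ℚ.* p ℚ.- s ℚ.* r)
      ≡⟨ cong₂ (λ t u → (p ℚ.* q ℚ.- p ℚ.* s) ℚ.+ (t ℚ.- u))
           (ℚ.*-comm s p) (ℚ.*-comm s r) ⟩
    (p ℚ.* q ℚ.- p ℚ.* s) ℚ.+ (p ℚ.* s ℚ.- r ℚ.* s)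
      ≡⟨ ℚ.+-assoc (p ℚ.* q ℚ.- p ℚ.* s) (p ℚ.* s) (ℚ.- (r ℚ.* s)) ⟨
    ((p ℚ.* q ℚ.- p ℚ.* s) ℚ.+ p ℚ.* s) ℚ.- r ℚ.* s
      ≡⟨ cong (ℚ._- r ℚ.* s) (-+-cancel (p ℚ.* q) (p ℚ.* s)) ⟩
    p ℚ.* q ℚ.- r ℚ.* s ∎)
    where
    open ≡-Reasoning
    distrib : ∀ x y z → x ℚ.* (y ℚ.- z) ≡ x ℚ.* y ℚ.- x ℚ.* z
    distrib x y z = trans (ℚ.*-distribˡ-+ x y (ℚ.- z))
      (cong (x ℚ.* y ℚ.+_) (sym (ℚ.neg-distribʳ-* x z)))

  bounded : ∀ x → IsCauchy x →
    ∃₂ λ B N → 0ℚ ℚ.< B × ∀ n → N ℕ.≤ n → ∣ x n ∣ ℚ.≤ B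
  bounded x cx with cx 1ℚ (ℚ.positive⁻¹ 1ℚ)
  ... | N , close = 1ℚ ℚ.+ ∣ x N ∣ , N , 0<B , below
    where
    0<B : 0ℚ ℚ.< 1ℚ ℚ.+ ∣ x N ∣
    0<B = ℚ.+-mono-<-≤ (ℚ.positive⁻¹ 1ℚ) (ℚ.0≤∣p∣ (x N))

    open ℚ.≤-Reasoning
    below : ∀ n → N ℕ.≤ n → ∣ x n ∣ ℚ.≤ 1ℚ ℚ.+ ∣ x N ∣
    below n N≤n = begin
      ∣ x n ∣                        ≡⟨ cong ∣_∣ (-+-cancel (x n) (x N)) ⟨
      ∣ (x n ℚ.- x N) ℚ.+ x N ∣      ≤⟨ ℚ.∣p+q∣≤∣p∣+∣q∣ (x n ℚ.- x N) (x N) ⟩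
      ∣ x n ℚ.- x N ∣ ℚ.+ ∣ x N ∣    ≤⟨ ℚ.+-monoˡ-≤ ∣ x N ∣ (close n N N≤n ℕ.≤-refl) ⟩
      1ℚ ℚ.+ ∣ x N ∣                 ∎

  *-mono-∣∣ : ∀ {p q B δ} → 0ℚ ℚ.< B →
    ∣ p ∣ ℚ.≤ B → ∣ q ∣ ℚ.≤ δ → ∣ p ℚ.* q ∣ ℚ.≤ B ℚ.* δ
  *-mono-∣∣ {p} {q} {B} {δ} 0<B p≤B q≤δ = begin
    ∣ p ℚ.* q ∣        ≡⟨ ℚ.∣p*q∣≡∣p∣*∣q∣ p q ⟩
    ∣ p ∣ ℚ.* ∣ q ∣    ≤⟨ ℚ.*-monoʳ-≤-nonNeg ∣ q ∣ {{ℚ.nonNegative (ℚ.0≤∣p∣ q)}} p≤B ⟩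
    B ℚ.* ∣ q ∣        ≤⟨ ℚ.*-monoˡ-≤-nonNeg B {{ℚ.nonNegative (ℚ.<⇒≤ 0<B)}} q≤δ ⟩
    B ℚ.* δ            ∎
    where open ℚ.≤-Reasoning

  divide : ∀ {B ε} → 0ℚ ℚ.< B → 0ℚ ℚ.< ε →
    ∃ λ δ → 0ℚ ℚ.< δ × B ℚ.* δ ≡ ε
  divide {B} {ε} 0<B 0<ε =
    1/B ℚ.* ε , 0<δ ,
    trans (sym (ℚ.*-assoc B 1/B ε))
      (trans (cong (ℚ._* ε) (ℚ.*-inverseʳ B {{nz}})) (ℚ.*-identityˡ ε))
    where
    nz  = ℚ.pos⇒nonZero B {{ℚ.positive 0<B}}
    1/B = ℚ.1/_ B {{nz}}
    0<δ : 0ℚ ℚ.< 1/B ℚ.* ε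
    0<δ = subst (ℚ._< 1/B ℚ.* ε) (ℚ.*-zeroʳ 1/B)
      (ℚ.*-monoʳ-<-pos 1/B {{ℚ.1/pos⇒pos B {{ℚ.positive 0<B}}}} 0<ε)

  -- Abstract because unfolding these proofs makes terms of type ℝ very large.
  abstract
    constant-cauchy : ∀ p → IsCauchy (λ _ → p)
    constant-cauchy p ε 0<ε = 0 , λ _ _ _ _ →
      subst (ℚ._≤ ε) (sym (cong ∣_∣ (ℚ.+-inverseʳ p))) (ℚ.<⇒≤ 0<ε)

    +-cauchy : ∀ {x y} → IsCauchy x → IsCauchy y → IsCauchy (λ n → x n ℚ.+ y n)
    +-cauchy {x} {y} cx cy ε 0<ε
      with cx (½ ℚ.* ε) (0<½* 0<ε) | cy (½ ℚ.* ε) (0<½* 0<ε)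
    ... | N , p | M , q = N ℕ.⊔ M , λ m n N⊔M≤m N⊔M≤n → begin
        ∣ (x m ℚ.+ y m) ℚ.- (x n ℚ.+ y n) ∣
          ≡⟨ cong ∣_∣ (+-difference (x m) (y m) (x n) (y n)) ⟩
        ∣ (x m ℚ.- x n) ℚ.+ (y m ℚ.- y n) ∣
          ≤⟨ ℚ.∣p+q∣≤∣p∣+∣q∣ (x m ℚ.- x n) (y m ℚ.- y n) ⟩
        ∣ x m ℚ.- x n ∣ ℚ.+ ∣ y m ℚ.- y n ∣
          ≤⟨ ℚ.+-mono-≤
               (p m n (ℕ.m⊔n≤o⇒m≤o N M N⊔M≤m) (ℕ.m⊔n≤o⇒m≤o N M N⊔M≤n))
               (q m n (ℕ.m⊔n≤o⇒n≤o N M N⊔M≤m) (ℕ.m⊔n≤o⇒n≤o N M N⊔M≤n)) ⟩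
        ½ ℚ.* ε ℚ.+ ½ ℚ.* ε
          ≡⟨ halves ε ⟩
        ε ∎
      where open ℚ.≤-Reasoning

    *-close : ∀ {p q r s B C δ} → 0ℚ ℚ.< B → 0ℚ ℚ.< C →
      ∣ p ∣ ℚ.≤ B → ∣ s ∣ ℚ.≤ C → ∣ p ℚ.- r ∣ ℚ.≤ δ → ∣ q ℚ.- s ∣ ℚ.≤ δ →
      ∣ p ℚ.* q ℚ.- r ℚ.* s ∣ ℚ.≤ (B ℚ.+ C) ℚ.* δ
    *-close {p} {q} {r} {s} {B} {C} {δ} 0<B 0<C p≤B s≤C p-r≤δ q-s≤δ = begin
      ∣ p ℚ.* q ℚ.- r ℚ.* s ∣
        ≡⟨ cong ∣_∣ (*-difference p q r s) ⟩
      ∣ p ℚ.* (q ℚ.- s) ℚ.+ s ℚ.* (p ℚ.- r) ∣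
        ≤⟨ ℚ.∣p+q∣≤∣p∣+∣q∣ (p ℚ.* (q ℚ.- s)) (s ℚ.* (p ℚ.- r)) ⟩
      ∣ p ℚ.* (q ℚ.- s) ∣ ℚ.+ ∣ s ℚ.* (p ℚ.- r) ∣
        ≤⟨ ℚ.+-mono-≤
             (*-mono-∣∣ {p} {q ℚ.- s} 0<B p≤B q-s≤δ)
             (*-mono-∣∣ {s} {p ℚ.- r} 0<C s≤C p-r≤δ) ⟩
      B ℚ.* δ ℚ.+ C ℚ.* δ
        ≡⟨ ℚ.*-distribʳ-+ δ B C ⟨
      (B ℚ.+ C) ℚ.* δ ∎
      where open ℚ.≤-Reasoning

    *-cauchy : ∀ {x y} → IsCauchy x → IsCauchy y → IsCauchy (λ n → x n ℚ.* y n)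
    *-cauchy {x} {y} cx cy ε 0<ε =
      let B , N₁ , 0<B , x≤B = bounded x cx
          C , N₂ , 0<C , y≤C = bounded y cy
          δ , 0<δ , eq = divide {B ℚ.+ C} {ε} (ℚ.+-mono-< 0<B 0<C) 0<ε
          N₃ , p = cx δ 0<δ
          N₄ , q = cy δ 0<δ
          N₁₂ = N₁ ℕ.⊔ N₂
          N₃₄ = N₃ ℕ.⊔ N₄
      in N₁₂ ℕ.⊔ N₃₄ , λ m n N≤m N≤n →
        let N₁₂≤m = ℕ.m⊔n≤o⇒m≤o N₁₂ N₃₄ N≤m
            N₁₂≤n = ℕ.m⊔n≤o⇒m≤o N₁₂ N₃₄ N≤n
            N₃₄≤m = ℕ.m⊔n≤o⇒n≤o N₁₂ N₃₄ N≤m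
            N₃₄≤n = ℕ.m⊔n≤o⇒n≤o N₁₂ N₃₄ N≤n
        in subst (∣ x m ℚ.* y m ℚ.- x n ℚ.* y n ∣ ℚ.≤_) eq
          (*-close {x m} {y m} {x n} {y n} 0<B 0<C
            (x≤B m (ℕ.m⊔n≤o⇒m≤o N₁ N₂ N₁₂≤m))
            (y≤C n (ℕ.m⊔n≤o⇒n≤o N₁ N₂ N₁₂≤n))
            (p m n (ℕ.m⊔n≤o⇒m≤o N₃ N₄ N₃₄≤m) (ℕ.m⊔n≤o⇒m≤o N₃ N₄ N₃₄≤n))
            (q m n (ℕ.m⊔n≤o⇒n≤o N₃ N₄ N₃₄≤m) (ℕ.m⊔n≤o⇒n≤o N₃ N₄ N₃₄≤n)))

fromℚ : ℚ → ℝ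
fromℚ p = mkℝ (λ _ → p) (constant-cauchy p)

fromℤ : ℤ → ℝ
fromℤ z = fromℚ (z ℚ./ 1)

0ℝ 1ℝ : ℝ
0ℝ = fromℚ 0ℚ
1ℝ = fromℚ 1ℚ

_+_ : ℝ → ℝ → ℝ
mkℝ x cx + mkℝ y cy = mkℝ (λ n → x n ℚ.+ y n) (+-cauchy {x} {y} cx cy)

_*_ : ℝ → ℝ → ℝ
mkℝ x cx * mkℝ y cy = mkℝ (λ n → x n ℚ.* y n) (*-cauchy {x} {y} cx cy)

Matrix : ℕ → Set
Matrix n = Fin n → Fin n → ℝ

∑ : ∀ {n} → Vector ℝ n → ℝ
∑ = foldr _+_ 0ℝ

record IsEigenvalue {n} (M : Matrix n) (θ : ℝ) : Set where
  constructor mkEigenvalue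
  field
    vector   : Vector ℝ n
    nonzero  : ∃ λ x → vector x # 0ℝ
    equation : ∀ x → ∑ (λ y → M x y * vector y) ≈ θ * vector x

record Graph (n : ℕ) : Set₁ where
  infix 4 _~_ _~?_
  field
    _~_      : Rel (Fin n) 0ℓ
    _~?_     : Decidable _~_
    ~-sym    : Symmetric _~_
    ~-irrefl : Irreflexive _≡_ _~_

  infixr 5 _∷_
  data Walk : ℕ → Fin n → Fin n → Set where
    []  : ∀ {x} → Walk 0 x x
    _∷_ : ∀ {l x y z} → x ~ y → Walk l y z → Walk (suc l) x z

  Distance : Fin n → Fin n → ℕ → Set
  Distance x y i = Walk i x y × (∀ j → Walk j x y → i ℕ.≤ j)

  Connected : Set
  Connected = ∀ x y → ∃ λ l → Walk l x y

  HasDiameter : ℕ → Set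
  HasDiameter D =
    (∀ x y i → Distance x y i → i ℕ.≤ D) × ∃₂ λ x y → Distance x y D

  adjacencyMatrix : Matrix n
  adjacencyMatrix x y = if does (x ~? y) then 1ℝ else 0ℝ

HasCardinality : ∀ {n} → (Fin n → Set) → ℕ → Set
HasCardinality {n} P m = Σ (Subset n) λ S →
  (∀ z → z ∈ S ⇔ P z) × Subset.∣ S ∣ ≡ m

record IsDistanceRegular {n} (Γ : Graph n) (D : ℕ) : Set where
  open Graph Γ
  field
    connected : Connected
    diameter  : HasDiameter D
    b c       : Fin (suc D) → ℕ
    -- "At distance i - 1" is phrased so that it is unsatisfiable for i = 0.
    c-count   : ∀ i x y → Distance x y (toℕ i) →
      HasCardinality (λ z → y ~ z × ∃ λ j → suc j ≡ toℕ i × Distance x z j) (c i)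
    b-count   : ∀ i x y → Distance x y (toℕ i) →
      HasCardinality (λ z → y ~ z × Distance x z (suc (toℕ i))) (b i)

  valency : ℕ
  valency = b 0F

  a : Fin (suc D) → ℤ
  a i = + valency ℤ.- + b i ℤ.- + c i

-- θ lists the distinct eigenvalues θ 0 > θ 1 > … > θ D, without multiplicity.
record Spectrum {n} (Γ : Graph n) (D : ℕ) : Set where
  open Graph Γ
  field
    θ          : Fin (suc D) → ℝ
    decreasing : ∀ i j → i Fin.< j → θ j < θ i
    eigenvalue : ∀ i → IsEigenvalue adjacencyMatrix (θ i)
    complete   : ∀ μ → IsEigenvalue adjacencyMatrix μ → ∃ λ i → μ ≈ θ i

record IsShilla {n} (Γ : Graph n) : Set where
  field
    distanceRegular : IsDistanceRegular Γ 3
    spectrum        : Spectrum Γ 3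

  open IsDistanceRegular distanceRegular public
  open Spectrum spectrum public

  field
    θ₁≈a₃ : θ 1F ≈ fromℤ (a 3F)

  -- The integer b(Γ) attached to a Shilla graph (not an intersection number).
  b⟨Γ⟩ : ℤ
  b⟨Γ⟩ = a 3F ℤ.- a 1F

  θ₃ : ℝ
  θ₃ = θ 3F

-- Write b₂ = β and c₂ = c, and let a₃ = a, so that k = a b. Then θ₂ and θ₃ are the roots of
-- an integral quadratic q with q (-b) = -c (b - 1) < 0, whence θ₃ < -b; for b = 2 this is
-- the claim. For b ≥ 3 one shows q (-b² + 2) ≥ 0. Suppose not. The Krein condition
-- q³₁₁ ≥ 0 reads (β + c) θ₃ + b (b β + c) ≥ 0, which forces θ₃ > -b². If θ₂ and θ₃ are
-- irrational then they are conjugate, hence have equal multiplicities; this is a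
-- Diophantine equation in the parameters that contradicts the Krein condition. Otherwise
-- θ₃ = -b² + 1, and the Krein condition gives b (b - 1) (c - 1) ≤ a, whereas positivity of
-- the idempotent E₃ on an edge and its common neighbours bounds c from below.
module Submission where

-- No extension field is built. Over ℤ the eigenvalues θ₂ and θ₃ enter only through `s` = θ₂ + θ₃
-- and `r` = θ₂ θ₃, acting on the rank-two module V. A statement about θ₃ alone is out of reach
-- unless the discriminant is a square; otherwise only quantities symmetric in the two conjugates, a
-- norm and a trace, can be used. This is why the two cases separate, and why the Krein condition is
-- proved once as a quadratic form on V and specialised twice. Substituting x = -(w + b) turns q
-- into w² + p w - P with p = a + b - (β + c) and P = c (b - 1). The point -b² + 2 becomes W = b² -
-- b - 2, and the Krein condition becomes w (β + c) ≤ b (b - 1) β. The case analysis uses these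
-- coordinates. Cauchy reals serve only to see that θ₂ and θ₃ are roots of q and to compare θ₃ with
-- an integer. Their order is not decidable, so for b ≥ 3 the inequality is refuted from the sign of
-- q at an integer, whereas the strict bound θ₃ < -b requires an explicit rational gap.

module Integral where

  open import Data.Empty using (⊥)
  open import Data.Fin.Base as Fin using (Fin; zero; suc; toℕ; fromℕ<)
  open import Data.Fin.Patterns using (0F; 1F; 2F; 3F)
  import Data.Fin.Properties as Fin
  open import Data.Fin.Subset as Subset using (Subset; _∉_; inside; outside)
  open import Data.Fin.Subset.Properties using (drop-there)
  open import Data.Integer.Base hiding (suc)
  open import Data.Integer.DivMod using (_/ℕ_; _%ℕ_; n%ℕd<d; a≡a%ℕn+[a/ℕn]*n)
  open import Data.Integer.Properties renaming (_≟_ to _≟ᶻ_)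
  open import Data.Integer.Tactic.RingSolver using (solve-∀)
  open import Data.List.Base using (List; []; _∷_; allFin)
  import Data.List.Membership.Propositional as List
  open import Data.List.Membership.Propositional.Properties using (∈-allFin)
  open import Data.List.Relation.Unary.Any using (here; there)
  open import Data.Nat.Base as ℕ using (ℕ; suc)
  open import Data.Nat.Coprimality using (Coprime; coprime-/gcd; coprime-divisor)
  open import Data.Nat.Divisibility using (_∣_; divides; ∣-refl)
  open import Data.Nat.DivMod using (m/n*n≡m)
  open import Data.Nat.GCD using (gcd; gcd[m,n]∣m; gcd[m,n]∣n; gcd[m,n]≢0)
  import Data.Nat.Properties as ℕ
  import Data.Nat.Tactic.RingSolver as ℕSolver
  open import Data.Product.Base using (∃; _×_; _,_; proj₁; proj₂)
  open import Data.Sum.Base using (_⊎_; inj₁; inj₂)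
  open import Data.Vec.Base as Vec using (_∷_; [])
  open import Data.Vec.Functional using (Vector)
  open import Defs using (Graph; HasCardinality; IsDistanceRegular)
  open import Function.Base using (_∘_)
  open import Function.Bundles using (Equivalence)
  open import Relation.Binary.Definitions using (Tri; tri<; tri≈; tri>)
  open import Relation.Binary.PropositionalEquality
  open import Relation.Nullary using (¬_; Dec; yes; no; contradiction)
  open import Relation.Nullary.Decidable using (_×-dec_; map′)
  open import Algebra.Properties.Semiring.Sum +-*-semiring using (sum; sum-syntax; sum-cong-≗; ∑-distrib-+; ∑-comm; *-distribˡ-sum; *-distribʳ-sum; sum-replicate-zero) public

  -- Integer matrices

  0≤+ : ∀ {i j} → 0ℤ ≤ i → 0ℤ ≤ j → 0ℤ ≤ i + j
  0≤+ = +-mono-≤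

  0≤* : ∀ {i j} → 0ℤ ≤ i → 0ℤ ≤ j → 0ℤ ≤ i * j
  0≤* {+ m} {+ n} _ _ = subst (0ℤ ≤_) (pos-* m n) (+≤+ ℕ.z≤n)

  0<* : ∀ {i j} → 0ℤ < i → 0ℤ < j → 0ℤ < i * j
  0<* {+[1+ m ]} {+[1+ n ]} _ _ = +<+ (ℕ.s≤s ℕ.z≤n)
  0<* {+0} (+<+ ())
  0<* {+[1+ m ]} {+0} _ (+<+ ())

  0≤sq : ∀ i → 0ℤ ≤ i * i
  0≤sq (+ m)      = 0≤* {+ m} {+ m} (+≤+ ℕ.z≤n) (+≤+ ℕ.z≤n)
  0≤sq (-[1+ m ]) = +≤+ ℕ.z≤n

  sq-pos : ∀ {i} → i ≢ 0ℤ → 0ℤ < i * i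
  sq-pos {+0}       i≢0 = contradiction refl i≢0
  sq-pos {+[1+ m ]} _   = +<+ (ℕ.s≤s ℕ.z≤n)
  sq-pos { -[1+ m ]} _  = +<+ (ℕ.s≤s ℕ.z≤n)

  ≤-by : ∀ {i j} d → 0ℤ ≤ d → j ≡ i + d → i ≤ j
  ≤-by {i} d 0≤d refl = subst (_≤ i + d) (+-identityʳ i) (+-monoʳ-≤ i 0≤d)

  *-cancel-pos-≤ : ∀ {i j} → 0ℤ < i → 0ℤ ≤ i * j → 0ℤ ≤ j
  *-cancel-pos-≤ {i} {+ _}      _   _ = +≤+ ℕ.z≤n
  *-cancel-pos-≤ {+[1+ _ ]} { -[1+ _ ]} _ ()
  *-cancel-pos-≤ {+0} (+<+ ())

  *-cancel-pos-≡ : ∀ {i} → 0ℤ < i → ∀ {j k} → i * j ≡ i * k → j ≡ k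
  *-cancel-pos-≡ {+[1+ m ]} _ = *-cancelˡ-≡ +[1+ m ] _ _
  *-cancel-pos-≡ {+0} (+<+ ())

  *-cancel-pos-< : ∀ {i j} → 0ℤ < i → 0ℤ < i * j → 0ℤ < j
  *-cancel-pos-< {i} {j} 0<i 0<ij = ≰⇒> λ j≤0 → <⇒≱ 0<ij
    (≤-by (i * (0ℤ - j)) (0≤* (<⇒≤ 0<i) (i≤j⇒0≤j-i j≤0)) (go i j))
    where
    go : ∀ i j → 0ℤ ≡ i * j + i * (0ℤ - j)
    go = solve-∀

  sum-nonneg : ∀ {n} (f : Vector ℤ n) → (∀ i → 0ℤ ≤ f i) → 0ℤ ≤ sum f
  sum-nonneg {ℕ.zero}  f _   = +≤+ ℕ.z≤n
  sum-nonneg {ℕ.suc n} f 0≤f = 0≤+ (0≤f zero) (sum-nonneg (f ∘ suc) (0≤f ∘ suc))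

  sum-mono : ∀ {n} {f g : Vector ℤ n} → (∀ i → f i ≤ g i) → sum f ≤ sum g
  sum-mono {ℕ.zero}  _   = +≤+ ℕ.z≤n
  sum-mono {ℕ.suc n} f≤g = +-mono-≤ (f≤g zero) (sum-mono (f≤g ∘ suc))

  term≤sum : ∀ {n} (f : Vector ℤ n) → (∀ i → 0ℤ ≤ f i) → ∀ i → f i ≤ sum f
  term≤sum {ℕ.suc n} f 0≤f zero    =
    ≤-by (sum (f ∘ suc)) (sum-nonneg (f ∘ suc) (0≤f ∘ suc)) refl
  term≤sum {ℕ.suc n} f 0≤f (suc i) = ≤-trans (term≤sum (f ∘ suc) (0≤f ∘ suc) i)
    (≤-by (f zero) (0≤f zero) (+-comm (f zero) (sum (f ∘ suc))))

  sum-zero : ∀ {n} {f : Vector ℤ n} → (∀ i → f i ≡ 0ℤ) → sum f ≡ 0ℤ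
  sum-zero {n} f≡0 = trans (sum-cong-≗ f≡0) (sum-replicate-zero n)

  sum-linear : ∀ {n} i j (f g : Vector ℤ n) →
    sum (λ x → i * f x + j * g x) ≡ i * sum f + j * sum g
  sum-linear i j f g = trans (∑-distrib-+ (λ x → i * f x) (λ x → j * g x))
    (sym (cong₂ _+_ (*-distribˡ-sum i f) (*-distribˡ-sum j g)))

  sum-linear₃ : ∀ {n} i j k (f g h : Vector ℤ n) →
    sum (λ x → i * f x + (j * g x + k * h x)) ≡ i * sum f + (j * sum g + k * sum h)
  sum-linear₃ i j k f g h = trans (∑-distrib-+ (λ x → i * f x) (λ x → j * g x + k * h x))
    (cong₂ _+_ (sym (*-distribˡ-sum i f)) (sum-linear j k g h))

  Square : ℕ → Set
  Square n = Fin n → Fin n → ℤ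

  infixr 7 _·_
  _·_ : ∀ {n} → Square n → Vector ℤ n → Vector ℤ n
  (M · v) x = ∑[ y < _ ] (M x y * v y)

  infix 7 _∙_
  _∙_ : ∀ {n} → Vector ℤ n → Vector ℤ n → ℤ
  v ∙ w = ∑[ x < _ ] (v x * w x)

  trace : ∀ {n} → Square n → ℤ
  trace M = ∑[ x < _ ] M x x

  ∙-comm : ∀ {n} (v w : Vector ℤ n) → v ∙ w ≡ w ∙ v
  ∙-comm v w = sum-cong-≗ λ x → *-comm (v x) (w x)

  ∙-linear₃ : ∀ {n} i j k (t f g h : Vector ℤ n) →
    t ∙ (λ x → i * f x + (j * g x + k * h x)) ≡ i * (t ∙ f) + (j * (t ∙ g) + k * (t ∙ h))
  ∙-linear₃ i j k t f g h = trans
    (sum-cong-≗ λ x → rearranged (t x) i (f x) j (g x) k (h x))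
    (sum-linear₃ i j k (λ x → t x * f x) (λ x → t x * g x) (λ x → t x * h x))
    where
    rearranged : ∀ t i f j g k h →
      t * (i * f + (j * g + k * h)) ≡ i * (t * f) + (j * (t * g) + k * (t * h))
    rearranged = solve-∀

  adjoint : ∀ {n} {M : Square n} → (∀ x y → M x y ≡ M y x) →
    ∀ v w → v ∙ (M · w) ≡ (M · v) ∙ w
  adjoint {n} {M} M-sym v w = begin
    ∑[ x < n ] (v x * ∑[ y < n ] (M x y * w y))
      ≡⟨ sum-cong-≗ (λ x → *-distribˡ-sum (v x) (λ y → M x y * w y)) ⟩
    ∑[ x < n ] ∑[ y < n ] (v x * (M x y * w y))
      ≡⟨ ∑-comm (λ x y → v x * (M x y * w y)) ⟩
    ∑[ y < n ] ∑[ x < n ] (v x * (M x y * w y))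
      ≡⟨ sum-cong-≗ (λ y → sum-cong-≗ λ x →
           trans (cong (λ m → v x * (m * w y)) (M-sym x y)) (swap (v x) (M y x) (w y))) ⟩
    ∑[ y < n ] ∑[ x < n ] (M y x * v x * w y)
      ≡⟨ sum-cong-≗ (λ y → *-distribʳ-sum (w y) (λ x → M y x * v x)) ⟨
    ∑[ y < n ] ((M · v) y * w y) ∎
    where
    open ≡-Reasoning
    swap : ∀ v m w → v * (m * w) ≡ m * v * w
    swap = solve-∀

  -- Traces of symmetric matrices N with N³ = D N

  Nonsquare : ℤ → Set
  Nonsquare D = ∀ i j → i ≢ 0ℤ → D * (i * i) ≢ j * j

  -- N commutes with the orthogonal projection onto span (v , N v), on which its trace
  -- vanishes; N′ is Δ times the restriction of N to the orthogonal complement.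
  module Deflation {n} (N : Square n) (N-sym : ∀ x y → N x y ≡ N y x)
    (D : ℤ) (N³≡DN : ∀ x y → (N · (N · (λ z → N z y))) x ≡ D * N x y)
    (i : Fin n) where

    v u : Vector ℤ n
    v x = N x i
    u   = N · v

    -- By `u∙u`, Δ is the Gram determinant of `v` and `u`. It is nonzero when α ≠ 0 and D is not a
    -- square, and multiplying by it clears the denominators of the projection onto their span.
    α γ Δ : ℤ
    α = v ∙ v
    γ = v ∙ u
    Δ = D * (α * α) - γ * γ

    N′ : Square n
    N′ x y = Δ * N x y +
      ((γ * u y - D * α * v y) * u x + (γ * D * v y - D * α * u y) * v x)

    N′-sym : ∀ x y → N′ x y ≡ N′ y x
    N′-sym x y = trans (cong (λ m → Δ * m + ((γ * u y - D * α * v y) * u x + (γ * D * v y - D * α * u y) * v x)) (N-sym x y))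
      (swap (Δ * N y x) γ D α (u x) (u y) (v x) (v y))
      where
      swap : ∀ m γ D α ux uy vx vy →
        m + ((γ * uy - D * α * vy) * ux + (γ * D * vy - D * α * uy) * vx) ≡
        m + ((γ * ux - D * α * vx) * uy + (γ * D * vx - D * α * ux) * vy)
      swap = solve-∀

    Nu : ∀ x → (N · u) x ≡ D * v x
    Nu x = N³≡DN x i

    u∙u : u ∙ u ≡ D * α
    u∙u = begin
      u ∙ u        ≡⟨ adjoint {M = N} N-sym u v ⟩
      (N · u) ∙ v  ≡⟨ sum-cong-≗ (λ x → trans (cong (_* v x) (Nu x)) (*-assoc D (v x) (v x))) ⟩
      sum (λ x → D * (v x * v x)) ≡⟨ *-distribˡ-sum D (λ x → v x * v x) ⟨
      D * α        ∎
      where open ≡-Reasoning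

    vᵢ : γ ≡ D * v i
    vᵢ = begin
      v ∙ u  ≡⟨ sum-cong-≗ (λ x → cong (_* u x) (N-sym x i)) ⟩
      (N · u) i ≡⟨ Nu i ⟩
      D * v i ∎
      where open ≡-Reasoning

    uᵢ : u i ≡ α
    uᵢ = sum-cong-≗ λ x → cong (_* v x) (N-sym i x)

    -- Column i of N is `v` itself, which the projection kills. Each deflation thus clears a column,
    -- and this makes the induction in `trace-zero` end.
    N′-column-i : ∀ x → N′ x i ≡ 0ℤ
    N′-column-i x = begin
      N′ x i ≡⟨ cong (λ t → (D * (α * α) - γ * γ) * v x + ((γ * t - D * α * v i) * u x + (γ * D * v i - D * α * t) * v x)) uᵢ ⟩
      _      ≡⟨ cong (λ g → (D * (α * α) - g * g) * v x + ((g * α - D * α * v i) * u x + (g * D * v i - D * α * α) * v x)) vᵢ ⟩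
      _      ≡⟨ cancelled D α (v i) (v x) (u x) ⟩
      0ℤ     ∎
      where
      open ≡-Reasoning
      cancelled : ∀ D α vi vx ux → (D * (α * α) - (D * vi) * (D * vi)) * vx +
        (((D * vi) * α - D * α * vi) * ux + ((D * vi) * D * vi - D * α * α) * vx) ≡ 0ℤ
      cancelled = solve-∀

    -- Columns cleared earlier stay cleared: by symmetry of N, `v` and `u` vanish at j as well.
    N′-column : ∀ j → (∀ x → N x j ≡ 0ℤ) → ∀ x → N′ x j ≡ 0ℤ
    N′-column j Nⱼ≡0 x = begin
      N′ x j ≡⟨ cong (λ t → Δ * t + ((γ * u j - D * α * v j) * u x + (γ * D * v j - D * α * u j) * v x)) (Nⱼ≡0 x) ⟩
      _      ≡⟨ cong₂ (λ s t → Δ * 0ℤ + ((γ * s - D * α * t) * u x + (γ * D * t - D * α * s) * v x)) uⱼ vⱼ ⟩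
      _      ≡⟨ cancelled Δ γ D α (u x) (v x) ⟩
      0ℤ     ∎
      where
      open ≡-Reasoning
      vⱼ : v j ≡ 0ℤ
      vⱼ = trans (N-sym j i) (Nⱼ≡0 i)
      uⱼ : u j ≡ 0ℤ
      uⱼ = sum-zero λ x → trans (cong (_* v x) (trans (N-sym j x) (Nⱼ≡0 x))) (*-zeroˡ (v x))
      cancelled : ∀ Δ γ D α ux vx →
        Δ * 0ℤ + ((γ * 0ℤ - D * α * 0ℤ) * ux + (γ * D * 0ℤ - D * α * 0ℤ) * vx) ≡ 0ℤ
      cancelled = solve-∀

    N′-apply : ∀ w x → (N′ · w) x ≡ Δ * (N · w) x +
      ((γ * (u ∙ w) - D * α * (v ∙ w)) * u x + (γ * D * (v ∙ w) - D * α * (u ∙ w)) * v x)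
    N′-apply w x = begin
      (N′ · w) x
        ≡⟨ sum-cong-≗ (λ y → rearranged Δ (N x y) γ D α (u x) (u y) (v x) (v y) (w y)) ⟩
      _ ≡⟨ sum-linear₃ Δ (γ * u x - D * α * v x) (γ * D * v x - D * α * u x)
             (λ y → N x y * w y) (λ y → u y * w y) (λ y → v y * w y) ⟩
      _ ≡⟨ collected (Δ * (N · w) x) γ D α (u x) (v x) (u ∙ w) (v ∙ w) ⟩
      _ ∎
      where
      open ≡-Reasoning
      rearranged : ∀ Δ m γ D α ux uy vx vy w →
        (Δ * m + ((γ * uy - D * α * vy) * ux + (γ * D * vy - D * α * uy) * vx)) * w ≡
        Δ * (m * w) + ((γ * ux - D * α * vx) * (uy * w) + (γ * D * vx - D * α * ux) * (vy * w))
      rearranged = solve-∀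
      collected : ∀ m γ D α ux vx p q →
        m + ((γ * ux - D * α * vx) * p + (γ * D * vx - D * α * ux) * q) ≡
        m + ((γ * p - D * α * q) * ux + (γ * D * q - D * α * p) * vx)
      collected = solve-∀

    N′-apply-⊥ : ∀ w → v ∙ w ≡ 0ℤ → u ∙ w ≡ 0ℤ → ∀ x → (N′ · w) x ≡ Δ * (N · w) x
    N′-apply-⊥ w v⊥w u⊥w x = begin
      (N′ · w) x ≡⟨ N′-apply w x ⟩
      _ ≡⟨ cong₂ (λ p q → Δ * (N · w) x + ((γ * q - D * α * p) * u x + (γ * D * p - D * α * q) * v x)) v⊥w u⊥w ⟩
      _ ≡⟨ cancelled (Δ * (N · w) x) γ D α (u x) (v x) ⟩
      Δ * (N · w) x ∎
      where
      open ≡-Reasoning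
      cancelled : ∀ m γ D α ux vx →
        m + ((γ * 0ℤ - D * α * 0ℤ) * ux + (γ * D * 0ℤ - D * α * 0ℤ) * vx) ≡ m
      cancelled = solve-∀

    module _ (y : Fin n) where
      λᵤ μᵥ : ℤ
      λᵤ = γ * u y - D * α * v y
      μᵥ = γ * D * v y - D * α * u y

      col : Vector ℤ n
      col x = N′ x y

      v∙Ny : v ∙ (λ x → N x y) ≡ u y
      v∙Ny = trans (∙-comm v (λ x → N x y)) (sum-cong-≗ λ x → cong (_* v x) (N-sym x y))

      u∙Ny : u ∙ (λ x → N x y) ≡ D * v y
      u∙Ny = trans (trans (∙-comm u (λ x → N x y)) (sum-cong-≗ λ x → cong (_* u x) (N-sym x y))) (Nu y)

      v⊥col : v ∙ col ≡ 0ℤ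
      v⊥col = begin
        v ∙ col ≡⟨ ∙-linear₃ Δ λᵤ μᵥ v (λ x → N x y) u v ⟩
        Δ * (v ∙ (λ x → N x y)) + (λᵤ * γ + μᵥ * α) ≡⟨ cong (λ t → Δ * t + (λᵤ * γ + μᵥ * α)) v∙Ny ⟩
        _ ≡⟨ cancelled D α γ (u y) (v y) ⟩
        0ℤ ∎
        where
        open ≡-Reasoning
        cancelled : ∀ D α γ uy vy → (D * (α * α) - γ * γ) * uy +
          ((γ * uy - D * α * vy) * γ + (γ * D * vy - D * α * uy) * α) ≡ 0ℤ
        cancelled = solve-∀

      u⊥col : u ∙ col ≡ 0ℤ
      u⊥col = begin
        u ∙ col ≡⟨ ∙-linear₃ Δ λᵤ μᵥ u (λ x → N x y) u v ⟩
        Δ * (u ∙ (λ x → N x y)) + (λᵤ * (u ∙ u) + μᵥ * (u ∙ v))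
          ≡⟨ cong₂ (λ s t → Δ * s + (λᵤ * t + μᵥ * (u ∙ v))) u∙Ny u∙u ⟩
        _ ≡⟨ cong (λ t → Δ * (D * v y) + (λᵤ * (D * α) + μᵥ * t)) (∙-comm u v) ⟩
        _ ≡⟨ cancelled D α γ (u y) (v y) ⟩
        0ℤ ∎
        where
        open ≡-Reasoning
        cancelled : ∀ D α γ uy vy → (D * (α * α) - γ * γ) * (D * vy) +
          ((γ * uy - D * α * vy) * (D * α) + (γ * D * vy - D * α * uy) * γ) ≡ 0ℤ
        cancelled = solve-∀

      N-col : ∀ x → (N · col) x ≡ Δ * (N · (λ z → N z y)) x + (λᵤ * (D * v x) + μᵥ * u x)
      N-col x = trans (∙-linear₃ Δ λᵤ μᵥ (N x) (λ z → N z y) u v)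
        (cong (λ t → Δ * (N · (λ z → N z y)) x + (λᵤ * t + μᵥ * u x)) (Nu x))

      NN-col : ∀ x → (N · (N · col)) x ≡ D * col x
      NN-col x = begin
        (N · (N · col)) x ≡⟨ sum-cong-≗ (λ z → cong (N x z *_) (trans (N-col z) (cong (λ t → Δ * (N · (λ z → N z y)) z + (t + μᵥ * u z)) (sym (*-assoc λᵤ D (v z)))))) ⟩
        _ ≡⟨ ∙-linear₃ Δ (λᵤ * D) μᵥ (N x) (N · (λ z → N z y)) v u ⟩
        _ ≡⟨ cong₂ (λ s t → Δ * s + (λᵤ * D * u x + μᵥ * t)) (N³≡DN x y) (Nu x) ⟩
        _ ≡⟨ collected Δ D (N x y) λᵤ (u x) μᵥ (v x) ⟩
        D * col x ∎
        where
        open ≡-Reasoning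
        collected : ∀ Δ D m l u μ v →
          Δ * (D * m) + (l * D * u + μ * (D * v)) ≡ D * (Δ * m + (l * u + μ * v))
        collected = solve-∀

      ⊥-N· : ∀ t t′ → (∀ x → (N · t) x ≡ t′ x) → ∀ w → t′ ∙ w ≡ 0ℤ → t ∙ (N · w) ≡ 0ℤ
      ⊥-N· t t′ Nt w t′⊥w = trans (adjoint {M = N} N-sym t w)
        (trans (sum-cong-≗ λ x → cong (_* w x) (Nt x)) t′⊥w)

      Dv⊥col : (λ x → D * v x) ∙ col ≡ 0ℤ
      Dv⊥col = trans (sum-cong-≗ λ x → *-assoc D (v x) (col x))
        (trans (sym (*-distribˡ-sum D (λ x → v x * col x))) (trans (cong (D *_) v⊥col) (*-zeroʳ D)))

      scaled : ∀ m w x → (N · (λ z → m * w z)) x ≡ m * (N · w) x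
      scaled m w x = trans (sum-cong-≗ λ z → swap (N x z) m (w z))
        (sym (*-distribˡ-sum m (λ z → N x z * w z)))
        where
        swap : ∀ a b c → a * (b * c) ≡ b * (a * c)
        swap = solve-∀

      v⊥Ncol : v ∙ (N · col) ≡ 0ℤ
      v⊥Ncol = ⊥-N· v u (λ _ → refl) col u⊥col

      u⊥Ncol : u ∙ (N · col) ≡ 0ℤ
      u⊥Ncol = ⊥-N· u (λ x → D * v x) Nu col Dv⊥col

      -- Both `col` and `N · col` are orthogonal to `v` and `u`, where N′ acts as Δ N; and N² acts
      -- as D on the range of N, which contains `col`.
      N′N′col : ∀ x → (N′ · (N′ · col)) x ≡ Δ * Δ * D * col x
      N′N′col x = begin
        (N′ · (N′ · col)) x
          ≡⟨ sum-cong-≗ (λ z → cong (N′ x z *_) (N′-apply-⊥ col v⊥col u⊥col z)) ⟩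
        (N′ · (λ z → Δ * (N · col) z)) x
          ≡⟨ sum-cong-≗ (λ z → swap (N′ x z) Δ ((N · col) z)) ⟩
        sum (λ z → Δ * (N′ x z * (N · col) z))
          ≡⟨ *-distribˡ-sum Δ (λ z → N′ x z * (N · col) z) ⟨
        Δ * (N′ · (N · col)) x
          ≡⟨ cong (Δ *_) (N′-apply-⊥ (N · col) v⊥Ncol u⊥Ncol x) ⟩
        Δ * (Δ * (N · (N · col)) x)
          ≡⟨ cong (λ t → Δ * (Δ * t)) (NN-col x) ⟩
        Δ * (Δ * (D * col x))
          ≡⟨ collected Δ D (col x) ⟩
        Δ * Δ * D * col x ∎
        where
        open ≡-Reasoning
        swap : ∀ a b c → a * (b * c) ≡ b * (a * c)
        swap = solve-∀
        collected : ∀ Δ D c → Δ * (Δ * (D * c)) ≡ Δ * Δ * D * c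
        collected = solve-∀

    -- The correction terms contribute γ (u ∙ u + D α) - 2 D α γ to the trace, and u ∙ u = D α.
    trace-N′ : trace N′ ≡ Δ * trace N
    trace-N′ = begin
      trace N′ ≡⟨ sum-cong-≗ (λ x → rearranged Δ (N x x) γ D α (u x) (v x)) ⟩
      _ ≡⟨ sum-linear₃ Δ γ (- (D * α)) (λ x → N x x) (λ x → u x * u x + D * (v x * v x)) (λ x → v x * u x + u x * v x) ⟩
      _ ≡⟨ cong₂ (λ s t → Δ * trace N + (γ * s + - (D * α) * t))
             (trans (∑-distrib-+ (λ x → u x * u x) (λ x → D * (v x * v x)))
               (cong₂ _+_ u∙u (sym (*-distribˡ-sum D (λ x → v x * v x)))))
             (trans (∑-distrib-+ (λ x → v x * u x) (λ x → u x * v x)) (cong (_+_ γ) (∙-comm u v))) ⟩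
      Δ * trace N + (γ * (D * α + D * α) + - (D * α) * (γ + γ))
        ≡⟨ cancelled (Δ * trace N) γ D α ⟩
      Δ * trace N ∎
      where
      open ≡-Reasoning
      rearranged : ∀ Δ m γ D α u v →
        Δ * m + ((γ * u - D * α * v) * u + (γ * D * v - D * α * u) * v) ≡
        Δ * m + (γ * (u * u + D * (v * v)) + - (D * α) * (v * u + u * v))
      rearranged = solve-∀
      cancelled : ∀ m γ D α → m + (γ * (D * α + D * α) + - (D * α) * (γ + γ)) ≡ m
      cancelled = solve-∀

  -- `Nonsquare` denies that D is the square of a rational number, a property shared by m² D. The
  -- constant Δ² D of the deflated matrix is therefore again admissible.
  nonsquare-scaled : ∀ {D m} → m ≢ 0ℤ → Nonsquare D → Nonsquare (m * m * D)
  nonsquare-scaled {D} {m} m≢0 ns i j i≢0 eq = ns (m * i) j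
    (λ mi≡0 → case-⊥ (i*j≡0⇒i≡0∨j≡0 m mi≡0))
    (trans (rearranged D m i) eq)
    where
    case-⊥ : m ≡ 0ℤ ⊎ i ≡ 0ℤ → ⊥
    case-⊥ (inj₁ m≡0) = m≢0 m≡0
    case-⊥ (inj₂ i≡0) = i≢0 i≡0
    rearranged : ∀ D m i → D * ((m * i) * (m * i)) ≡ m * m * D * (i * i)
    rearranged = solve-∀

  square-sum-zero : ∀ {n} (v : Vector ℤ n) → v ∙ v ≡ 0ℤ → ∀ x → v x ≡ 0ℤ
  square-sum-zero v v∙v≡0 x with v x ≟ᶻ 0ℤ
  ... | yes vx≡0 = vx≡0
  ... | no  vx≢0 = contradiction
    (<-≤-trans (sq-pos vx≢0) (term≤sum (λ y → v y * v y) (λ y → 0≤sq (v y)) x))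
    (λ 0<s → <-irrefl (sym v∙v≡0) 0<s)

  -- A symmetric matrix with N³ = D N has its eigenvalues among 0 and ±√D, and the
  -- conjugates √D and -√D are equally frequent when D is not a square.
  trace-zero : ∀ {n} (N : Square n) → (∀ x y → N x y ≡ N y x) → ∀ D →
    (∀ x y → (N · (N · (λ z → N z y))) x ≡ D * N x y) → Nonsquare D → trace N ≡ 0ℤ
  trace-zero {n} N N-sym D N³≡DN ns = go (allFin n) N N-sym D N³≡DN ns (λ j → inj₁ (∈-allFin j))
    where
    -- The list `js` contains every column that may still be nonzero, and it shrinks at each step. N
    -- and D change under deflation, hence the generalisation over them.
    go : ∀ js (N : Square n) → (∀ x y → N x y ≡ N y x) → ∀ D →
      (∀ x y → (N · (N · (λ z → N z y))) x ≡ D * N x y) → Nonsquare D →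
      (∀ j → j List.∈ js ⊎ (∀ x → N x j ≡ 0ℤ)) → trace N ≡ 0ℤ
    go [] N N-sym D N³≡DN ns columns = sum-zero λ x → diagonal x (columns x)
      where
      diagonal : ∀ x → x List.∈ [] ⊎ (∀ y → N y x ≡ 0ℤ) → N x x ≡ 0ℤ
      diagonal x (inj₂ Nx≡0) = Nx≡0 x
    go (i ∷ js) N N-sym D N³≡DN ns columns
      with (λ x → N x i) ∙ (λ x → N x i) ≟ᶻ 0ℤ
    ... | yes α≡0 = go js N N-sym D N³≡DN ns λ j → shorter j (columns j)
      where
      shorter : ∀ j → j List.∈ i ∷ js ⊎ (∀ x → N x j ≡ 0ℤ) → j List.∈ js ⊎ (∀ x → N x j ≡ 0ℤ)
      shorter j (inj₁ (here refl)) = inj₂ (square-sum-zero (λ x → N x i) α≡0)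
      shorter j (inj₁ (there j∈js)) = inj₁ j∈js
      shorter j (inj₂ Nj≡0)         = inj₂ Nj≡0
    ... | no α≢0 = trace≡0 (i*j≡0⇒i≡0∨j≡0 Δ (trans (sym trace-N′)
          (go js N′ N′-sym (Δ * Δ * D) (λ x y → N′N′col y x) (nonsquare-scaled {D} Δ≢0 ns)
            (λ j → shorter j (columns j)))))
      where
      open Deflation N N-sym D N³≡DN i
      Δ≢0 : Δ ≢ 0ℤ
      Δ≢0 Δ≡0 = ns α γ α≢0 (i-j≡0⇒i≡j (D * (α * α)) (γ * γ) Δ≡0)
      trace≡0 : Δ ≡ 0ℤ ⊎ trace N ≡ 0ℤ → trace N ≡ 0ℤ
      trace≡0 (inj₁ Δ≡0) = contradiction Δ≡0 Δ≢0
      trace≡0 (inj₂ t≡0) = t≡0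
      shorter : ∀ j → j List.∈ i ∷ js ⊎ (∀ x → N x j ≡ 0ℤ) → j List.∈ js ⊎ (∀ x → N′ x j ≡ 0ℤ)
      shorter j (inj₁ (here refl))  = inj₂ N′-column-i
      shorter j (inj₁ (there j∈js)) = inj₁ j∈js
      shorter j (inj₂ Nj≡0)         = inj₂ (N′-column j Nj≡0)

  indicator : ∀ {n} {g : Vector ℤ n} i → g i ≡ 1ℤ → (∀ j → j ≢ i → g j ≡ 0ℤ) → sum g ≡ 1ℤ
  indicator {ℕ.suc n} zero    gᵢ g₀ = cong₂ _+_ gᵢ (sum-zero λ j → g₀ (suc j) λ ())
  indicator {ℕ.suc n} (suc i) gᵢ g₀ = cong₂ _+_ (g₀ zero λ ())
    (indicator i gᵢ λ j j≢i → g₀ (suc j) λ eq → j≢i (Fin.suc-injective eq))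

  i<j⇒0<j-i : ∀ {i j} → i < j → 0ℤ < j - i
  i<j⇒0<j-i {i} {j} i<j = subst (_< j - i) (+-inverseʳ i) (+-monoˡ-< (- i) i<j)

  -- The Bose–Mesner algebra

  Profile : Set
  Profile = Fin 4 → ℤ

  profile : ℤ → ℤ → ℤ → ℤ → Profile
  profile f₀ f₁ f₂ f₃ 0F = f₀
  profile f₀ f₁ f₂ f₃ 1F = f₁
  profile f₀ f₁ f₂ f₃ 2F = f₂
  profile f₀ f₁ f₂ f₃ 3F = f₃

  δ₀ δ₁ δ₂ δ₃ : Profile
  δ₀ = profile 1ℤ 0ℤ 0ℤ 0ℤ
  δ₁ = profile 0ℤ 1ℤ 0ℤ 0ℤ
  δ₂ = profile 0ℤ 0ℤ 1ℤ 0ℤ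
  δ₃ = profile 0ℤ 0ℤ 0ℤ 1ℤ

  unit : Fin 4 → Profile
  unit 0F = δ₀
  unit 1F = δ₁
  unit 2F = δ₂
  unit 3F = δ₃

  unit-diagonal : ∀ j → unit j j ≡ 1ℤ
  unit-diagonal 0F = refl
  unit-diagonal 1F = refl
  unit-diagonal 2F = refl
  unit-diagonal 3F = refl

  unit-off : ∀ j l → l ≢ j → unit j l ≡ 0ℤ
  unit-off 0F 0F l≢j = contradiction refl l≢j
  unit-off 0F 1F _   = refl
  unit-off 0F 2F _   = refl
  unit-off 0F 3F _   = refl
  unit-off 1F 0F _   = refl
  unit-off 1F 1F l≢j = contradiction refl l≢j
  unit-off 1F 2F _   = refl
  unit-off 1F 3F _   = refl
  unit-off 2F 0F _   = refl
  unit-off 2F 1F _   = refl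
  unit-off 2F 2F l≢j = contradiction refl l≢j
  unit-off 2F 3F _   = refl
  unit-off 3F 0F _   = refl
  unit-off 3F 1F _   = refl
  unit-off 3F 2F _   = refl
  unit-off 3F 3F l≢j = contradiction refl l≢j

  unit-cases : ∀ j l → (l ≡ j × unit j l ≡ 1ℤ) ⊎ unit j l ≡ 0ℤ
  unit-cases j l with l Fin.≟ j
  ... | yes refl = inj₁ (refl , unit-diagonal j)
  ... | no  l≢j  = inj₂ (unit-off j l l≢j)

  0≤unit : ∀ j l → 0ℤ ≤ unit j l
  0≤unit j l with unit-cases j l
  ... | inj₁ (_ , p) = subst (0ℤ ≤_) (sym p) (+≤+ ℕ.z≤n)
  ... | inj₂ p       = subst (0ℤ ≤_) (sym p) (+≤+ ℕ.z≤n)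

  unit-expand : ∀ (f : Profile) l →
    f l ≡ f 0F * δ₀ l + f 1F * δ₁ l + (f 2F * δ₂ l + f 3F * δ₃ l)
  unit-expand f 0F = go (f 0F) (f 1F) (f 2F) (f 3F)
    where go : ∀ p q t v → p ≡ p * 1ℤ + q * 0ℤ + (t * 0ℤ + v * 0ℤ)
          go = solve-∀
  unit-expand f 1F = go (f 0F) (f 1F) (f 2F) (f 3F)
    where go : ∀ p q t v → q ≡ p * 0ℤ + q * 1ℤ + (t * 0ℤ + v * 0ℤ)
          go = solve-∀
  unit-expand f 2F = go (f 0F) (f 1F) (f 2F) (f 3F)
    where go : ∀ p q t v → t ≡ p * 0ℤ + q * 0ℤ + (t * 1ℤ + v * 0ℤ)
          go = solve-∀
  unit-expand f 3F = go (f 0F) (f 1F) (f 2F) (f 3F)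
    where go : ∀ p q t v → v ≡ p * 0ℤ + q * 0ℤ + (t * 0ℤ + v * 1ℤ)
          go = solve-∀

  tridiagonal : (k a₁ b₁ c₂ a₂ b₂ c₃ a₃ : ℤ) → Profile → Profile
  tridiagonal k a₁ b₁ c₂ a₂ b₂ c₃ a₃ f =
    profile (k * f 1F)
            (f 0F + a₁ * f 1F + b₁ * f 2F)
            (c₂ * f 1F + a₂ * f 2F + b₂ * f 3F)
            (c₃ * f 2F + a₃ * f 3F)

  tridiagonal-linear : ∀ k a₁ b₁ c₂ a₂ b₂ c₃ a₃ → let L = tridiagonal k a₁ b₁ c₂ a₂ b₂ c₃ a₃ in
    ∀ i j f g l → L (λ l → i * f l + j * g l) l ≡ i * L f l + j * L g l
  tridiagonal-linear k a₁ b₁ c₂ a₂ b₂ c₃ a₃ i j f g = λ where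
      0F → e₀ k i j (f 1F) (g 1F)
      1F → e₁ a₁ b₁ i j (f 0F) (f 1F) (f 2F) (g 0F) (g 1F) (g 2F)
      2F → e₂ c₂ a₂ b₂ i j (f 1F) (f 2F) (f 3F) (g 1F) (g 2F) (g 3F)
      3F → e₃ c₃ a₃ i j (f 2F) (f 3F) (g 2F) (g 3F)
    where
    e₀ : ∀ k i j f g → k * (i * f + j * g) ≡ i * (k * f) + j * (k * g)
    e₀ = solve-∀
    e₁ : ∀ a₁ b₁ i j f₀ f₁ f₂ g₀ g₁ g₂ →
      (i * f₀ + j * g₀) + a₁ * (i * f₁ + j * g₁) + b₁ * (i * f₂ + j * g₂) ≡
      i * (f₀ + a₁ * f₁ + b₁ * f₂) + j * (g₀ + a₁ * g₁ + b₁ * g₂)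
    e₁ = solve-∀
    e₂ : ∀ c₀ a₁ b₁ i j f₀ f₁ f₂ g₀ g₁ g₂ →
      c₀ * (i * f₀ + j * g₀) + a₁ * (i * f₁ + j * g₁) + b₁ * (i * f₂ + j * g₂) ≡
      i * (c₀ * f₀ + a₁ * f₁ + b₁ * f₂) + j * (c₀ * g₀ + a₁ * g₁ + b₁ * g₂)
    e₂ = solve-∀
    e₃ : ∀ c₃ a₃ i j f₂ f₃ g₂ g₃ → c₃ * (i * f₂ + j * g₂) + a₃ * (i * f₃ + j * g₃) ≡
      i * (c₃ * f₂ + a₃ * f₃) + j * (c₃ * g₂ + a₃ * g₃)
    e₃ = solve-∀

  tridiagonal-cong : ∀ k a₁ b₁ c₂ a₂ b₂ c₃ a₃ → let L = tridiagonal k a₁ b₁ c₂ a₂ b₂ c₃ a₃ in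
    ∀ {f g} → (∀ l → f l ≡ g l) → ∀ l → L f l ≡ L g l
  tridiagonal-cong k a₁ b₁ c₂ a₂ b₂ c₃ a₃ f≡g = λ where
    0F → cong (k *_) (f≡g 1F)
    1F → cong₂ (λ s t → s + b₁ * t) (cong₂ (λ s t → s + a₁ * t) (f≡g 0F) (f≡g 1F)) (f≡g 2F)
    2F → cong₂ (λ s t → s + b₂ * t) (cong₂ (λ s t → c₂ * s + a₂ * t) (f≡g 1F) (f≡g 2F)) (f≡g 3F)
    3F → cong₂ (λ s t → c₃ * s + a₃ * t) (f≡g 2F) (f≡g 3F)

  -- The eigenvector equation for a₃ determines the vector below up to a scalar; it holds up
  -- to a multiple of δ₀.
  tridiagonal-defect : ∀ k a₁ b₁ c₂ a₂ b₂ c₃ a₃ →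
    let f = profile ((a₃ - a₁) * b₂) b₂ 0ℤ (- c₂) in ∀ l →
    tridiagonal k a₁ b₁ c₂ a₂ b₂ c₃ a₃ f l ≡ a₃ * f l + b₂ * (k - a₃ * (a₃ - a₁)) * δ₀ l
  tridiagonal-defect k a₁ b₁ c₂ a₂ b₂ c₃ a₃ = λ where
      0F → e₀ k a₁ a₃ b₂
      1F → e₁ a₁ a₃ b₁ b₂ (b₂ * (k - a₃ * (a₃ - a₁)))
      2F → e₂ a₂ a₃ b₂ c₂ (b₂ * (k - a₃ * (a₃ - a₁)))
      3F → e₃ a₃ c₂ c₃ (b₂ * (k - a₃ * (a₃ - a₁)))
    where
    e₀ : ∀ k a₁ a₃ β → k * β ≡ a₃ * ((a₃ - a₁) * β) + β * (k - a₃ * (a₃ - a₁)) * 1ℤ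
    e₀ = solve-∀
    e₁ : ∀ a₁ a₃ b₁ β m → (a₃ - a₁) * β + a₁ * β + b₁ * 0ℤ ≡ a₃ * β + m * 0ℤ
    e₁ = solve-∀
    e₂ : ∀ a₂ a₃ β c m → c * β + a₂ * 0ℤ + β * (- c) ≡ a₃ * 0ℤ + m * 0ℤ
    e₂ = solve-∀
    e₃ : ∀ a₃ c c₃ m → c₃ * 0ℤ + a₃ * (- c) ≡ a₃ * (- c) + m * 0ℤ
    e₃ = solve-∀

  -- The intersection matrix of a graph with k = b a₃ and a₁ = a₃ - b, writing a, β, c
  -- for a₃, b₂, c₂.
  shillaMatrix : (a b β c : ℤ) → Profile → Profile
  shillaMatrix a b β c = tridiagonal
    (a * b) (a - b) ((b - 1ℤ) * (a + 1ℤ)) c (a * b - β - c) β ((b - 1ℤ) * a) a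

  -- x² - s x + r is the quadratic whose roots are θ₂ and θ₃, and u⁰ + x u¹ is, up to a
  -- scalar, the sequence of the eigenvalue x: u⁰ and u¹ span the kernel V of L² - s L + r.
  module Spectral (a b β c : ℤ) where

    L : Profile → Profile
    L = shillaMatrix a b β c

    L-linear : ∀ i j f g l → L (λ l → i * f l + j * g l) l ≡ i * L f l + j * L g l
    L-linear = tridiagonal-linear
      (a * b) (a - b) ((b - 1ℤ) * (a + 1ℤ)) c (a * b - β - c) β ((b - 1ℤ) * a) a

    L-cong : ∀ {f g} → (∀ l → f l ≡ g l) → ∀ l → L f l ≡ L g l
    L-cong = tridiagonal-cong
      (a * b) (a - b) ((b - 1ℤ) * (a + 1ℤ)) c (a * b - β - c) β ((b - 1ℤ) * a) a

    s r X e : ℤ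
    s = a - b - (β + c)
    r = b * β + c - a * b
    X = β + c
    e = b * β + c

    e₁ : Profile
    e₁ = profile (b * β) β 0ℤ (- c)

    -- For a root x of the quadratic the entries of u⁰ + x u¹ are k b₁, b₁ x, (x - a) (x + b) and a
    -- (b - 1) (x + b), with k = a b and b₁ = (a + 1) (b - 1). They solve the three-term recurrence;
    -- the third has been reduced modulo the quadratic to make it linear in x.
    u⁰ u¹ : Profile
    u⁰ = profile (a * b * ((a + 1ℤ) * (b - 1ℤ))) 0ℤ (- (b * β + c)) (a * b * (b - 1ℤ))
    u¹ = profile 0ℤ ((a + 1ℤ) * (b - 1ℤ)) (- (β + c)) (a * (b - 1ℤ))

    L-e₁ : ∀ l → L e₁ l ≡ a * e₁ l
    L-e₁ 0F = go a b β
      where go : ∀ a b β → a * b * β ≡ a * (b * β)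
            go = solve-∀
    L-e₁ 1F = go a b β
      where go : ∀ a b β → b * β + (a - b) * β + (b - 1ℤ) * (a + 1ℤ) * 0ℤ ≡ a * β
            go = solve-∀
    L-e₁ 2F = go a b β c
      where go : ∀ a b β c → c * β + (a * b - β - c) * 0ℤ + β * (- c) ≡ a * 0ℤ
            go = solve-∀
    L-e₁ 3F = go a b c
      where go : ∀ a b c → (b - 1ℤ) * a * 0ℤ + a * (- c) ≡ a * (- c)
            go = solve-∀

    -- Together with `L-u¹` this says that L acts on V as a companion matrix of the quadratic, so
    -- that its restriction to V depends on s and r alone.
    L-u⁰ : ∀ l → L u⁰ l ≡ - r * u¹ l
    L-u⁰ 0F = go a b β c
      where go : ∀ a b β c → a * b * 0ℤ ≡ - (b * β + c - a * b) * 0ℤ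
            go = solve-∀
    L-u⁰ 1F = go a b β c
      where go : ∀ a b β c → a * b * ((a + 1ℤ) * (b - 1ℤ)) + (a - b) * 0ℤ + (b - 1ℤ) * (a + 1ℤ) * (- (b * β + c))
                   ≡ - (b * β + c - a * b) * ((a + 1ℤ) * (b - 1ℤ))
            go = solve-∀
    L-u⁰ 2F = go a b β c
      where go : ∀ a b β c → c * 0ℤ + (a * b - β - c) * (- (b * β + c)) + β * (a * b * (b - 1ℤ))
                   ≡ - (b * β + c - a * b) * (- (β + c))
            go = solve-∀
    L-u⁰ 3F = go a b β c
      where go : ∀ a b β c → (b - 1ℤ) * a * (- (b * β + c)) + a * (a * b * (b - 1ℤ))
                   ≡ - (b * β + c - a * b) * (a * (b - 1ℤ))
            go = solve-∀

    L-u¹ : ∀ l → L u¹ l ≡ u⁰ l + s * u¹ l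
    L-u¹ 0F = go a b β c
      where go : ∀ a b β c → a * b * ((a + 1ℤ) * (b - 1ℤ))
                   ≡ a * b * ((a + 1ℤ) * (b - 1ℤ)) + (a - b - (β + c)) * 0ℤ
            go = solve-∀
    L-u¹ 1F = go a b β c
      where go : ∀ a b β c → 0ℤ + (a - b) * ((a + 1ℤ) * (b - 1ℤ)) + (b - 1ℤ) * (a + 1ℤ) * (- (β + c))
                   ≡ 0ℤ + (a - b - (β + c)) * ((a + 1ℤ) * (b - 1ℤ))
            go = solve-∀
    L-u¹ 2F = go a b β c
      where go : ∀ a b β c → c * ((a + 1ℤ) * (b - 1ℤ)) + (a * b - β - c) * (- (β + c)) + β * (a * (b - 1ℤ))
                   ≡ - (b * β + c) + (a - b - (β + c)) * (- (β + c))
            go = solve-∀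
    L-u¹ 3F = go a b β c
      where go : ∀ a b β c → (b - 1ℤ) * a * (- (β + c)) + a * (a * (b - 1ℤ))
                   ≡ a * b * (b - 1ℤ) + (a - b - (β + c)) * (a * (b - 1ℤ))
            go = solve-∀

    infix 8 _u⁰+_u¹
    _u⁰+_u¹ : ℤ → ℤ → Profile
    (i u⁰+ j u¹) l = i * u⁰ l + j * u¹ l

    L-V : ∀ i j l → L (i u⁰+ j u¹) l ≡ (j u⁰+ (s * j - r * i) u¹) l
    L-V i j l = begin
      L (i u⁰+ j u¹) l            ≡⟨ L-linear i j u⁰ u¹ l ⟩
      i * L u⁰ l + j * L u¹ l     ≡⟨ cong₂ (λ x y → i * x + j * y) (L-u⁰ l) (L-u¹ l) ⟩
      _                           ≡⟨ go i j r s (u⁰ l) (u¹ l) ⟩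
      (j u⁰+ (s * j - r * i) u¹) l ∎
      where
      open ≡-Reasoning
      go : ∀ i j r s x y → i * (- r * y) + j * (x + s * y) ≡ j * x + (s * j - r * i) * y
      go = solve-∀

    -- h = (L² - s L + r) δ₀
    h 𝟙 : Profile
    h   = profile e X c 0ℤ
    𝟙 _ = 1ℤ

    -- With `h-δ₀` and `L-𝟙` this gives (L - k) (L - a) (L² - s L + r) δ₀ = 0, where k = a b. An
    -- eigenvalue other than k and a must therefore be a root of the quadratic.
    L-h : ∀ l → L h l ≡ a * h l + a * (b - 1ℤ) * c * 𝟙 l
    L-h 0F = go a b β c
      where go : ∀ a b β c → a * b * (β + c) ≡ a * (b * β + c) + a * (b - 1ℤ) * c * 1ℤ
            go = solve-∀
    L-h 1F = go a b β c
      where go : ∀ a b β c → b * β + c + (a - b) * (β + c) + (b - 1ℤ) * (a + 1ℤ) * c ≡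
                   a * (β + c) + a * (b - 1ℤ) * c * 1ℤ
            go = solve-∀
    L-h 2F = go a b β c
      where go : ∀ a b β c → c * (β + c) + (a * b - β - c) * c + β * 0ℤ ≡ a * c + a * (b - 1ℤ) * c * 1ℤ
            go = solve-∀
    L-h 3F = go a b c
      where go : ∀ a b c → (b - 1ℤ) * a * c + a * 0ℤ ≡ a * 0ℤ + a * (b - 1ℤ) * c * 1ℤ
            go = solve-∀

    -- The summand `0ℤ * 0ℤ` gives the equation the shape i f + m g that `eigenprofile` takes, with
    -- g = 0.
    L-𝟙 : ∀ l → L 𝟙 l ≡ a * b * 𝟙 l + 0ℤ * 0ℤ
    L-𝟙 0F = go a b
      where go : ∀ a b → a * b * 1ℤ ≡ a * b * 1ℤ + 0ℤ * 0ℤ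
            go = solve-∀
    L-𝟙 1F = go a b
      where go : ∀ a b → 1ℤ + (a - b) * 1ℤ + (b - 1ℤ) * (a + 1ℤ) * 1ℤ ≡ a * b * 1ℤ + 0ℤ * 0ℤ
            go = solve-∀
    L-𝟙 2F = go a b β c
      where go : ∀ a b β c → c * 1ℤ + (a * b - β - c) * 1ℤ + β * 1ℤ ≡ a * b * 1ℤ + 0ℤ * 0ℤ
            go = solve-∀
    L-𝟙 3F = go a b
      where go : ∀ a b → (b - 1ℤ) * a * 1ℤ + a * 1ℤ ≡ a * b * 1ℤ + 0ℤ * 0ℤ
            go = solve-∀

    L-δ₀ : ∀ l → L δ₀ l ≡ δ₁ l
    L-δ₀ 0F = *-zeroʳ (a * b)
    L-δ₀ 1F = go a b
      where go : ∀ a b → 1ℤ + (a - b) * 0ℤ + (b - 1ℤ) * (a + 1ℤ) * 0ℤ ≡ 1ℤ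
            go = solve-∀
    L-δ₀ 2F = go a b β c
      where go : ∀ a b β c → c * 0ℤ + (a * b - β - c) * 0ℤ + β * 0ℤ ≡ 0ℤ
            go = solve-∀
    L-δ₀ 3F = go a b
      where go : ∀ a b → (b - 1ℤ) * a * 0ℤ + a * 0ℤ ≡ 0ℤ
            go = solve-∀

    L-δ₁ : ∀ l → 1ℤ * L δ₁ l + r * δ₀ l ≡ s * δ₁ l + 1ℤ * h l
    L-δ₁ 0F = go a b β c
      where go : ∀ a b β c → 1ℤ * (a * b * 1ℤ) + (b * β + c - a * b) * 1ℤ ≡
                   (a - b - (β + c)) * 0ℤ + 1ℤ * (b * β + c)
            go = solve-∀
    L-δ₁ 1F = go a b β c
      where go : ∀ a b β c → 1ℤ * (0ℤ + (a - b) * 1ℤ + (b - 1ℤ) * (a + 1ℤ) * 0ℤ) + (b * β + c - a * b) * 0ℤ ≡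
                   (a - b - (β + c)) * 1ℤ + 1ℤ * (β + c)
            go = solve-∀
    L-δ₁ 2F = go a b β c
      where go : ∀ a b β c → 1ℤ * (c * 1ℤ + (a * b - β - c) * 0ℤ + β * 0ℤ) + (b * β + c - a * b) * 0ℤ ≡
                   (a - b - (β + c)) * 0ℤ + 1ℤ * c
            go = solve-∀
    L-δ₁ 3F = go a b β c
      where go : ∀ a b β c → 1ℤ * ((b - 1ℤ) * a * 0ℤ + a * 0ℤ) + (b * β + c - a * b) * 0ℤ ≡
                   (a - b - (β + c)) * 0ℤ + 1ℤ * 0ℤ
            go = solve-∀

    h-δ₀ : ∀ l → 1ℤ * L (L δ₀) l + r * δ₀ l ≡ s * L δ₀ l + 1ℤ * h l
    h-δ₀ l = trans (cong (λ t → 1ℤ * t + r * δ₀ l) (L-cong L-δ₀ l))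
      (trans (L-δ₁ l) (cong (λ t → s * t + 1ℤ * h l) (sym (L-δ₀ l))))

    quadratic-at-b : - b * - b - s * - b + r ≡ - (c * (b - 1ℤ))
    quadratic-at-b = go a b β c
      where
      go : ∀ a b β c → - b * - b - (a - b - (β + c)) * - b + (b * β + c - a * b) ≡ - (c * (b - 1ℤ))
      go = solve-∀

  -- M f is the element Σ fᵢ Aᵢ of the Bose–Mesner algebra; A M f = M (L f).
  record IsScheme {n : ℕ} (d : Fin n → Fin n → Fin 4) (L : Profile → Profile) : Set where
    field
      d-sym  : ∀ x y → d x y ≡ d y x
      d-refl : ∀ x → d x x ≡ 0F
      d-zero : ∀ x y → d x y ≡ 0F → x ≡ y
      A·M    : ∀ f x y → ∑[ z < n ] (δ₁ (d x z) * f (d z y)) ≡ L f (d x y)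

  module BoseMesner {n : ℕ} {d : Fin n → Fin n → Fin 4} {a b β c : ℤ}
    (scheme : IsScheme d (shillaMatrix a b β c))
    (0<a : 0ℤ < a) (1<b : 1ℤ < b) (0<β : 0ℤ < β) (0<c : 0ℤ < c) where

    open IsScheme scheme public
    open Spectral a b β c public

    M : Profile → Square n
    M f x y = f (d x y)

    M-sym : ∀ f x y → M f x y ≡ M f y x
    M-sym f x y = cong f (d-sym x y)

    -- M g M f = M h
    record Acts (g f h : Profile) : Set where
      constructor mkActs
      field
        product : ∀ x y → ∑[ z < n ] (g (d x z) * f (d z y)) ≡ h (d x y)

    open Acts public

    acts-congˡ : ∀ {g g′ f h} → (∀ l → g l ≡ g′ l) → Acts g f h → Acts g′ f h
    acts-congˡ {f = f} g≡ acts .product x y = trans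
      (sum-cong-≗ λ z → cong (_* f (d z y)) (sym (g≡ (d x z)))) (product acts x y)

    acts-congʳ : ∀ {g f h h′} → (∀ l → h l ≡ h′ l) → Acts g f h → Acts g f h′
    acts-congʳ h≡ acts .product x y = trans (product acts x y) (h≡ (d x y))

    acts-linear : ∀ i j {g g′ f h h′} → Acts g f h → Acts g′ f h′ →
      Acts (λ l → i * g l + j * g′ l) f (λ l → i * h l + j * h′ l)
    acts-linear i j {g} {g′} {f} acts acts′ .product x y = begin
      sum (λ z → (i * g (d x z) + j * g′ (d x z)) * f (d z y))
        ≡⟨ sum-cong-≗ (λ z → go i j (g (d x z)) (g′ (d x z)) (f (d z y))) ⟩
      _ ≡⟨ sum-linear i j (λ z → g (d x z) * f (d z y)) (λ z → g′ (d x z) * f (d z y)) ⟩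
      _ ≡⟨ cong₂ (λ s t → i * s + j * t) (product acts x y) (product acts′ x y) ⟩
      _ ∎
      where
      open ≡-Reasoning
      go : ∀ i j g g′ f → (i * g + j * g′) * f ≡ i * (g * f) + j * (g′ * f)
      go = solve-∀

    acts-cancel : ∀ {m g f h} → 0ℤ < m →
      Acts (λ l → m * g l) f (λ l → m * h l) → Acts g f h
    acts-cancel {m} {g} {f} 0<m acts .product x y = *-cancel-pos-≡ 0<m (begin
      m * sum (λ z → g (d x z) * f (d z y))
        ≡⟨ *-distribˡ-sum m (λ z → g (d x z) * f (d z y)) ⟩
      sum (λ z → m * (g (d x z) * f (d z y)))
        ≡⟨ sum-cong-≗ (λ z → *-assoc m (g (d x z)) (f (d z y))) ⟨
      _ ≡⟨ product acts x y ⟩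
      _ ∎)
      where open ≡-Reasoning

    δ₀-diagonal : ∀ x z → δ₀ (d x z) ≢ 0ℤ → x ≡ z
    δ₀-diagonal x z δ≢0 with d x z in eq
    ... | 0F = d-zero x z eq
    ... | 1F = contradiction refl δ≢0
    ... | 2F = contradiction refl δ≢0
    ... | 3F = contradiction refl δ≢0

    sum-δ₀ : ∀ (f : Vector ℤ n) x → sum (λ z → δ₀ (d x z) * f z) ≡ f x
    sum-δ₀ f x = begin
      sum (λ z → δ₀ (d x z) * f z)   ≡⟨ sum-cong-≗ at-x ⟩
      sum (λ z → δ₀ (d x z) * f x)   ≡⟨ *-distribʳ-sum (f x) (λ z → δ₀ (d x z)) ⟨
      sum (λ z → δ₀ (d x z)) * f x   ≡⟨ cong (_* f x) one ⟩
      1ℤ * f x                       ≡⟨ *-identityˡ (f x) ⟩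
      f x                            ∎
      where
      open ≡-Reasoning
      at-x : ∀ z → δ₀ (d x z) * f z ≡ δ₀ (d x z) * f x
      at-x z with δ₀ (d x z) ≟ᶻ 0ℤ
      ... | yes δ≡0 = trans (cong (_* f z) δ≡0) (cong (_* f x) (sym δ≡0))
      ... | no  δ≢0 = cong (λ y → δ₀ (d x z) * f y) (sym (δ₀-diagonal x z δ≢0))
      one : sum (λ z → δ₀ (d x z)) ≡ 1ℤ
      one = indicator x (cong δ₀ (d-refl x)) λ z z≢x → zero-off z (λ x≡z → z≢x (sym x≡z))
        where
        zero-off : ∀ z → x ≢ z → δ₀ (d x z) ≡ 0ℤ
        zero-off z x≢z with δ₀ (d x z) ≟ᶻ 0ℤ
        ... | yes δ≡0 = δ≡0
        ... | no  δ≢0 = contradiction (δ₀-diagonal x z δ≢0) x≢z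

    acts-δ₀ : ∀ f → Acts δ₀ f f
    acts-δ₀ f .product x y = sum-δ₀ (λ z → f (d z y)) x

    -- Associativity, (A M g) M f = A (M g M f), read through `A·M`. Since A generates the algebra,
    -- the products below all come from it.
    acts-L : ∀ {g f h} → Acts g f h → Acts (L g) f (L h)
    acts-L {g} {f} {h} acts .product x y = begin
      sum (λ z → L g (d x z) * f (d z y))
        ≡⟨ sum-cong-≗ (λ z → trans (cong (_* f (d z y)) (sym (A·M g x z)))
             (*-distribʳ-sum (f (d z y)) (λ w → δ₁ (d x w) * g (d w z)))) ⟩
      sum (λ z → sum (λ w → δ₁ (d x w) * g (d w z) * f (d z y)))
        ≡⟨ ∑-comm (λ z w → δ₁ (d x w) * g (d w z) * f (d z y)) ⟩
      sum (λ w → sum (λ z → δ₁ (d x w) * g (d w z) * f (d z y)))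
        ≡⟨ sum-cong-≗ (λ w → trans (sum-cong-≗ λ z → *-assoc (δ₁ (d x w)) (g (d w z)) (f (d z y)))
             (sym (*-distribˡ-sum (δ₁ (d x w)) (λ z → g (d w z) * f (d z y))))) ⟩
      sum (λ w → δ₁ (d x w) * sum (λ z → g (d w z) * f (d z y)))
        ≡⟨ sum-cong-≗ (λ w → cong (δ₁ (d x w) *_) (product acts w y)) ⟩
      sum (λ w → δ₁ (d x w) * h (d w y))
        ≡⟨ A·M h x y ⟩
      L h (d x y) ∎
      where open ≡-Reasoning

    acts-δ₁ : ∀ f → Acts δ₁ f (L f)
    acts-δ₁ f .product x y = A·M f x y

    -- From c₂ A₂ = A² - a₁ A - k, where a₁ = a - b and k = a b.
    acts-cδ₂ : ∀ f → Acts (λ l → c * δ₂ l) f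
      (λ l → 1ℤ * L (L f) l + 1ℤ * (- (a - b) * L f l + - (a * b) * f l))
    acts-cδ₂ f = acts-congˡ step
      (acts-linear 1ℤ 1ℤ (acts-L (acts-δ₁ f))
        (acts-linear (- (a - b)) (- (a * b)) (acts-δ₁ f) (acts-δ₀ f)))
      where
      step : ∀ l → 1ℤ * L δ₁ l + 1ℤ * (- (a - b) * δ₁ l + - (a * b) * δ₀ l) ≡ c * δ₂ l
      step 0F = go a b c
        where go : ∀ a b c → 1ℤ * (a * b * 1ℤ) + 1ℤ * (- (a - b) * 0ℤ + - (a * b) * 1ℤ) ≡ c * 0ℤ
              go = solve-∀
      step 1F = go a b c
        where go : ∀ a b c → 1ℤ * (0ℤ + (a - b) * 1ℤ + (b - 1ℤ) * (a + 1ℤ) * 0ℤ) +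
                     1ℤ * (- (a - b) * 1ℤ + - (a * b) * 0ℤ) ≡ c * 0ℤ
              go = solve-∀
      step 2F = go a b β c
        where go : ∀ a b β c → 1ℤ * (c * 1ℤ + (a * b - β - c) * 0ℤ + β * 0ℤ) +
                     1ℤ * (- (a - b) * 0ℤ + - (a * b) * 0ℤ) ≡ c * 1ℤ
              go = solve-∀
      step 3F = go a b c
        where go : ∀ a b c → 1ℤ * ((b - 1ℤ) * a * 0ℤ + a * 0ℤ) +
                     1ℤ * (- (a - b) * 0ℤ + - (a * b) * 0ℤ) ≡ c * 0ℤ
              go = solve-∀

    -- c c₃ A₃ = A (c A₂) - a₂ (c A₂) - b₁ c A
    acts-cc₃δ₃ : ∀ {f h₁ h₂} → Acts δ₁ f h₁ → Acts (λ l → c * δ₂ l) f h₂ →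
      Acts (λ l → c * ((b - 1ℤ) * a) * δ₃ l) f
        (λ l → 1ℤ * L h₂ l + 1ℤ * (- (a * b - β - c) * h₂ l + - ((b - 1ℤ) * (a + 1ℤ) * c) * h₁ l))
    acts-cc₃δ₃ {f} acts₁ acts₂ = acts-congˡ step
      (acts-linear 1ℤ 1ℤ (acts-L acts₂)
        (acts-linear (- (a * b - β - c)) (- ((b - 1ℤ) * (a + 1ℤ) * c)) acts₂ acts₁))
      where
      step : ∀ l → 1ℤ * L (λ l → c * δ₂ l) l +
        1ℤ * (- (a * b - β - c) * (c * δ₂ l) + - ((b - 1ℤ) * (a + 1ℤ) * c) * δ₁ l)
        ≡ c * ((b - 1ℤ) * a) * δ₃ l
      step 0F = go a b β c
        where go : ∀ a b β c → 1ℤ * (a * b * (c * 0ℤ)) +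
                     1ℤ * (- (a * b - β - c) * (c * 0ℤ) + - ((b - 1ℤ) * (a + 1ℤ) * c) * 0ℤ)
                     ≡ c * ((b - 1ℤ) * a) * 0ℤ
              go = solve-∀
      step 1F = go a b β c
        where go : ∀ a b β c → 1ℤ * (c * 0ℤ + (a - b) * (c * 0ℤ) + (b - 1ℤ) * (a + 1ℤ) * (c * 1ℤ)) +
                     1ℤ * (- (a * b - β - c) * (c * 0ℤ) + - ((b - 1ℤ) * (a + 1ℤ) * c) * 1ℤ)
                     ≡ c * ((b - 1ℤ) * a) * 0ℤ
              go = solve-∀
      step 2F = go a b β c
        where go : ∀ a b β c → 1ℤ * (c * (c * 0ℤ) + (a * b - β - c) * (c * 1ℤ) + β * (c * 0ℤ)) +
                     1ℤ * (- (a * b - β - c) * (c * 1ℤ) + - ((b - 1ℤ) * (a + 1ℤ) * c) * 0ℤ)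
                     ≡ c * ((b - 1ℤ) * a) * 0ℤ
              go = solve-∀
      step 3F = go a b β c
        where go : ∀ a b β c → 1ℤ * ((b - 1ℤ) * a * (c * 1ℤ) + a * (c * 0ℤ)) +
                     1ℤ * (- (a * b - β - c) * (c * 0ℤ) + - ((b - 1ℤ) * (a + 1ℤ) * c) * 0ℤ)
                     ≡ c * ((b - 1ℤ) * a) * 1ℤ
              go = solve-∀

    -- Products are computed for c times a profile because c A₂ is an integral polynomial in A. For
    -- A₃ the further denominator c₃ = (b - 1) a is cancelled by the callers, in each case
    -- separately.
    acts-c : ∀ {f h₁ h₂ h₃} (g : Profile) → Acts δ₁ f h₁ → Acts (λ l → c * δ₂ l) f h₂ →
      Acts (λ l → c * δ₃ l) f h₃ → Acts (λ l → c * g l) f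
        (λ l → 1ℤ * (c * g 0F * f l + c * g 1F * h₁ l) + 1ℤ * (g 2F * h₂ l + g 3F * h₃ l))
    acts-c {f} g acts₁ acts₂ acts₃ = acts-congˡ step
      (acts-linear 1ℤ 1ℤ (acts-linear (c * g 0F) (c * g 1F) (acts-δ₀ f) acts₁)
        (acts-linear (g 2F) (g 3F) acts₂ acts₃))
      where
      step : ∀ l → 1ℤ * (c * g 0F * δ₀ l + c * g 1F * δ₁ l) +
        1ℤ * (g 2F * (c * δ₂ l) + g 3F * (c * δ₃ l)) ≡ c * g l
      step 0F = go c (g 0F) (g 1F) (g 2F) (g 3F)
        where go : ∀ c g₀ g₁ g₂ g₃ → 1ℤ * (c * g₀ * 1ℤ + c * g₁ * 0ℤ) + 1ℤ * (g₂ * (c * 0ℤ) + g₃ * (c * 0ℤ)) ≡ c * g₀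
              go = solve-∀
      step 1F = go c (g 0F) (g 1F) (g 2F) (g 3F)
        where go : ∀ c g₀ g₁ g₂ g₃ → 1ℤ * (c * g₀ * 0ℤ + c * g₁ * 1ℤ) + 1ℤ * (g₂ * (c * 0ℤ) + g₃ * (c * 0ℤ)) ≡ c * g₁
              go = solve-∀
      step 2F = go c (g 0F) (g 1F) (g 2F) (g 3F)
        where go : ∀ c g₀ g₁ g₂ g₃ → 1ℤ * (c * g₀ * 0ℤ + c * g₁ * 0ℤ) + 1ℤ * (g₂ * (c * 1ℤ) + g₃ * (c * 0ℤ)) ≡ c * g₂
              go = solve-∀
      step 3F = go c (g 0F) (g 1F) (g 2F) (g 3F)
        where go : ∀ c g₀ g₁ g₂ g₃ → 1ℤ * (c * g₀ * 0ℤ + c * g₁ * 0ℤ) + 1ℤ * (g₂ * (c * 0ℤ) + g₃ * (c * 1ℤ)) ≡ c * g₃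
              go = solve-∀

    0<c₃ : 0ℤ < (b - 1ℤ) * a
    0<c₃ = 0<* (i<j⇒0<j-i 1<b) 0<a

  -- Schur products and positive semidefinite forms

  sum-constant : ∀ n i → sum {n} (λ _ → i) ≡ + n * i
  sum-constant ℕ.zero    i = refl
  sum-constant (ℕ.suc n) i = trans (cong (_+_ i) (sum-constant n i)) (sym (suc-* (+ n) i))

  -- Schur's product theorem.
  schur : ∀ {n} (U : Square n) → (∀ x y → U x y ≡ U y x) → (f : Vector ℤ n) →
    let V = λ x z → ∑[ w < n ] (U x w * U w z) in
    0ℤ ≤ f ∙ ((λ x z → V x z * V x z) · f)
  schur {n} U U-sym f = subst (0ℤ ≤_) (sym expanded)
    (sum-nonneg _ λ w → sum-nonneg _ λ w′ → 0≤sq (total w w′))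
    where
    -- An entry of U² is a sum over w, and squaring it brings in a second index w′. Regrouped by (w,
    -- w′), the form is the sum of the squares of `total`.
    total : Fin n → Fin n → ℤ
    total w w′ = ∑[ x < n ] (f x * U x w * U x w′)

    sum-* : ∀ {m} (g h : Vector ℤ m) → sum g * sum h ≡ sum (λ i → sum (λ j → g i * h j))
    sum-* g h = trans (*-distribʳ-sum (sum h) g) (sum-cong-≗ λ i → *-distribˡ-sum (g i) h)

    term : ∀ fx fz a b c d → fx * (a * b * (c * d) * fz) ≡ (fx * a * c) * (fz * b * d)
    term = solve-∀

    open ≡-Reasoning
    expanded : f ∙ ((λ x z → sum (λ w → U x w * U w z) * sum (λ w → U x w * U w z)) · f) ≡
      sum (λ w → sum (λ w′ → total w w′ * total w w′))
    expanded = begin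
      _ ≡⟨ sum-cong-≗ (λ x → trans
             (*-distribˡ-sum (f x) (λ z → sum (λ w → U x w * U w z) * sum (λ w → U x w * U w z) * f z))
             (sum-cong-≗ λ z → expand x z)) ⟩
      sum (λ x → sum (λ z → sum (λ w → sum (λ w′ → (f x * U x w * U x w′) * (f z * U z w * U z w′)))))
        ≡⟨ sum-cong-≗ (λ x → ∑-comm (λ z w → sum (λ w′ → (f x * U x w * U x w′) * (f z * U z w * U z w′)))) ⟩
      sum (λ x → sum (λ w → sum (λ z → sum (λ w′ → (f x * U x w * U x w′) * (f z * U z w * U z w′)))))
        ≡⟨ ∑-comm (λ x w → sum (λ z → sum (λ w′ → (f x * U x w * U x w′) * (f z * U z w * U z w′)))) ⟩
      sum (λ w → sum (λ x → sum (λ z → sum (λ w′ → (f x * U x w * U x w′) * (f z * U z w * U z w′)))))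
        ≡⟨ sum-cong-≗ (λ w → trans
             (sum-cong-≗ λ x → ∑-comm (λ z w′ → (f x * U x w * U x w′) * (f z * U z w * U z w′)))
             (∑-comm (λ x w′ → sum (λ z → (f x * U x w * U x w′) * (f z * U z w * U z w′))))) ⟩
      sum (λ w → sum (λ w′ → sum (λ x → sum (λ z → (f x * U x w * U x w′) * (f z * U z w * U z w′)))))
        ≡⟨ sum-cong-≗ (λ w → sum-cong-≗ λ w′ →
             sum-* (λ x → f x * U x w * U x w′) (λ z → f z * U z w * U z w′)) ⟨
      _ ∎
      where
      expand : ∀ x z → f x * (sum (λ w → U x w * U w z) * sum (λ w → U x w * U w z) * f z) ≡
        sum (λ w → sum (λ w′ → (f x * U x w * U x w′) * (f z * U z w * U z w′)))
      expand x z = begin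
        f x * (sum (λ w → U x w * U w z) * sum (λ w → U x w * U w z) * f z)
          ≡⟨ cong (λ t → f x * (t * f z)) (sum-* (λ w → U x w * U w z) (λ w → U x w * U w z)) ⟩
        f x * (sum (λ w → sum (λ w′ → U x w * U w z * (U x w′ * U w′ z))) * f z)
          ≡⟨ cong (f x *_) (*-distribʳ-sum (f z) (λ w → sum (λ w′ → U x w * U w z * (U x w′ * U w′ z)))) ⟩
        f x * sum (λ w → sum (λ w′ → U x w * U w z * (U x w′ * U w′ z)) * f z)
          ≡⟨ *-distribˡ-sum (f x) (λ w → sum (λ w′ → U x w * U w z * (U x w′ * U w′ z)) * f z) ⟩
        sum (λ w → f x * (sum (λ w′ → U x w * U w z * (U x w′ * U w′ z)) * f z))
          ≡⟨ sum-cong-≗ (λ w → trans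
               (cong (f x *_) (*-distribʳ-sum (f z) (λ w′ → U x w * U w z * (U x w′ * U w′ z))))
               (*-distribˡ-sum (f x) (λ w′ → U x w * U w z * (U x w′ * U w′ z) * f z))) ⟩
        sum (λ w → sum (λ w′ → f x * (U x w * U w z * (U x w′ * U w′ z) * f z)))
          ≡⟨ sum-cong-≗ (λ w → sum-cong-≗ λ w′ → trans
               (cong₂ (λ s t → f x * (U x w * s * (U x w′ * t) * f z)) (U-sym w z) (U-sym w′ z))
               (term (f x) (f z) (U x w) (U z w) (U x w′) (U z w′))) ⟩
        _ ∎

  -- The form takes the value A (A C - B²) at (B, -A) and C (A C - B²) at (-C, B) when A = 0. If A =
  -- C = 0, its value at (-B, 1) is -2 B², twice the determinant.
  psd-determinant : ∀ A B C → (∀ i j → 0ℤ ≤ A * (i * i) + + 2 * B * (i * j) + C * (j * j)) →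
    0ℤ ≤ A * C - B * B
  psd-determinant A B C psd with <-cmp 0ℤ A | <-cmp 0ℤ C
  ... | tri< 0<A _ _ | _ = *-cancel-pos-≤ 0<A (subst (0ℤ ≤_) (go A B C) (psd B (- A)))
    where go : ∀ A B C → A * (B * B) + + 2 * B * (B * (- A)) + C * ((- A) * (- A)) ≡ A * (A * C - B * B)
          go = solve-∀
  ... | tri≈ _ _ _ | tri< 0<C _ _ = *-cancel-pos-≤ 0<C (subst (0ℤ ≤_) (go A B C) (psd (- C) B))
    where go : ∀ A B C → A * ((- C) * (- C)) + + 2 * B * ((- C) * B) + C * (B * B) ≡ C * (A * C - B * B)
          go = solve-∀
  ... | tri≈ _ refl _ | tri≈ _ refl _ =
    *-cancel-pos-≤ {+ 2} (+<+ (ℕ.s≤s ℕ.z≤n)) (subst (0ℤ ≤_) (go B) (psd (- B) 1ℤ))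
    where go : ∀ B → 0ℤ * ((- B) * (- B)) + + 2 * B * ((- B) * 1ℤ) + 0ℤ * (1ℤ * 1ℤ) ≡ + 2 * (0ℤ * 0ℤ - B * B)
          go = solve-∀
  ... | tri≈ _ _ _ | tri> _ _ C<0 = contradiction (subst (0ℤ ≤_) (go A B C) (psd 0ℤ 1ℤ)) (<⇒≱ C<0)
    where go : ∀ A B C → A * (0ℤ * 0ℤ) + + 2 * B * (0ℤ * 1ℤ) + C * (1ℤ * 1ℤ) ≡ C
          go = solve-∀
  ... | tri> _ _ A<0 | _ = contradiction (subst (0ℤ ≤_) (go A B C) (psd 1ℤ 0ℤ)) (<⇒≱ A<0)
    where go : ∀ A B C → A * (1ℤ * 1ℤ) + + 2 * B * (1ℤ * 0ℤ) + C * (0ℤ * 0ℤ) ≡ A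
          go = solve-∀

  -- Krein, multiplicity and local conditions on the parameters

  module Conditions {n : ℕ} {d : Fin n → Fin n → Fin 4} {a b β c : ℤ}
    (scheme : IsScheme d (shillaMatrix a b β c)) (o : Fin n)
    (0<a : 0ℤ < a) (1<b : 1ℤ < b) (0<β : 0ℤ < β) (0<c : 0ℤ < c) where

    open BoseMesner scheme 0<a 1<b 0<β 0<c public

    -- M g acts on V as i + j L.
    ActsOnV : Profile → ℤ → ℤ → Set
    ActsOnV g i j = ∀ k l → Acts g (k u⁰+ l u¹) ((i * k + j * l) u⁰+ (i * l + j * (s * l - r * k)) u¹)

    V-cong : ∀ {i j k l} → i ≡ k → j ≡ l → ∀ m → (i u⁰+ j u¹) m ≡ (k u⁰+ l u¹) m
    V-cong refl refl m = refl

    onV-δ₁ : ActsOnV δ₁ 0ℤ 1ℤ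
    onV-δ₁ k l = acts-congʳ (λ m → trans (L-V k l m)
      (V-cong (go₀ k l) (go₁ l (s * l - r * k)) m)) (acts-δ₁ (k u⁰+ l u¹))
      where
      go₀ : ∀ k l → l ≡ 0ℤ * k + 1ℤ * l
      go₀ = solve-∀
      go₁ : ∀ l t → t ≡ 0ℤ * l + 1ℤ * t
      go₁ = solve-∀

    L²-V : ∀ k l m → L (L (k u⁰+ l u¹)) m ≡
      ((s * l - r * k) u⁰+ (s * (s * l - r * k) - r * l) u¹) m
    L²-V k l m = trans (L-cong (L-V k l) m) (L-V l (s * l - r * k) m)

    onV-δ₂ : ActsOnV (λ m → c * δ₂ m) (- e) (- X)
    onV-δ₂ k l = acts-congʳ
      (λ m → trans
        (cong₂ (λ p q → 1ℤ * p + 1ℤ * (- (a - b) * q + - (a * b) * (k * u⁰ m + l * u¹ m)))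
          (L²-V k l m) (L-V k l m))
        (go a b β c k l (u⁰ m) (u¹ m)))
      (acts-cδ₂ (k u⁰+ l u¹))
      where
      go : ∀ a b β c k l U W →
        1ℤ * (((a - b - (β + c)) * l - (b * β + c - a * b) * k) * U
            + ((a - b - (β + c)) * ((a - b - (β + c)) * l - (b * β + c - a * b) * k) - (b * β + c - a * b) * l) * W)
        + 1ℤ * (- (a - b) * (l * U + ((a - b - (β + c)) * l - (b * β + c - a * b) * k) * W)
          + - (a * b) * (k * U + l * W))
        ≡ (- (b * β + c) * k + - (β + c) * l) * U
        + (- (b * β + c) * l + - (β + c) * ((a - b - (β + c)) * l - (b * β + c - a * b) * k)) * W
      go = solve-∀

    onV-δ₃ : ActsOnV (λ m → c * δ₃ m) (β * b) β
    onV-δ₃ k l = acts-cancel 0<c₃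
      (acts-congˡ (λ m → swap c ((b - 1ℤ) * a) (δ₃ m))
      (acts-congʳ
        (λ m → trans
          (cong (λ p → 1ℤ * p + 1ℤ * (- (a * b - β - c) *
                ((- e * k + - X * l) u⁰+ (- e * l + - X * (s * l - r * k)) u¹) m
              + - ((b - 1ℤ) * (a + 1ℤ) * c) * ((0ℤ * k + 1ℤ * l) u⁰+ (0ℤ * l + 1ℤ * (s * l - r * k)) u¹) m))
            (L-V (- e * k + - X * l) (- e * l + - X * (s * l - r * k)) m))
          (go a b β c k l (u⁰ m) (u¹ m)))
        (acts-cc₃δ₃ (onV-δ₁ k l) (onV-δ₂ k l))))
      where
      swap : ∀ c t δ → c * t * δ ≡ t * (c * δ)
      swap = solve-∀
      go : ∀ a b β c k l U W →
        1ℤ * ((- (b * β + c) * l + - (β + c) * ((a - b - (β + c)) * l - (b * β + c - a * b) * k)) * U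
             + ((a - b - (β + c)) * (- (b * β + c) * l + - (β + c) * ((a - b - (β + c)) * l - (b * β + c - a * b) * k))
               - (b * β + c - a * b) * (- (b * β + c) * k + - (β + c) * l)) * W)
        + 1ℤ * (- (a * b - β - c) *
            ((- (b * β + c) * k + - (β + c) * l) * U
            + (- (b * β + c) * l + - (β + c) * ((a - b - (β + c)) * l - (b * β + c - a * b) * k)) * W)
          + - ((b - 1ℤ) * (a + 1ℤ) * c) *
            ((0ℤ * k + 1ℤ * l) * U + (0ℤ * l + 1ℤ * ((a - b - (β + c)) * l - (b * β + c - a * b) * k)) * W))
        ≡ (b - 1ℤ) * a * ((β * b * k + β * l) * U
            + (β * b * l + β * ((a - b - (β + c)) * l - (b * β + c - a * b) * k)) * W)
      go = solve-∀

    onV : ∀ (g : Profile) → ActsOnV (λ m → c * g m)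
      (c * g 0F - e * g 2F + b * β * g 3F) (c * g 1F - X * g 2F + β * g 3F)
    onV g k l = acts-congʳ
      (λ m → go c (g 0F) (g 1F) (g 2F) (g 3F) e X b β k l (s * l - r * k) (u⁰ m) (u¹ m))
      (acts-c g (onV-δ₁ k l) (onV-δ₂ k l) (onV-δ₃ k l))
      where
      go : ∀ c g₀ g₁ g₂ g₃ e X b β k l t U W →
        1ℤ * (c * g₀ * (k * U + l * W) + c * g₁ * ((0ℤ * k + 1ℤ * l) * U + (0ℤ * l + 1ℤ * t) * W))
        + 1ℤ * (g₂ * ((- e * k + - X * l) * U + (- e * l + - X * t) * W)
          + g₃ * ((β * b * k + β * l) * U + (β * b * l + β * t) * W))
        ≡ ((c * g₀ - e * g₂ + b * β * g₃) * k + (c * g₁ - X * g₂ + β * g₃) * l) * U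
        + ((c * g₀ - e * g₂ + b * β * g₃) * l + (c * g₁ - X * g₂ + β * g₃) * t) * W
      go = solve-∀

    0<b : 0ℤ < b
    0<b = <-trans (+<+ (ℕ.s≤s ℕ.z≤n)) 1<b

    0<b-1 : 0ℤ < b - 1ℤ
    0<b-1 = i<j⇒0<j-i 1<b

    0<a+1 : 0ℤ < a + 1ℤ
    0<a+1 = +-mono-<-≤ 0<a (+≤+ ℕ.z≤n)

    κ₁ : ℤ
    κ₁ = b * β + β * a + c * (a + 1ℤ)

    0<κ₁ : 0ℤ < κ₁
    0<κ₁ = +-mono-< (+-mono-< (0<* 0<b 0<β) (0<* 0<β 0<a)) (0<* 0<c 0<a+1)

    -- On the eigenspace of a, c A₂ acts as a² - (a - b) a - a b = 0 and A₃ as -(a + 1). Hence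
    -- `M e₁` is κ₁ times an idempotent, that of θ₁.
    acts-e₁ : Acts e₁ e₁ (λ l → κ₁ * e₁ l)
    acts-e₁ = acts-cancel 0<c (acts-congʳ (λ l → go a b β c (e₁ l)) (acts-c e₁ δ₁e₁ δ₂e₁ δ₃e₁))
      where
      δ₁e₁ : Acts δ₁ e₁ (λ l → a * e₁ l)
      δ₁e₁ = acts-congʳ L-e₁ (acts-δ₁ e₁)

      LL-e₁ : ∀ l → L (L e₁) l ≡ a * (a * e₁ l)
      LL-e₁ l = trans (L-cong (λ l → trans (L-e₁ l) (sym (zero-tail (a * e₁ l)))) l)
        (trans (L-linear a 0ℤ e₁ e₁ l) (trans (zero-tail (a * L e₁ l)) (cong (a *_) (L-e₁ l))))
        where
        zero-tail : ∀ i → i + 0ℤ ≡ i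
        zero-tail = +-identityʳ

      δ₂e₁ : Acts (λ l → c * δ₂ l) e₁ (λ _ → 0ℤ)
      δ₂e₁ = acts-congʳ
        (λ l → trans (cong₂ (λ p q → 1ℤ * p + 1ℤ * (- (a - b) * q + - (a * b) * e₁ l)) (LL-e₁ l) (L-e₁ l))
          (vanishes a b (e₁ l)))
        (acts-cδ₂ e₁)
        where
        vanishes : ∀ a b t → 1ℤ * (a * (a * t)) + 1ℤ * (- (a - b) * (a * t) + - (a * b) * t) ≡ 0ℤ
        vanishes = solve-∀

      δ₃e₁ : Acts (λ l → c * δ₃ l) e₁ (λ l → - (c * (a + 1ℤ)) * e₁ l)
      δ₃e₁ = acts-cancel 0<c₃ (acts-congˡ (λ l → swap c ((b - 1ℤ) * a) (δ₃ l))
        (acts-congʳ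
          (λ l → trans (cong (λ p → 1ℤ * p + 1ℤ * (- (a * b - β - c) * 0ℤ + - ((b - 1ℤ) * (a + 1ℤ) * c) * (a * e₁ l)))
              (L-linear 0ℤ 0ℤ e₁ e₁ l))
            (collected a b β c (e₁ l)))
          (acts-cc₃δ₃ δ₁e₁ δ₂e₁)))
        where
        swap : ∀ c t δ → c * t * δ ≡ t * (c * δ)
        swap = solve-∀
        collected : ∀ a b β c t →
          1ℤ * 0ℤ + 1ℤ * (- (a * b - β - c) * 0ℤ + - ((b - 1ℤ) * (a + 1ℤ) * c) * (a * t)) ≡
          (b - 1ℤ) * a * (- (c * (a + 1ℤ)) * t)
        collected = solve-∀

      go : ∀ a b β c t →
        1ℤ * (c * (b * β) * t + c * β * (a * t)) + 1ℤ * (0ℤ * 0ℤ + - c * (- (c * (a + 1ℤ)) * t)) ≡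
        c * ((b * β + β * a + c * (a + 1ℤ)) * t)
      go = solve-∀

    -- T = X L + b e is, up to a positive factor, the restriction to V of the entrywise
    -- square of M e₁; its eigenvalues there are the Krein parameters q²₁₁ and q³₁₁.
    square-e₁-onV : ActsOnV (λ l → c * (c * (e₁ l * e₁ l))) (c * (c * β * (b * e))) (c * (c * β * X))
    square-e₁-onV k l = acts-congʳ (λ m → V-cong (go₀ a b β c k l) (go₁ a b β c l (s * l - r * k)) m)
      (acts-congˡ (λ _ → refl) (onV′ k l))
      where
      g : Profile
      g m = c * (e₁ m * e₁ m)
      onV′ : ActsOnV (λ m → c * g m)
        (c * g 0F - e * g 2F + b * β * g 3F) (c * g 1F - X * g 2F + β * g 3F)
      onV′ = onV g
      go₀ : ∀ a b β c k l →
        (c * (c * (b * β * (b * β))) - (b * β + c) * (c * (0ℤ * 0ℤ)) + b * β * (c * (- c * - c))) * k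
        + (c * (c * (β * β)) - (β + c) * (c * (0ℤ * 0ℤ)) + β * (c * (- c * - c))) * l
        ≡ c * (c * β * (b * (b * β + c))) * k + c * (c * β * (β + c)) * l
      go₀ = solve-∀
      go₁ : ∀ a b β c l t →
        (c * (c * (b * β * (b * β))) - (b * β + c) * (c * (0ℤ * 0ℤ)) + b * β * (c * (- c * - c))) * l
        + (c * (c * (β * β)) - (β + c) * (c * (0ℤ * 0ℤ)) + β * (c * (- c * - c))) * t
        ≡ c * (c * β * (b * (b * β + c))) * l + c * (c * β * (β + c)) * t
      go₁ = solve-∀

    ⟪_,_⟫ : Profile → Profile → ℤ
    ⟪ f , g ⟫ = ∑[ x < n ] (f (d x o) * g (d x o))

    ⟪⟫-comm : ∀ f g → ⟪ f , g ⟫ ≡ ⟪ g , f ⟫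
    ⟪⟫-comm f g = ∙-comm (λ x → f (d x o)) (λ x → g (d x o))

    ⟪⟫-linear : ∀ i j f g h → ⟪ f , (λ l → i * g l + j * h l) ⟫ ≡ i * ⟪ f , g ⟫ + j * ⟪ f , h ⟫
    ⟪⟫-linear i j f g h = trans
      (sum-cong-≗ λ x → go i j (f (d x o)) (g (d x o)) (h (d x o)))
      (sum-linear i j (λ x → f (d x o) * g (d x o)) (λ x → f (d x o) * h (d x o)))
      where
      go : ∀ i j f g h → f * (i * g + j * h) ≡ i * (f * g) + j * (f * h)
      go = solve-∀

    ⟪⟫-congʳ : ∀ f {g h} → (∀ l → g l ≡ h l) → ⟪ f , g ⟫ ≡ ⟪ f , h ⟫
    ⟪⟫-congʳ f g≡h = sum-cong-≗ λ x → cong (f (d x o) *_) (g≡h (d x o))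

    ⟪⟫-scale : ∀ i f g → ⟪ f , (λ l → i * g l) ⟫ ≡ i * ⟪ f , g ⟫
    ⟪⟫-scale i f g = trans (sum-cong-≗ λ x → swap (f (d x o)) i (g (d x o)))
      (sym (*-distribˡ-sum i (λ x → f (d x o) * g (d x o))))
      where
      swap : ∀ f i g → f * (i * g) ≡ i * (f * g)
      swap = solve-∀

    ⟪⟫-nonneg : ∀ f → 0ℤ ≤ ⟪ f , f ⟫
    ⟪⟫-nonneg f = sum-nonneg (λ x → f (d x o) * f (d x o)) (λ x → 0≤sq (f (d x o)))

    ⟪⟫-positive : ∀ f → f 0F ≢ 0ℤ → 0ℤ < ⟪ f , f ⟫
    ⟪⟫-positive f f₀≢0 = <-≤-trans (sq-pos λ f≡0 → f₀≢0 (trans (cong f (sym (d-refl o))) f≡0))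
      (term≤sum (λ x → f (d x o) * f (d x o)) (λ x → 0≤sq (f (d x o))) o)

    TV : ℤ → ℤ → Profile
    TV k l = (b * e * k + X * l) u⁰+ (b * e * l + X * (s * l - r * k)) u¹

    -- `M e₁` is symmetric with square κ₁ `M e₁`, so Schur's theorem makes the entrywise square of
    -- κ₁ `M e₁` positive semidefinite. On V that square is a positive multiple of T, whose value at
    -- k u⁰ + l u¹ is `TV k l`.
    krein : ∀ k l → 0ℤ ≤ ⟪ k u⁰+ l u¹ , TV k l ⟫
    krein k l = *-cancel-pos-≤ (0<* (0<* (0<* 0<c 0<c) 0<c) 0<β)
      (*-cancel-pos-≤ (0<* 0<κ₁ 0<κ₁) (subst (0ℤ ≤_) total (0≤* 0≤c² (schur U (M-sym e₁) f))))
      where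
      U : Square n
      U = M e₁
      f : Vector ℤ n
      f x = (k u⁰+ l u¹) (d x o)
      0≤c² : 0ℤ ≤ c * (c * c)
      0≤c² = <⇒≤ (0<* 0<c (0<* 0<c 0<c))
      open ≡-Reasoning
      square : ∀ x z → (∑[ w < n ] (U x w * U w z)) * (∑[ w < n ] (U x w * U w z)) ≡
        κ₁ * κ₁ * (U x z * U x z)
      square x z = trans (cong₂ _*_ (product acts-e₁ x z) (product acts-e₁ x z)) (go κ₁ (U x z))
        where
        go : ∀ κ u → κ * u * (κ * u) ≡ κ * κ * (u * u)
        go = solve-∀
      row : ∀ x → c * (c * ∑[ z < n ] (κ₁ * κ₁ * (U x z * U x z) * f z)) ≡
        κ₁ * κ₁ * (c * (c * β * TV k l (d x o)))
      row x = begin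
        c * (c * ∑[ z < n ] (κ₁ * κ₁ * (U x z * U x z) * f z))
          ≡⟨ trans (sym (*-assoc c c _)) (*-distribˡ-sum (c * c) (λ z → κ₁ * κ₁ * (U x z * U x z) * f z)) ⟩
        sum (λ z → c * c * (κ₁ * κ₁ * (U x z * U x z) * f z))
          ≡⟨ sum-cong-≗ (λ z → swap c κ₁ (U x z) (f z)) ⟩
        sum (λ z → κ₁ * κ₁ * (c * (c * (U x z * U x z)) * f z))
          ≡⟨ *-distribˡ-sum (κ₁ * κ₁) (λ z → c * (c * (U x z * U x z)) * f z) ⟨
        κ₁ * κ₁ * sum (λ z → c * (c * (U x z * U x z)) * f z)
          ≡⟨ cong (κ₁ * κ₁ *_) (product (square-e₁-onV k l) x o) ⟩
        _ ≡⟨ cong (κ₁ * κ₁ *_) (go c β (b * e) X k l (s * l - r * k) (u⁰ (d x o)) (u¹ (d x o))) ⟩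
        κ₁ * κ₁ * (c * (c * β * TV k l (d x o))) ∎
        where
        swap : ∀ c κ u f → c * c * (κ * κ * (u * u) * f) ≡ κ * κ * (c * (c * (u * u)) * f)
        swap = solve-∀
        go : ∀ c β t X k l m U W →
          (c * (c * β * t) * k + c * (c * β * X) * l) * U + (c * (c * β * t) * l + c * (c * β * X) * m) * W ≡
          c * (c * β * ((t * k + X * l) * U + (t * l + X * m) * W))
        go = solve-∀
      total : c * (c * c) * (f ∙ ((λ x z → (∑[ w < n ] (U x w * U w z)) * (∑[ w < n ] (U x w * U w z))) · f)) ≡
        κ₁ * κ₁ * (c * c * c * β * ⟪ k u⁰+ l u¹ , TV k l ⟫)
      total = begin
        _ ≡⟨ *-distribˡ-sum (c * (c * c)) (λ x → f x * ((λ x z → (∑[ w < n ] (U x w * U w z)) * (∑[ w < n ] (U x w * U w z))) · f) x) ⟩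
        _ ≡⟨ sum-cong-≗ (λ x → cong (λ t → c * (c * c) * (f x * t)) (sum-cong-≗ λ z → cong (_* f z) (square x z))) ⟩
        sum (λ x → c * (c * c) * (f x * sum (λ z → κ₁ * κ₁ * (U x z * U x z) * f z)))
          ≡⟨ sum-cong-≗ (λ x → trans (go₀ c (f x) _) (trans (cong (λ t → c * (f x * t)) (row x)) (go₁ c β κ₁ (f x) (TV k l (d x o))))) ⟩
        sum (λ x → κ₁ * κ₁ * (c * c * c * β) * (f x * TV k l (d x o)))
          ≡⟨ *-distribˡ-sum (κ₁ * κ₁ * (c * c * c * β)) (λ x → f x * TV k l (d x o)) ⟨
        κ₁ * κ₁ * (c * c * c * β) * ⟪ k u⁰+ l u¹ , TV k l ⟫
          ≡⟨ *-assoc (κ₁ * κ₁) (c * c * c * β) _ ⟩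
        _ ∎
        where
        go₀ : ∀ c f t → c * (c * c) * (f * t) ≡ c * (f * (c * (c * t)))
        go₀ = solve-∀
        go₁ : ∀ c β κ f t → c * (f * (κ * κ * (c * (c * β * t)))) ≡ κ * κ * (c * c * c * β) * (f * t)
        go₁ = solve-∀

    u⁰₀ : ℤ
    u⁰₀ = a * b * ((a + 1ℤ) * (b - 1ℤ))

    0<u⁰₀ : 0ℤ < u⁰₀
    0<u⁰₀ = 0<* (0<* 0<a 0<b) (0<* 0<a+1 0<b-1)

    -- At an integral root x the vector u⁰ + x u¹ is an eigenvector of T with eigenvalue X x + b e.
    -- Its norm is positive because its entry at distance 0 is.
    krein-root : ∀ x → x * x ≡ s * x - r → 0ℤ ≤ X * x + b * e
    krein-root x root = *-cancel-pos-≤ 0<f² (subst (0ℤ ≤_) scaled (krein 1ℤ x))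
      where
      f : Profile
      f = 1ℤ u⁰+ x u¹
      f₀≢0 : f 0F ≢ 0ℤ
      f₀≢0 f₀≡0 = <-irrefl (trans (sym f₀≡0) (go u⁰₀ x)) 0<u⁰₀
        where go : ∀ u x → 1ℤ * u + x * 0ℤ ≡ u
              go = solve-∀
      0<f² : 0ℤ < ⟪ f , f ⟫
      0<f² = ⟪⟫-positive f f₀≢0
      scaled : ⟪ f , TV 1ℤ x ⟫ ≡ ⟪ f , f ⟫ * (X * x + b * e)
      scaled = trans (⟪⟫-congʳ f λ l → trans
          (cong (λ t → (b * e * 1ℤ + X * x) * u⁰ l + (b * e * x + X * t) * u¹ l)
            (trans (go₀ s r x) (sym root)))
          (go₁ (b * e) X x (u⁰ l) (u¹ l)))
        (trans (⟪⟫-scale (X * x + b * e) f f) (*-comm (X * x + b * e) ⟪ f , f ⟫))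
        where
        go₀ : ∀ s r x → s * x - r * 1ℤ ≡ s * x - r
        go₀ = solve-∀
        go₁ : ∀ t X x U W → (t * 1ℤ + X * x) * U + (t * x + X * (x * x)) * W ≡ (X * x + t) * (1ℤ * U + x * W)
        go₁ = solve-∀

    G₀₀ G₀₁ G₁₁ : ℤ
    G₀₀ = ⟪ u⁰ , u⁰ ⟫
    G₀₁ = ⟪ u⁰ , u¹ ⟫
    G₁₁ = ⟪ u¹ , u¹ ⟫

    L-selfadjoint : ∀ f g → ⟪ f , L g ⟫ ≡ ⟪ L f , g ⟫
    L-selfadjoint f g = begin
      ⟪ f , L g ⟫
        ≡⟨ sum-cong-≗ (λ x → cong (f (d x o) *_) (A·M g x o)) ⟨
      (λ x → f (d x o)) ∙ (M δ₁ · (λ x → g (d x o)))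
        ≡⟨ adjoint {M = M δ₁} (M-sym δ₁) (λ x → f (d x o)) (λ x → g (d x o)) ⟩
      (M δ₁ · (λ x → f (d x o))) ∙ (λ x → g (d x o))
        ≡⟨ sum-cong-≗ (λ x → cong (_* g (d x o)) (A·M f x o)) ⟩
      ⟪ L f , g ⟫ ∎
      where open ≡-Reasoning

    -- Self-adjointness of L, applied to u⁰ and u¹, leaves only two independent entries in the Gram
    -- matrix of V. The constants `B₀₀`, `B₀₁`, `B₁₁` below satisfy the same relation.
    gram-relation : G₀₀ ≡ - (s * G₀₁) - r * G₁₁
    gram-relation = begin
      G₀₀                             ≡⟨ go₀ s G₀₀ G₀₁ ⟩
      1ℤ * G₀₀ + s * G₀₁ - s * G₀₁    ≡⟨ cong (_- s * G₀₁) shifted ⟩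
      - r * G₁₁ - s * G₀₁             ≡⟨ go₁ r s G₀₁ G₁₁ ⟩
      - (s * G₀₁) - r * G₁₁           ∎
      where
      open ≡-Reasoning
      go₀ : ∀ s g h → g ≡ 1ℤ * g + s * h - s * h
      go₀ = solve-∀
      go₁ : ∀ r s g h → - r * h - s * g ≡ - (s * g) - r * h
      go₁ = solve-∀
      shifted : 1ℤ * G₀₀ + s * G₀₁ ≡ - r * G₁₁
      shifted = begin
        1ℤ * G₀₀ + s * G₀₁          ≡⟨ ⟪⟫-linear 1ℤ s u⁰ u⁰ u¹ ⟨
        ⟪ u⁰ , (λ l → 1ℤ * u⁰ l + s * u¹ l) ⟫
          ≡⟨ ⟪⟫-congʳ u⁰ (λ l → trans (L-u¹ l) (cong (_+ s * u¹ l) (sym (*-identityˡ (u⁰ l))))) ⟨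
        ⟪ u⁰ , L u¹ ⟫               ≡⟨ L-selfadjoint u⁰ u¹ ⟩
        ⟪ L u⁰ , u¹ ⟫               ≡⟨ ⟪⟫-comm (L u⁰) u¹ ⟩
        ⟪ u¹ , L u⁰ ⟫               ≡⟨ ⟪⟫-congʳ u¹ L-u⁰ ⟩
        ⟪ u¹ , (λ l → - r * u¹ l) ⟫ ≡⟨ ⟪⟫-scale (- r) u¹ u¹ ⟩
        - r * G₁₁                   ∎

    ⟪V,V⟫ : ∀ i j k l → ⟪ i u⁰+ j u¹ , k u⁰+ l u¹ ⟫ ≡
      k * (i * G₀₀ + j * G₀₁) + l * (i * G₀₁ + j * G₁₁)
    ⟪V,V⟫ i j k l = trans (⟪⟫-linear k l f u⁰ u¹)
      (cong₂ (λ p q → k * p + l * q)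
        (trans (⟪⟫-comm f u⁰) (⟪⟫-linear i j u⁰ u⁰ u¹))
        (trans (⟪⟫-comm f u¹) (trans (⟪⟫-linear i j u¹ u⁰ u¹)
          (cong (λ t → i * t + j * G₁₁) (⟪⟫-comm u¹ u⁰)))))
      where
      f : Profile
      f = i u⁰+ j u¹

    D : ℤ
    D = s * s - + 4 * r

    -- If u¹ vanished on the whole graph, `gram-relation` would make the norm of u⁰ zero, although
    -- its entry at distance 0 is positive.
    G₁₁≢0 : G₁₁ ≢ 0ℤ
    G₁₁≢0 G₁₁≡0 = <-irrefl (sym G₀₀≡0) (⟪⟫-positive u⁰ λ u⁰₀≡0 → <-irrefl (sym u⁰₀≡0) 0<u⁰₀)
      where
      u¹-zero : ∀ x → u¹ (d x o) ≡ 0ℤ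
      u¹-zero = square-sum-zero (λ x → u¹ (d x o)) G₁₁≡0
      G₀₁≡0 : G₀₁ ≡ 0ℤ
      G₀₁≡0 = sum-zero λ x → trans (cong (u⁰ (d x o) *_) (u¹-zero x)) (*-zeroʳ (u⁰ (d x o)))
      G₀₀≡0 : G₀₀ ≡ 0ℤ
      G₀₀≡0 = trans gram-relation (trans (cong₂ (λ p q → - (s * p) - r * q) G₀₁≡0 G₁₁≡0) (go s r))
        where
        go : ∀ s r → - (s * 0ℤ) - r * 0ℤ ≡ 0ℤ
        go = solve-∀

    0<G₁₁ : 0ℤ < G₁₁
    0<G₁₁ = ≤∧≢⇒< (⟪⟫-nonneg u¹) (λ eq → G₁₁≢0 (sym eq))

    -- Four times the determinant is D q² - (2 p + s q)². This serves both for the Gram matrix of V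
    -- and for `det`.
    nonsquare-determinant : Nonsquare D → ∀ p q → q ≢ 0ℤ → (- (s * p) - r * q) * q - p * p ≢ 0ℤ
    nonsquare-determinant ns p q q≢0 det≡0 = ns q (+ 2 * p + s * q) q≢0
      (i-j≡0⇒i≡j _ _ (trans (go s r p q) (trans (cong (+ 4 *_) det≡0) refl)))
      where
      go : ∀ s r p q → (s * s - + 4 * r) * (q * q) - (+ 2 * p + s * q) * (+ 2 * p + s * q) ≡
        + 4 * ((- (s * p) - r * q) * q - p * p)
      go = solve-∀

    gram : ℤ
    gram = (- (s * G₀₁) - r * G₁₁) * G₁₁ - G₀₁ * G₀₁

    0≤gram : 0ℤ ≤ gram
    0≤gram = *-cancel-pos-≤ 0<G₁₁ (subst (0ℤ ≤_) expanded (⟪⟫-nonneg (G₁₁ u⁰+ (- G₀₁) u¹)))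
      where
      go : ∀ g h t → h * (h * t + - g * g) + - g * (h * g + - g * h) ≡ h * (t * h - g * g)
      go = solve-∀
      expanded : ⟪ G₁₁ u⁰+ (- G₀₁) u¹ , G₁₁ u⁰+ (- G₀₁) u¹ ⟫ ≡ G₁₁ * gram
      expanded = trans (⟪V,V⟫ G₁₁ (- G₀₁) G₁₁ (- G₀₁))
        (trans (go G₀₁ G₁₁ G₀₀) (cong (λ t → G₁₁ * (t * G₁₁ - G₀₁ * G₀₁)) gram-relation))

    -- The determinant of the form f ↦ ⟪ f , T f ⟫ is that of ⟪ f , f ⟫ times the norm of T,
    -- so both conjugate eigenvalues of T are nonnegative.
    krein-norm : Nonsquare D → 0ℤ ≤ X * X * r + X * s * (b * e) + b * e * (b * e)
    krein-norm ns = *-cancel-pos-≤ {gram} 0<gram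
      (subst (0ℤ ≤_) (determinant X (b * e) s r G₀₁ G₁₁) (psd-determinant A B C form))
      where
      A B C : ℤ
      A = b * e * (- (s * G₀₁) - r * G₁₁) - X * r * G₀₁
      B = b * e * G₀₁ - X * r * G₁₁
      C = X * G₀₁ + (X * s + b * e) * G₁₁
      0<gram : 0ℤ < gram
      0<gram = ≤∧≢⇒< 0≤gram λ eq → nonsquare-determinant ns G₀₁ G₁₁ G₁₁≢0 (sym eq)
      form : ∀ i j → 0ℤ ≤
        (b * e * (- (s * G₀₁) - r * G₁₁) - X * r * G₀₁) * (i * i)
        + + 2 * (b * e * G₀₁ - X * r * G₁₁) * (i * j)
        + (X * G₀₁ + (X * s + b * e) * G₁₁) * (j * j)
      form i j = subst (0ℤ ≤_)
        (trans (⟪V,V⟫ i j (b * e * i + X * j) (b * e * j + X * (s * j - r * i)))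
        (trans (cong (λ t → (b * e * i + X * j) * (i * t + j * G₀₁) +
            (b * e * j + X * (s * j - r * i)) * (i * G₀₁ + j * G₁₁)) gram-relation)
          (go X (b * e) s r G₀₁ G₁₁ i j)))
        (krein i j)
        where
        go : ∀ X t s r g h i j →
          (t * i + X * j) * (i * (- (s * g) - r * h) + j * g) + (t * j + X * (s * j - r * i)) * (i * g + j * h)
          ≡ (t * (- (s * g) - r * h) - X * r * g) * (i * i) + + 2 * (t * g - X * r * h) * (i * j)
            + (X * g + (X * s + t) * h) * (j * j)
        go = solve-∀
      determinant : ∀ X t s r g h →
        (t * (- (s * g) - r * h) - X * r * g) * (X * g + (X * s + t) * h) - (t * g - X * r * h) * (t * g - X * r * h)
        ≡ ((- (s * g) - r * h) * h - g * g) * (X * X * r + X * s * t + t * t)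
      determinant = solve-∀

    -- Multiplication constants of V: c u⁰ acts on V as B₀₀ + B₀₁ L, and c u¹ as B₀₁ + B₁₁ L.
    B₀₁ B₁₁ : ℤ
    B₀₁ = X * e + a * b * β * (b - 1ℤ)
    B₁₁ = X * ((b - 1ℤ) * a + X) + c * (b - 1ℤ)

    B₀₀ : ℤ
    B₀₀ = - (s * B₀₁) - r * B₁₁

    0<B₁₁ : 0ℤ < B₁₁
    0<B₁₁ = +-mono-< (0<* 0<X (+-mono-< 0<c₃ 0<X)) (0<* 0<c 0<b-1)
      where
      0<X : 0ℤ < X
      0<X = +-mono-< 0<β 0<c

    onV-u⁰ : ActsOnV (λ l → c * u⁰ l) B₀₀ B₀₁
    onV-u⁰ k l = acts-congʳ (V-cong (go a b β c k l) (go a b β c l (s * l - r * k))) (onV u⁰ k l)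
      where
      go : ∀ a b β c k l →
        (c * (a * b * ((a + 1ℤ) * (b - 1ℤ))) - (b * β + c) * (- (b * β + c)) + b * β * (a * b * (b - 1ℤ))) * k
        + (c * 0ℤ - (β + c) * (- (b * β + c)) + β * (a * b * (b - 1ℤ))) * l
        ≡ (- ((a - b - (β + c)) * ((β + c) * (b * β + c) + a * b * β * (b - 1ℤ)))
            - (b * β + c - a * b) * ((β + c) * ((b - 1ℤ) * a + (β + c)) + c * (b - 1ℤ))) * k
        + ((β + c) * (b * β + c) + a * b * β * (b - 1ℤ)) * l
      go = solve-∀

    onV-u¹ : ActsOnV (λ l → c * u¹ l) B₀₁ B₁₁
    onV-u¹ k l = acts-congʳ (V-cong (go a b β c k l) (go a b β c l (s * l - r * k))) (onV u¹ k l)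
      where
      go : ∀ a b β c k l →
        (c * 0ℤ - (b * β + c) * (- (β + c)) + b * β * (a * (b - 1ℤ))) * k
        + (c * ((a + 1ℤ) * (b - 1ℤ)) - (β + c) * (- (β + c)) + β * (a * (b - 1ℤ))) * l
        ≡ ((β + c) * (b * β + c) + a * b * β * (b - 1ℤ)) * k
        + ((β + c) * ((b - 1ℤ) * a + (β + c)) + c * (b - 1ℤ)) * l
      go = solve-∀

    -- The coordinates of the element of V acting on V as det (2 L - s).
    A₀ A₁ det : ℤ
    A₀ = - (s * B₁₁ + + 2 * B₀₁)
    A₁ = + 2 * B₀₀ + s * B₀₁
    det = B₀₀ * B₁₁ - B₀₁ * B₀₁

    -- Since 2 θ₂ - s = √D and 2 θ₃ - s = -√D, `M ν` is det √D (E₂ - E₃) with the idempotents E₂ and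
    -- E₃ of θ₂ and θ₃. Its trace measures the difference of their multiplicities.
    ν : Profile
    ν l = A₀ * (c * u⁰ l) + A₁ * (c * u¹ l)

    onV-combination : ∀ {f g : Profile} p q t → ActsOnV f p q → ActsOnV g q t →
      ActsOnV (λ l → - (s * t + + 2 * q) * f l + (+ 2 * p + s * q) * g l)
        (- s * (p * t - q * q)) (+ 2 * (p * t - q * q))
    onV-combination p q t onV-f onV-g k l = acts-congʳ
      (λ m → go s p q t k l (s * l - r * k) (u⁰ m) (u¹ m))
      (acts-linear (- (s * t + + 2 * q)) (+ 2 * p + s * q) (onV-f k l) (onV-g k l))
      where
      go : ∀ s p q t k l m U W →
        - (s * t + + 2 * q) * ((p * k + q * l) * U + (p * l + q * m) * W)
        + (+ 2 * p + s * q) * ((q * k + t * l) * U + (q * l + t * m) * W)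
        ≡ (- s * (p * t - q * q) * k + + 2 * (p * t - q * q) * l) * U
        + (- s * (p * t - q * q) * l + + 2 * (p * t - q * q) * m) * W
      go = solve-∀

    -- On V one has (2 L - s)² = s² - 4 r = D, and f itself lies in V.
    cube : ∀ (f : Profile) k₀ l₀ m → (∀ l → f l ≡ (k₀ u⁰+ l₀ u¹) l) → ActsOnV f (- s * m) (+ 2 * m) →
      ∀ x y → (M f · (M f · (λ z → M f z y))) x ≡ m * m * D * M f x y
    cube f k₀ l₀ m f≡ onV-f x y = begin
      (M f · (M f · (λ z → M f z y))) x
        ≡⟨ sum-cong-≗ (λ z → cong (f (d x z) *_) (trans
             (sum-cong-≗ λ w → cong (f (d z w) *_) (f≡ (d w y)))
             (product (onV-f k₀ l₀) z y))) ⟩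
      sum (λ z → f (d x z) * (k₁ u⁰+ l₁ u¹) (d z y))
        ≡⟨ product (onV-f k₁ l₁) x y ⟩
      ((- s * m * k₁ + + 2 * m * l₁) u⁰+ (- s * m * l₁ + + 2 * m * (s * l₁ - r * k₁)) u¹) (d x y)
        ≡⟨ go s r m k₀ l₀ (u⁰ (d x y)) (u¹ (d x y)) ⟩
      m * m * D * (k₀ u⁰+ l₀ u¹) (d x y)
        ≡⟨ cong (m * m * D *_) (f≡ (d x y)) ⟨
      m * m * D * M f x y ∎
      where
      open ≡-Reasoning
      k₁ l₁ : ℤ
      k₁ = - s * m * k₀ + + 2 * m * l₀
      l₁ = - s * m * l₀ + + 2 * m * (s * l₀ - r * k₀)
      go : ∀ s r m k l U W →
        (- s * m * (- s * m * k + + 2 * m * l) + + 2 * m * (- s * m * l + + 2 * m * (s * l - r * k))) * U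
        + (- s * m * (- s * m * l + + 2 * m * (s * l - r * k))
          + + 2 * m * (s * (- s * m * l + + 2 * m * (s * l - r * k)) - r * (- s * m * k + + 2 * m * l))) * W
        ≡ m * m * (s * s - + 4 * r) * (k * U + l * W)
      go = solve-∀

    ν-cubed : ∀ x y → (M ν · (M ν · (λ z → M ν z y))) x ≡ det * det * D * M ν x y
    ν-cubed = cube ν (A₀ * c) (A₁ * c) det
      (λ l → cong₂ _+_ (sym (*-assoc A₀ c (u⁰ l))) (sym (*-assoc A₁ c (u¹ l))))
      (onV-combination B₀₀ B₀₁ B₁₁ onV-u⁰ onV-u¹)

    diagonal-zero : ∀ (f : Profile) → trace (M f) ≡ 0ℤ → f 0F ≡ 0ℤ
    diagonal-zero f trace≡0 with i*j≡0⇒i≡0∨j≡0 (+ n) (trans (sym (sum-constant n (f 0F)))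
                                   (trans (sum-cong-≗ λ x → cong f (sym (d-refl x))) trace≡0))
    ... | inj₂ f₀≡0 = f₀≡0
    ... | inj₁ n≡0  = contradiction n≡0 (n≢0 o)
      where
      n≢0 : ∀ {n} → Fin n → + n ≢ 0ℤ
      n≢0 zero    ()
      n≢0 (suc _) ()

    -- Shaped after the entry of ν at distance 0: u¹ vanishes there, so the trace sees only `A₀`.
    coefficient-zero : ∀ t v {w} → 0ℤ < w → - t * (c * w) + v * (c * 0ℤ) ≡ 0ℤ → t ≡ 0ℤ
    coefficient-zero t v {w} 0<w eq = *-cancel-pos-≡ (0<* 0<c 0<w)
      (trans eq′ (sym (*-zeroʳ (c * w))))
      where
      go : ∀ t v c w → - t * (c * w) + v * (c * 0ℤ) ≡ - (c * w * t)
      go = solve-∀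
      eq′ : c * w * t ≡ 0ℤ
      eq′ = trans (sym (neg-involutive (c * w * t))) (cong -_ (trans (sym (go t v c w)) eq))

    -- The equality says that the idempotents of θ₂ and θ₃ have the same trace.
    equal-multiplicities : Nonsquare D → s * B₁₁ + + 2 * B₀₁ ≡ 0ℤ
    equal-multiplicities ns = coefficient-zero (s * B₁₁ + + 2 * B₀₁) A₁ 0<u⁰₀
      (diagonal-zero ν (trace-zero (M ν) (M-sym ν) (det * det * D) ν-cubed (nonsquare-scaled {D} {det} det≢0 ns)))
      where
      det≢0 : det ≢ 0ℤ
      det≢0 = nonsquare-determinant ns B₀₁ B₁₁ λ B≡0 → <-irrefl (sym B≡0) 0<B₁₁

    -- The eigenvector u⁰ - g u¹ of L for a root -g of the quadratic.
    module Root (g : ℤ) (root : g * g ≡ - (s * g) - r) where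

      u : Profile
      u = 1ℤ u⁰+ (- g) u¹

      κ : ℤ
      κ = c * u 0F - e * u 2F + b * β * u 3F + (c * u 1F - X * u 2F + β * u 3F) * (- g)

      acts-u : Acts (λ l → c * u l) u (λ l → κ * u l)
      acts-u = acts-congʳ (λ l → trans
          (cong (λ t → (p * 1ℤ + q * (- g)) * u⁰ l + (p * (- g) + q * t) * u¹ l) (trans (go₀ s r g) (sym root)))
          (go₁ p q g (u⁰ l) (u¹ l)))
        (onV u 1ℤ (- g))
        where
        p q : ℤ
        p = c * u 0F - e * u 2F + b * β * u 3F
        q = c * u 1F - X * u 2F + β * u 3F
        go₀ : ∀ s r g → s * (- g) - r * 1ℤ ≡ - (s * g) - r
        go₀ = solve-∀
        go₁ : ∀ p q g U W → (p * 1ℤ + q * (- g)) * U + (p * (- g) + q * (g * g)) * W ≡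
          (p + q * (- g)) * (1ℤ * U + - g * W)
        go₁ = solve-∀

      u₀≡ : u 0F ≡ u⁰₀
      u₀≡ = go u⁰₀ g
        where go : ∀ t g → 1ℤ * t + - g * 0ℤ ≡ t
              go = solve-∀

      0<u₀ : 0ℤ < u 0F
      0<u₀ = subst (0ℤ <_) (sym u₀≡) 0<u⁰₀

      -- The (o, o) entries of c (`M u`)² = κ `M u` are c times a norm and κ times u₀ > 0.
      0<κ : 0ℤ < κ
      0<κ = *-cancel-pos-< 0<u₀ (subst (0ℤ <_) (trans c⟪u,u⟫ (*-comm κ (u 0F)))
        (0<* 0<c (⟪⟫-positive u λ u₀≡0 → <-irrefl (sym u₀≡0) 0<u₀)))
        where
        c⟪u,u⟫ : c * ⟪ u , u ⟫ ≡ κ * u 0F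
        c⟪u,u⟫ = begin
          c * ⟪ u , u ⟫ ≡⟨ *-distribˡ-sum c (λ x → u (d x o) * u (d x o)) ⟩
          sum (λ x → c * (u (d x o) * u (d x o)))
            ≡⟨ sum-cong-≗ (λ x → trans (sym (*-assoc c (u (d x o)) (u (d x o))))
                 (cong (λ t → c * u t * u (d x o)) (d-sym x o))) ⟩
          sum (λ x → c * u (d o x) * u (d x o)) ≡⟨ product acts-u o o ⟩
          κ * u (d o o) ≡⟨ cong (λ t → κ * u t) (d-refl o) ⟩
          κ * u 0F ∎
          where open ≡-Reasoning

      -- By `acts-u`, `M u` is the positive multiple c / κ of the square of a symmetric matrix.
      positive-semidefinite : ∀ ξ → 0ℤ ≤ ξ ∙ (M u · ξ)
      positive-semidefinite ξ = *-cancel-pos-≤ 0<κ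
        (subst (0ℤ ≤_) expanded (0≤* (<⇒≤ 0<c) (sum-nonneg _ λ x → 0≤sq ((M u · ξ) x))))
        where
        open ≡-Reasoning
        column : ∀ x y → c * (M u · (λ w → M u w y)) x ≡ κ * M u x y
        column x y = trans (*-distribˡ-sum c (λ w → M u x w * M u w y))
          (trans (sum-cong-≗ λ w → sym (*-assoc c (M u x w) (M u w y))) (product acts-u x y))
        squared : ∀ x → c * (M u · (M u · ξ)) x ≡ κ * (M u · ξ) x
        squared x = begin
          c * sum (λ w → M u x w * sum (λ y → M u w y * ξ y))
            ≡⟨ cong (c *_) (sum-cong-≗ λ w → *-distribˡ-sum (M u x w) (λ y → M u w y * ξ y)) ⟩
          c * sum (λ w → sum (λ y → M u x w * (M u w y * ξ y)))
            ≡⟨ cong (c *_) (∑-comm (λ w y → M u x w * (M u w y * ξ y))) ⟩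
          c * sum (λ y → sum (λ w → M u x w * (M u w y * ξ y)))
            ≡⟨ cong (c *_) (sum-cong-≗ λ y → trans
                 (sum-cong-≗ λ w → sym (*-assoc (M u x w) (M u w y) (ξ y)))
                 (sym (*-distribʳ-sum (ξ y) (λ w → M u x w * M u w y)))) ⟩
          c * sum (λ y → (M u · (λ w → M u w y)) x * ξ y)
            ≡⟨ *-distribˡ-sum c (λ y → (M u · (λ w → M u w y)) x * ξ y) ⟩
          sum (λ y → c * ((M u · (λ w → M u w y)) x * ξ y))
            ≡⟨ sum-cong-≗ (λ y → trans (sym (*-assoc c _ (ξ y)))
                 (trans (cong (_* ξ y) (column x y)) (*-assoc κ (M u x y) (ξ y)))) ⟩
          sum (λ y → κ * (M u x y * ξ y))
            ≡⟨ *-distribˡ-sum κ (λ y → M u x y * ξ y) ⟨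
          κ * (M u · ξ) x ∎
        expanded : c * ((M u · ξ) ∙ (M u · ξ)) ≡ κ * (ξ ∙ (M u · ξ))
        expanded = begin
          c * ((M u · ξ) ∙ (M u · ξ)) ≡⟨ cong (c *_) (adjoint {M = M u} (M-sym u) ξ (M u · ξ)) ⟨
          c * (ξ ∙ (M u · (M u · ξ))) ≡⟨ *-distribˡ-sum c (λ x → ξ x * (M u · (M u · ξ)) x) ⟩
          sum (λ x → c * (ξ x * (M u · (M u · ξ)) x))
            ≡⟨ sum-cong-≗ (λ x → trans (go c (ξ x) _) (trans (cong (ξ x *_) (squared x)) (go ( ξ x) κ _))) ⟩
          sum (λ x → κ * (ξ x * (M u · ξ) x)) ≡⟨ *-distribˡ-sum κ (λ x → ξ x * (M u · ξ) x) ⟨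
          κ * (ξ ∙ (M u · ξ)) ∎
          where
          go : ∀ c x t → c * (x * t) ≡ x * (c * t)
          go = solve-∀

      -- χ is the set of common neighbours of an edge x y, and the inequality is the
      -- nonnegativity of the form of M u at the component of χ orthogonal to x + y.
      module Edge (x y : Fin n) (x~y : d x y ≡ 1F) where

        y~x : d y x ≡ 1F
        y~x = trans (d-sym y x) x~y

        a₁ : ℤ
        a₁ = a - b

        -- This takes the place of the triangle inequality: L has no entry joining the distances 1
        -- and 3, so the number of such z is zero.
        no-triangle : ∀ {x y z} → d x y ≡ 1F → d x z ≡ 1F → d z y ≢ 3F
        no-triangle {x} {y} {z} x~y x~z dzy≡3 = contradiction
          (term≤sum (λ w → δ₁ (d x w) * δ₃ (d w y)) (λ w → 0≤* (0≤unit 1F (d x w)) (0≤unit 3F (d w y))) z)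
          (<⇒≱ (subst₂ _<_ (sym (trans (A·M δ₃ x y) (trans (cong (L δ₃) x~y) (go a b))))
            (sym (cong₂ (λ k l → δ₁ k * δ₃ l) x~z dzy≡3)) (+<+ (ℕ.s≤s ℕ.z≤n))))
          where
          go : ∀ a b → 0ℤ + (a - b) * 0ℤ + (b - 1ℤ) * (a + 1ℤ) * 0ℤ ≡ 0ℤ
          go = solve-∀

        χ : Vector ℤ n
        χ z = δ₁ (d x z) * δ₁ (d z y)

        χ-cases : ∀ z → (χ z ≡ 1ℤ × d x z ≡ 1F × d z y ≡ 1F) ⊎ χ z ≡ 0ℤ
        χ-cases z with unit-cases 1F (d x z) | unit-cases 1F (d z y)
        ... | inj₁ (x~z , p) | inj₁ (z~y , q) = inj₁ (cong₂ _*_ p q , x~z , z~y)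
        ... | inj₂ p         | _              = inj₂ (cong (_* δ₁ (d z y)) p)
        ... | inj₁ _         | inj₂ q         = inj₂ (trans (cong (δ₁ (d x z) *_) q) (*-zeroʳ (δ₁ (d x z))))

        χ-cong : ∀ {f g : Vector ℤ n} → (∀ z → d x z ≡ 1F → d z y ≡ 1F → f z ≡ g z) → ∀ z → χ z * f z ≡ χ z * g z
        χ-cong {f} {g} f≡g z with χ-cases z
        ... | inj₁ (_ , x~z , z~y) = cong (χ z *_) (f≡g z x~z z~y)
        ... | inj₂ χ≡0             = trans (cong (_* f z) χ≡0) (cong (_* g z) (sym χ≡0))

        common : ∀ {v w} → d v w ≡ 1F → ∑[ z < n ] (δ₁ (d v z) * δ₁ (d z w)) ≡ a₁
        common {v} {w} v~w = trans (A·M δ₁ v w) (trans (cong (L δ₁) v~w) (go a b))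
          where
          go : ∀ a b → 0ℤ + (a - b) * 1ℤ + (b - 1ℤ) * (a + 1ℤ) * 0ℤ ≡ a - b
          go = solve-∀

        sum-χ : sum χ ≡ a₁
        sum-χ = common x~y

        sum-χ-constant : ∀ i → sum (λ z → χ z * i) ≡ a₁ * i
        sum-χ-constant i = trans (sym (*-distribʳ-sum i χ)) (cong (_* i) sum-χ)

        T : ℤ
        T = χ ∙ (M δ₁ · χ)

        S : Vector ℤ n
        S w = ∑[ z < n ] (χ z * δ₁ (d z w))

        -- Counts the pairs (z, w) of adjacent neighbours of x with z in χ: each z has a₁ common
        -- neighbours w with x.
        paths : ∑[ w < n ] (δ₁ (d x w) * S w) ≡ a₁ * a₁
        paths = begin
          sum (λ w → δ₁ (d x w) * S w)
            ≡⟨ sum-cong-≗ (λ w → *-distribˡ-sum (δ₁ (d x w)) (λ z → χ z * δ₁ (d z w))) ⟩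
          sum (λ w → sum (λ z → δ₁ (d x w) * (χ z * δ₁ (d z w))))
            ≡⟨ ∑-comm (λ w z → δ₁ (d x w) * (χ z * δ₁ (d z w))) ⟩
          sum (λ z → sum (λ w → δ₁ (d x w) * (χ z * δ₁ (d z w))))
            ≡⟨ sum-cong-≗ (λ z → trans (sum-cong-≗ λ w →
                 trans (go (δ₁ (d x w)) (χ z) (δ₁ (d z w))) (cong (λ l → χ z * (δ₁ (d x w) * δ₁ l)) (d-sym z w)))
                 (sym (*-distribˡ-sum (χ z) (λ w → δ₁ (d x w) * δ₁ (d w z))))) ⟩
          sum (λ z → χ z * sum (λ w → δ₁ (d x w) * δ₁ (d w z)))
            ≡⟨ sum-cong-≗ (χ-cong λ z x~z _ → common x~z) ⟩
          sum (λ z → χ z * a₁) ≡⟨ sum-χ-constant a₁ ⟩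
          a₁ * a₁ ∎
          where
          open ≡-Reasoning
          go : ∀ p q t → p * (q * t) ≡ q * (p * t)
          go = solve-∀

        S-y : S y ≡ a₁
        S-y = trans (sum-cong-≗ (χ-cong λ z _ z~y → cong δ₁ z~y)) (trans (sum-χ-constant 1ℤ) (*-identityʳ a₁))

        -- The c common neighbours of w and y include x, and x is not in χ.
        S-2 : ∀ w → d x w ≡ 1F → d w y ≡ 2F → S w ≤ c - 1ℤ
        S-2 w x~w dwy≡2 = subst (S w ≤_) total (sum-mono bound)
          where
          total : sum (λ z → 1ℤ * (δ₁ (d w z) * δ₁ (d z y)) + -1ℤ * δ₀ (d x z)) ≡ c - 1ℤ
          total = trans (sum-linear 1ℤ -1ℤ (λ z → δ₁ (d w z) * δ₁ (d z y)) (λ z → δ₀ (d x z)))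
            (trans (cong₂ (λ p q → 1ℤ * p + -1ℤ * q)
              (trans (A·M δ₁ w y) (cong (L δ₁) dwy≡2))
              (trans (sum-cong-≗ λ z → sym (*-identityʳ (δ₀ (d x z)))) (sum-δ₀ (λ _ → 1ℤ) x)))
              (go a b β c))
            where
            go : ∀ a b β c → 1ℤ * (c * 1ℤ + (a * b - β - c) * 0ℤ + β * 0ℤ) + -1ℤ * 1ℤ ≡ c - 1ℤ
            go = solve-∀
          bound : ∀ z → χ z * δ₁ (d z w) ≤ 1ℤ * (δ₁ (d w z) * δ₁ (d z y)) + -1ℤ * δ₀ (d x z)
          bound z with d x z in eq
          ... | 0F = ≤-reflexive (sym (cong₂ (λ k l → 1ℤ * (δ₁ k * δ₁ l) + -1ℤ * 1ℤ)
                  (trans (cong (d w) (sym x≡z)) (trans (d-sym w x) x~w))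
                  (trans (cong (λ v → d v y) (sym x≡z)) x~y)))
            where
            x≡z : x ≡ z
            x≡z = d-zero x z eq
          ... | 1F = ≤-reflexive (trans (cong (λ l → 1ℤ * δ₁ (d z y) * δ₁ l) (d-sym z w))
                       (go (δ₁ (d z y)) (δ₁ (d w z))))
            where
            go : ∀ p q → 1ℤ * p * q ≡ 1ℤ * (q * p) + -1ℤ * 0ℤ
            go = solve-∀
          ... | 2F = subst (0ℤ ≤_) (go (δ₁ (d w z) * δ₁ (d z y))) (0≤* (0≤unit 1F (d w z)) (0≤unit 1F (d z y)))
            where
            go : ∀ p → p ≡ 1ℤ * p + -1ℤ * 0ℤ
            go = solve-∀
          ... | 3F = subst (0ℤ ≤_) (go (δ₁ (d w z) * δ₁ (d z y))) (0≤* (0≤unit 1F (d w z)) (0≤unit 1F (d z y)))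
            where
            go : ∀ p → p ≡ 1ℤ * p + -1ℤ * 0ℤ
            go = solve-∀

        T-sum : T ≡ ∑[ w < n ] (δ₁ (d x w) * S w * δ₁ (d w y))
        T-sum = trans (adjoint {M = M δ₁} (M-sym δ₁) χ χ) (sum-cong-≗ λ w →
          trans (cong (_* χ w) (sum-cong-≗ λ z → trans (*-comm (δ₁ (d w z)) (χ z)) (cong (λ l → χ z * δ₁ l) (d-sym w z))))
            (go (S w) (δ₁ (d x w)) (δ₁ (d w y))))
          where
          go : ∀ s p q → s * (p * q) ≡ p * s * q
          go = solve-∀

        -- Of the a₁² pairs counted by `paths`, those with w = y number a₁ and those with w in χ
        -- number T. Each of the b₁ = (b - 1) (a + 1) neighbours w of x at distance 2 from y
        -- contributes at most c - 1.
        T-bound : a₁ * a₁ - a₁ - (a + 1ℤ) * (b - 1ℤ) * (c - 1ℤ) ≤ T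
        T-bound = ≤-by (upper - (a₁ * a₁ - T))
          (i≤j⇒0≤j-i (subst₂ _≤_ difference total (sum-mono bound)))
          (go a₁ (a + 1ℤ) (b - 1ℤ) (c - 1ℤ) T)
          where
          upper : ℤ
          upper = a₁ * 1ℤ + (c - 1ℤ) * ((b - 1ℤ) * (a + 1ℤ))
          go : ∀ q m m′ t T → T ≡ q * q - q - m * m′ * t + (q * 1ℤ + t * (m′ * m) - (q * q - T))
          go = solve-∀
          difference : sum (λ w → 1ℤ * (δ₁ (d x w) * S w) + -1ℤ * (δ₁ (d x w) * S w * δ₁ (d w y))) ≡ a₁ * a₁ - T
          difference = trans (sum-linear 1ℤ -1ℤ (λ w → δ₁ (d x w) * S w) (λ w → δ₁ (d x w) * S w * δ₁ (d w y)))
            (trans (cong₂ (λ p q → 1ℤ * p + -1ℤ * q) paths (sym T-sum)) (subtract (a₁ * a₁) T))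
            where
            subtract : ∀ p q → 1ℤ * p + -1ℤ * q ≡ p - q
            subtract = solve-∀
          total : sum (λ w → a₁ * (δ₁ (d x w) * δ₀ (d w y)) + (c - 1ℤ) * (δ₁ (d x w) * δ₂ (d w y))) ≡ upper
          total = trans (sum-linear a₁ (c - 1ℤ) (λ w → δ₁ (d x w) * δ₀ (d w y)) (λ w → δ₁ (d x w) * δ₂ (d w y)))
            (cong₂ (λ p q → a₁ * p + (c - 1ℤ) * q)
              (trans (A·M δ₀ x y) (trans (cong (L δ₀) x~y) (go₀ a b)))
              (trans (A·M δ₂ x y) (trans (cong (L δ₂) x~y) (go₁ a b))))
            where
            go₀ : ∀ a b → 1ℤ + (a - b) * 0ℤ + (b - 1ℤ) * (a + 1ℤ) * 0ℤ ≡ 1ℤ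
            go₀ = solve-∀
            go₁ : ∀ a b → 0ℤ + (a - b) * 0ℤ + (b - 1ℤ) * (a + 1ℤ) * 1ℤ ≡ (b - 1ℤ) * (a + 1ℤ)
            go₁ = solve-∀
          bound : ∀ w → 1ℤ * (δ₁ (d x w) * S w) + -1ℤ * (δ₁ (d x w) * S w * δ₁ (d w y)) ≤
            a₁ * (δ₁ (d x w) * δ₀ (d w y)) + (c - 1ℤ) * (δ₁ (d x w) * δ₂ (d w y))
          bound w with unit-cases 1F (d x w)
          ... | inj₂ p = ≤-reflexive (trans
                  (cong (λ t → 1ℤ * (t * S w) + -1ℤ * (t * S w * δ₁ (d w y))) p)
                  (trans (zero-sides (S w) (δ₁ (d w y)) a₁ (c - 1ℤ) (δ₀ (d w y)) (δ₂ (d w y)))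
                    (cong (λ t → a₁ * (t * δ₀ (d w y)) + (c - 1ℤ) * (t * δ₂ (d w y))) (sym p))))
            where
            zero-sides : ∀ s t p q v w → 1ℤ * (0ℤ * s) + -1ℤ * (0ℤ * s * t) ≡ p * (0ℤ * v) + q * (0ℤ * w)
            zero-sides = solve-∀
          ... | inj₁ (x~w , p) with d w y in eq
          ...   | 0F = ≤-reflexive (trans (cong (λ t → 1ℤ * (t * S w) + -1ℤ * (t * S w * 0ℤ)) p)
                    (trans (at-0 (S w) (c - 1ℤ))
                    (trans (cong (λ t → t * (1ℤ * 1ℤ) + (c - 1ℤ) * (1ℤ * 0ℤ)) (trans (cong S (d-zero w y eq)) S-y))
                    (cong (λ t → a₁ * (t * 1ℤ) + (c - 1ℤ) * (t * 0ℤ)) (sym p)))))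
            where
            at-0 : ∀ s q → 1ℤ * (1ℤ * s) + -1ℤ * (1ℤ * s * 0ℤ) ≡ s * (1ℤ * 1ℤ) + q * (1ℤ * 0ℤ)
            at-0 = solve-∀
          ...   | 1F = ≤-reflexive (at-1 (δ₁ (d x w)) (S w) a₁ (c - 1ℤ))
            where
            at-1 : ∀ t s p q → 1ℤ * (t * s) + -1ℤ * (t * s * 1ℤ) ≡ p * (t * 0ℤ) + q * (t * 0ℤ)
            at-1 = solve-∀
          ...   | 2F = subst₂ _≤_
                    (trans (at-2 (S w)) (cong (λ t → 1ℤ * (t * S w) + -1ℤ * (t * S w * 0ℤ)) (sym p)))
                    (trans (at-2′ a₁ (c - 1ℤ)) (cong (λ t → a₁ * (t * 0ℤ) + (c - 1ℤ) * (t * 1ℤ)) (sym p)))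
                    (S-2 w x~w eq)
            where
            at-2 : ∀ s → s ≡ 1ℤ * (1ℤ * s) + -1ℤ * (1ℤ * s * 0ℤ)
            at-2 = solve-∀
            at-2′ : ∀ p q → q ≡ p * (1ℤ * 0ℤ) + q * (1ℤ * 1ℤ)
            at-2′ = solve-∀
          ...   | 3F = contradiction eq (no-triangle x~y x~w)

        u₀ u₁ u₂ : ℤ
        u₀ = u 0F
        u₁ = u 1F
        u₂ = u 2F

        -- Neighbours of x are at mutual distance at most 2, so on χ the matrix `M u` agrees with u₂
        -- J + (u₀ - u₂) I + (u₁ - u₂) A, where J is the all-ones matrix.
        χMuχ : χ ∙ (M u · χ) ≡ u₂ * (a₁ * a₁) + ((u₀ - u₂) * a₁ + (u₁ - u₂) * T)
        χMuχ = begin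
          χ ∙ (M u · χ)
            ≡⟨ sum-cong-≗ (χ-cong λ z x~z _ → trans (sum-cong-≗ λ w → trans (*-comm (M u z w) (χ w))
                 (trans (χ-cong {g = λ w → v (d z w)} (λ w x~w _ → near (d z w) (no-triangle x~w x~z)) w)
                   (regroup (χ w) u₀ u₁ u₂ (δ₀ (d z w)) (δ₁ (d z w)))))
                 (trans (sum-linear₃ u₂ (u₀ - u₂) (u₁ - u₂) χ (λ w → δ₀ (d z w) * χ w) (λ w → δ₁ (d z w) * χ w))
                   (cong₂ (λ p q → u₂ * p + ((u₀ - u₂) * q + (u₁ - u₂) * (M δ₁ · χ) z)) sum-χ (sum-δ₀ χ z)))) ⟩
          sum (λ z → χ z * (u₂ * a₁ + ((u₀ - u₂) * χ z + (u₁ - u₂) * (M δ₁ · χ) z)))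
            ≡⟨ ∙-linear₃ u₂ (u₀ - u₂) (u₁ - u₂) χ (λ _ → a₁) χ (M δ₁ · χ) ⟩
          u₂ * (χ ∙ (λ _ → a₁)) + ((u₀ - u₂) * (χ ∙ χ) + (u₁ - u₂) * T)
            ≡⟨ cong₂ (λ p q → u₂ * p + ((u₀ - u₂) * q + (u₁ - u₂) * T)) (sum-χ-constant a₁) χ∙χ ⟩
          _ ∎
          where
          open ≡-Reasoning
          v : Profile
          v l = u₂ + ((u₀ - u₂) * δ₀ l + (u₁ - u₂) * δ₁ l)
          near : ∀ l → l ≢ 3F → u l ≡ v l
          near 0F _ = go u₀ u₁ u₂
            where go : ∀ p q t → p ≡ t + ((p - t) * 1ℤ + (q - t) * 0ℤ)
                  go = solve-∀
          near 1F _ = go u₀ u₁ u₂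
            where go : ∀ p q t → q ≡ t + ((p - t) * 0ℤ + (q - t) * 1ℤ)
                  go = solve-∀
          near 2F _ = go u₀ u₁ u₂
            where go : ∀ p q t → t ≡ t + ((p - t) * 0ℤ + (q - t) * 0ℤ)
                  go = solve-∀
          near 3F l≢3 = contradiction refl l≢3
          regroup : ∀ x p q t v w → x * (t + ((p - t) * v + (q - t) * w)) ≡ t * x + ((p - t) * (v * x) + (q - t) * (w * x))
          regroup = solve-∀
          χ∙χ : χ ∙ χ ≡ a₁
          χ∙χ = trans (sum-cong-≗ (χ-cong λ z x~z z~y → cong₂ (λ k l → δ₁ k * δ₁ l) x~z z~y))
            (trans (sum-χ-constant 1ℤ) (*-identityʳ a₁))

        α γ : ℤ
        α = - (a₁ * u₁)
        γ = u₀ + u₁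

        ξ : Vector ℤ n
        ξ z = α * δ₀ (d x z) + (α * δ₀ (d y z) + γ * χ z)

        ξ∙ : ∀ f → ξ ∙ f ≡ α * f x + (α * f y + γ * (χ ∙ f))
        ξ∙ f = begin
          ξ ∙ f ≡⟨ ∙-comm ξ f ⟩
          f ∙ ξ ≡⟨ ∙-linear₃ α α γ f (λ z → δ₀ (d x z)) (λ z → δ₀ (d y z)) χ ⟩
          _ ≡⟨ cong₂ (λ p q → α * p + q)
                 (trans (∙-comm f (λ z → δ₀ (d x z))) (sum-δ₀ f x))
                 (cong₂ (λ p q → α * p + γ * q)
                   (trans (∙-comm f (λ z → δ₀ (d y z))) (sum-δ₀ f y)) (∙-comm f χ)) ⟩
          _ ∎
          where open ≡-Reasoning

        Muξ : ∀ z → (M u · ξ) z ≡ α * M u z x + (α * M u z y + γ * (M u · χ) z)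
        Muξ z = trans (∙-comm (M u z) ξ) (trans (ξ∙ (M u z))
          (cong (λ t → α * M u z x + (α * M u z y + γ * t)) (∙-comm χ (M u z))))

        form : ξ ∙ (M u · ξ) ≡ γ * (γ * (χ ∙ (M u · χ)) - + 2 * (a₁ * u₁ * (a₁ * u₁)))
        form = begin
          ξ ∙ (M u · ξ) ≡⟨ ξ∙ (M u · ξ) ⟩
          α * (M u · ξ) x + (α * (M u · ξ) y + γ * (χ ∙ (M u · ξ)))
            ≡⟨ cong₂ (λ p q → α * p + (α * q + γ * (χ ∙ (M u · ξ)))) at-x at-y ⟩
          _ ≡⟨ cong (λ t → α * (α * u₀ + (α * u₁ + γ * (a₁ * u₁))) + (α * (α * u₁ + (α * u₀ + γ * (a₁ * u₁))) + γ * t)) at-χ ⟩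
          _ ≡⟨ go a₁ u₀ u₁ (χ ∙ (M u · χ)) ⟩
          _ ∎
          where
          open ≡-Reasoning
          χx : (M u · χ) x ≡ a₁ * u₁
          χx = trans (∙-comm (M u x) χ) (trans (sum-cong-≗ (χ-cong λ z x~z _ → cong u x~z)) (sum-χ-constant u₁))
          χy : (M u · χ) y ≡ a₁ * u₁
          χy = trans (∙-comm (M u y) χ) (trans (sum-cong-≗ (χ-cong λ z _ z~y → cong u (trans (d-sym y z) z~y))) (sum-χ-constant u₁))
          at-x : (M u · ξ) x ≡ α * u₀ + (α * u₁ + γ * (a₁ * u₁))
          at-x = trans (Muξ x) (cong₂ (λ p q → α * p + q) (cong u (d-refl x))
            (cong₂ (λ p q → α * p + γ * q) (cong u x~y) χx))
          at-y : (M u · ξ) y ≡ α * u₁ + (α * u₀ + γ * (a₁ * u₁))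
          at-y = trans (Muξ y) (cong₂ (λ p q → α * p + q) (cong u y~x)
            (cong₂ (λ p q → α * p + γ * q) (cong u (d-refl y)) χy))
          at-χ : χ ∙ (M u · ξ) ≡ α * (a₁ * u₁) + (α * (a₁ * u₁) + γ * (χ ∙ (M u · χ)))
          at-χ = trans (sum-cong-≗ λ z → cong (χ z *_) (Muξ z))
            (trans (∙-linear₃ α α γ χ (λ z → M u z x) (λ z → M u z y) (M u · χ))
              (cong₂ (λ p q → α * p + (α * q + γ * (χ ∙ (M u · χ))))
                (trans (sum-cong-≗ (χ-cong λ z x~z _ → cong u (trans (d-sym z x) x~z))) (sum-χ-constant u₁))
                (trans (sum-cong-≗ (χ-cong λ z _ z~y → cong u z~y)) (sum-χ-constant u₁))))
          go : ∀ m p q t → let α = - (m * q) in let γ = p + q in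
            α * (α * p + (α * q + γ * (m * q))) + (α * (α * q + (α * p + γ * (m * q)))
              + γ * (α * (m * q) + (α * (m * q) + γ * t)))
            ≡ γ * (γ * t - + 2 * (m * q * (m * q)))
          go = solve-∀

        -- After division by γ, positive because g < k = a b, the form does not increase with T, as
        -- u₂ - u₁ = (g - 1) (k + g). So T may be replaced by its lower bound `T₀`, and what remains
        -- has the positive factor m² (k + g).
        local-inequality : 1ℤ < g → g < a * b →
          a₁ * ((a₁ + 1ℤ) * g - a * b) ≤ (c - 1ℤ) * (g - 1ℤ) * (a * b - g)
        local-inequality 1<g g<k = 0≤i-j⇒j≤i (*-cancel-pos-≤ (0<* (0<* 0<m 0<m) 0<k+g)
          (subst (0ℤ ≤_) (factored (a * b) m g a₁ (c - 1ℤ))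
            (subst₂ (λ p q → 0ℤ ≤ (p + q) * Φ p q v T₀ - + 2 * (a₁ * q * (a₁ * q)))
              u₀≡ u₁≡ (0≤+′ (subst (λ t → 0ℤ ≤ γ * Φ u₀ u₁ t T - + 2 * (a₁ * u₁ * (a₁ * u₁))) u₂≡ 0≤γΦ)))))
          where
          m v T₀ : ℤ
          m = (a + 1ℤ) * (b - 1ℤ)
          v = (g - 1ℤ) * (a * b + g) + - g * m
          T₀ = a₁ * a₁ - a₁ - m * (c - 1ℤ)
          Φ : ℤ → ℤ → ℤ → ℤ → ℤ
          Φ u₀ u₁ u₂ T = u₂ * (a₁ * a₁) + ((u₀ - u₂) * a₁ + (u₁ - u₂) * T)
          0<m : 0ℤ < m
          0<m = 0<* 0<a+1 0<b-1
          0<g-1 : 0ℤ < g - 1ℤ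
          0<g-1 = i<j⇒0<j-i 1<g
          0<k+g : 0ℤ < a * b + g
          0<k+g = +-mono-< (0<* 0<a 0<b) (<-trans (+<+ (ℕ.s≤s ℕ.z≤n)) 1<g)
          u₁≡ : u₁ ≡ - g * m
          u₁≡ = go g m
            where go : ∀ g m → 1ℤ * 0ℤ + - g * m ≡ - g * m
                  go = solve-∀
          edge-value : ∀ a b g → (g + a) * (g - b) ≡ (g - 1ℤ) * (a * b + g) + - g * ((a + 1ℤ) * (b - 1ℤ))
          edge-value = solve-∀
          u₂≡ : u₂ ≡ v
          u₂≡ = trans (go₀ a b β c g) (trans (cong (_+ ((a - b) * g - a * b)) (sym root)) (trans (go₁ a b g) (edge-value a b g)))
            where
            go₀ : ∀ a b β c g → 1ℤ * (- (b * β + c)) + - g * (- (β + c)) ≡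
              - ((a - b - (β + c)) * g) - (b * β + c - a * b) + ((a - b) * g - a * b)
            go₀ = solve-∀
            go₁ : ∀ a b g → g * g + ((a - b) * g - a * b) ≡ (g + a) * (g - b)
            go₁ = solve-∀
          γ≡ : γ ≡ m * (a * b - g)
          γ≡ = trans (cong₂ _+_ u₀≡ u₁≡) (go a b g)
            where go : ∀ a b g → a * b * ((a + 1ℤ) * (b - 1ℤ)) + - g * ((a + 1ℤ) * (b - 1ℤ)) ≡ (a + 1ℤ) * (b - 1ℤ) * (a * b - g)
                  go = solve-∀
          0<γ : 0ℤ < γ
          0<γ = subst (0ℤ <_) (sym γ≡) (0<* 0<m (i<j⇒0<j-i g<k))
          0≤γΦ : 0ℤ ≤ γ * Φ u₀ u₁ u₂ T - + 2 * (a₁ * u₁ * (a₁ * u₁))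
          0≤γΦ = *-cancel-pos-≤ 0<γ (subst (0ℤ ≤_)
            (trans form (cong (λ t → γ * (γ * t - + 2 * (a₁ * u₁ * (a₁ * u₁)))) χMuχ))
            (positive-semidefinite ξ))
          0≤+′ : 0ℤ ≤ γ * Φ u₀ u₁ (v) T - + 2 * (a₁ * u₁ * (a₁ * u₁)) →
            0ℤ ≤ γ * Φ u₀ u₁ (v) T₀ - + 2 * (a₁ * u₁ * (a₁ * u₁))
          0≤+′ 0≤ = ≤-trans 0≤ (≤-by (γ * ((v - u₁) * (T - T₀)))
            (0≤* (<⇒≤ 0<γ) (0≤* 0≤u₂-u₁ (i≤j⇒0≤j-i T-bound)))
            (go γ (v) (a₁ * a₁) ((u₀ - v) * a₁) u₁ T T₀ (+ 2 * (a₁ * u₁ * (a₁ * u₁)))))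
            where
            go : ∀ γ v p q u T T₀ w → γ * (v * p + (q + (u - v) * T₀)) - w ≡
              γ * (v * p + (q + (u - v) * T)) - w + γ * ((v - u) * (T - T₀))
            go = solve-∀
            0≤u₂-u₁ : 0ℤ ≤ v - u₁
            0≤u₂-u₁ = subst (0ℤ ≤_) (trans (go′ g (a * b) m) (cong (λ t → v - t) (sym u₁≡)))
              (0≤* (<⇒≤ 0<g-1) (<⇒≤ 0<k+g))
              where
              go′ : ∀ g k m → (g - 1ℤ) * (k + g) ≡ (g - 1ℤ) * (k + g) + - g * m - - g * m
              go′ = solve-∀
          factored : ∀ k m g q t → let v = (g - 1ℤ) * (k + g) + - g * m in
            (k * m + - g * m) * (v * (q * q) + ((k * m - v) * q + (- g * m - v) * (q * q - q - m * t)))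
            - + 2 * (q * (- g * m) * (q * (- g * m)))
            ≡ m * m * (k + g) * (t * (g - 1ℤ) * (k - g) - q * ((q + 1ℤ) * g - k))
          factored = solve-∀

  -- Arithmetic of the parameters

  -- Many contradictions below are certificates of this shape: a nonnegative and a positive
  -- expression whose sum is zero, by the given equations and the ring solver.
  positivity : ∀ {i j} → 0ℤ ≤ i → 0ℤ < j → i + j ≡ 0ℤ → ⊥
  positivity 0≤i 0<j eq = <-irrefl (sym eq) (+-mono-≤-< 0≤i 0<j)

  0<-difference : ∀ {i j} → 0ℤ < j - i → i < j
  0<-difference {i} {j} 0<j-i = subst₂ _<_ (+-identityˡ i) (go i j) (+-monoˡ-< i 0<j-i)
    where
    go : ∀ i j → j - i + i ≡ j
    go = solve-∀

  0<⇒1≤ : ∀ {i} → 0ℤ < i → 1ℤ ≤ i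
  0<⇒1≤ = i<j⇒suc[i]≤j

  -- Natural coefficients, lowest degree first. A polynomial in b that has such coefficients in
  -- powers of b - 3 is nonnegative for b ≥ 3.
  horner : List ℕ → ℤ → ℤ
  horner []       x = 0ℤ
  horner (i ∷ is) x = + i + x * horner is x

  0≤horner : ∀ is {x} → 0ℤ ≤ x → 0ℤ ≤ horner is x
  0≤horner []       0≤x = ≤-refl
  0≤horner (i ∷ is) 0≤x = 0≤+ {+ i} (+≤+ ℕ.z≤n) (0≤* 0≤x (0≤horner is 0≤x))

  -- m divides n² and is coprime to n, so it divides n, and then m = 1.
  coprime-square : ∀ m n d → Coprime m n → d ℕ.* (m ℕ.* m) ≡ n ℕ.* n → d ≡ n ℕ.* n
  coprime-square m n d coprime eq = begin
    d                      ≡⟨ ℕ.*-identityʳ d ⟨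
    d ℕ.* 1                ≡⟨ cong (λ t → d ℕ.* (t ℕ.* t)) m≡1 ⟨
    d ℕ.* (m ℕ.* m)        ≡⟨ eq ⟩
    n ℕ.* n                ∎
    where
    open ≡-Reasoning
    m∣n : m ∣ n
    m∣n = coprime-divisor coprime (divides (d ℕ.* m) (trans (sym eq) (sym (ℕ.*-assoc d m m))))
    m≡1 : m ≡ 1
    m≡1 = coprime (∣-refl , m∣n)

  reduced-square : ∀ m n d g .{{_ : ℕ.NonZero g}} → Coprime m n →
    d ℕ.* ((m ℕ.* g) ℕ.* (m ℕ.* g)) ≡ (n ℕ.* g) ℕ.* (n ℕ.* g) → d ≡ n ℕ.* n
  reduced-square m n d g coprime eq = coprime-square m n d coprime
    (ℕ.*-cancelʳ-≡ (d ℕ.* (m ℕ.* m)) (n ℕ.* n) (g ℕ.* g) {{ℕ.m*n≢0 g g}}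
      (trans (go d m g) (trans eq (go′ n g))))
    where
    go : ∀ d m g → d ℕ.* (m ℕ.* m) ℕ.* (g ℕ.* g) ≡ d ℕ.* ((m ℕ.* g) ℕ.* (m ℕ.* g))
    go = ℕSolver.solve-∀
    go′ : ∀ m g → (m ℕ.* g) ℕ.* (m ℕ.* g) ≡ m ℕ.* m ℕ.* (g ℕ.* g)
    go′ = ℕSolver.solve-∀

  -- Division by the gcd reduces the equation to coprime m and n. Thus a natural number with a
  -- rational square root has a natural one.
  square-quotient : ∀ m n d .{{_ : ℕ.NonZero m}} → d ℕ.* (m ℕ.* m) ≡ n ℕ.* n → ∃ λ e → d ≡ e ℕ.* e
  square-quotient m n d eq = n ℕ./ gcd m n , reduced-square (m ℕ./ gcd m n) (n ℕ./ gcd m n) d (gcd m n)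
    (coprime-/gcd m n)
    (subst₂ (λ m n → d ℕ.* (m ℕ.* m) ≡ n ℕ.* n)
      (sym (m/n*n≡m (gcd[m,n]∣m m n))) (sym (m/n*n≡m (gcd[m,n]∣n m n))) eq)
    where
    instance
      g≢0 : ℕ.NonZero (gcd m n)
      g≢0 = ℕ.≢-nonZero (gcd[m,n]≢0 m n (inj₁ (ℕ.≢-nonZero⁻¹ m)))

  ∣sq∣ : ∀ i → + (∣ i ∣ ℕ.* ∣ i ∣) ≡ i * i
  ∣sq∣ (+ n)      = pos-* n n
  ∣sq∣ (-[1+ n ]) = refl

  negative-nonsquare : ∀ {D} → D < 0ℤ → Nonsquare D
  negative-nonsquare {D} D<0 i j i≢0 eq = positivity (0≤sq j) (0<* (i<j⇒0<j-i D<0) (sq-pos i≢0))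
    (trans (cong (_+ (0ℤ - D) * (i * i)) (sym eq)) (go D (i * i)))
    where
    go : ∀ D t → D * t + (0ℤ - D) * t ≡ 0ℤ
    go = solve-∀

  ∣∣-square : ∀ n i j → + n * (i * i) ≡ j * j → n ℕ.* (∣ i ∣ ℕ.* ∣ i ∣) ≡ ∣ j ∣ ℕ.* ∣ j ∣
  ∣∣-square n i j eq = +-injective {n ℕ.* (∣ i ∣ ℕ.* ∣ i ∣)} {∣ j ∣ ℕ.* ∣ j ∣} (begin
    + (n ℕ.* (∣ i ∣ ℕ.* ∣ i ∣))   ≡⟨ pos-* n (∣ i ∣ ℕ.* ∣ i ∣) ⟩
    + n * + (∣ i ∣ ℕ.* ∣ i ∣)     ≡⟨ cong (+ n *_) (∣sq∣ i) ⟩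
    + n * (i * i)                 ≡⟨ eq ⟩
    j * j                         ≡⟨ ∣sq∣ j ⟨
    + (∣ j ∣ ℕ.* ∣ j ∣)           ∎)
    where open ≡-Reasoning

  integral-square-root : ∀ n i j → i ≢ 0ℤ → + n * (i * i) ≡ j * j → ∃ λ e → n ≡ e ℕ.* e
  integral-square-root n i j i≢0 eq = square-quotient ∣ i ∣ ∣ j ∣ n (∣∣-square n i j eq)
    where
    instance
      ∣i∣≢0 : ℕ.NonZero ∣ i ∣
      ∣i∣≢0 = ℕ.≢-nonZero λ ∣i∣≡0 → i≢0 (∣i∣≡0⇒i≡0 ∣i∣≡0)

  -- For D = n ≥ 0 a search among e ≤ n decides, since `integral-square-root` turns a rational root
  -- into a natural one.
  square? : ∀ D → (∃ λ e → 0ℤ ≤ e × D ≡ e * e) ⊎ Nonsquare D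
  square? D@(-[1+ n ]) = inj₂ (negative-nonsquare {D} -<+)
  square? (+ n)    = decide (ℕ.anyUpTo? (λ e → n ℕ.≟ e ℕ.* e) (suc n))
    where
    n≤n*n : ∀ n → n ℕ.≤ n ℕ.* n
    n≤n*n ℕ.zero  = ℕ.z≤n
    n≤n*n (suc n) = ℕ.m≤m*n (suc n) (suc n)

    bounded : (∃ λ e → n ≡ e ℕ.* e) → ∃ λ e → e ℕ.< suc n × n ≡ e ℕ.* e
    bounded (e , n≡e²) = e , ℕ.s≤s (subst (e ℕ.≤_) (sym n≡e²) (n≤n*n e)) , n≡e²

    decide : Dec (∃ λ e → e ℕ.< suc n × n ≡ e ℕ.* e) → (∃ λ e → 0ℤ ≤ e × + n ≡ e * e) ⊎ Nonsquare (+ n)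
    decide (yes (e , _ , n≡e²)) = inj₁ (+ e , +≤+ ℕ.z≤n , trans (cong +_ n≡e²) (pos-* e e))
    decide (no none) = inj₂ λ i j i≢0 eq → none (bounded (integral-square-root n i j i≢0 eq))

  parity : ∀ i → ∃ λ j → i ≡ + 2 * j ⊎ i ≡ + 2 * j + 1ℤ
  parity i with i %ℕ 2 | n%ℕd<d i 2 | a≡a%ℕn+[a/ℕn]*n i 2
  ... | 0 | _ | eq = i /ℕ 2 , inj₁ (trans eq (go (i /ℕ 2)))
    where go : ∀ q → 0ℤ + q * + 2 ≡ + 2 * q
          go = solve-∀
  ... | 1 | _ | eq = i /ℕ 2 , inj₂ (trans eq (go (i /ℕ 2)))
    where go : ∀ q → 1ℤ + q * + 2 ≡ + 2 * q + 1ℤ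
          go = solve-∀
  ... | suc (suc _) | ℕ.s≤s (ℕ.s≤s ()) | _

  even≢odd : ∀ i j → + 2 * i ≢ + 2 * j + 1ℤ
  even≢odd i j eq = odd≢0 (i - j) (trans (go i j) (trans (cong (_- + 2 * j) eq) (go′ j)))
    where
    go : ∀ i j → + 2 * (i - j) ≡ + 2 * i - + 2 * j
    go = solve-∀
    go′ : ∀ j → + 2 * j + 1ℤ - + 2 * j ≡ 1ℤ
    go′ = solve-∀
    odd≢0 : ∀ i → + 2 * i ≢ 1ℤ
    odd≢0 (+ 0) ()
    odd≢0 +[1+ n ] eq with +-injective eq
    ... | eq′ = ℕ.1+n≢0 (ℕ.suc-injective (trans (cong suc (sym (ℕ.+-suc n (n ℕ.+ 0)))) eq′))
    odd≢0 (-[1+ n ]) ()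

  -- w = (e - p) / 2 is the positive root of w² + p w - P, and w + p is minus the other root. The
  -- numerator is even because (e - p) (e + p) = 4 P.
  integral-root : ∀ p P e → 0ℤ ≤ e → p * p + + 4 * P ≡ e * e → 0ℤ < P →
    ∃ λ w → 0ℤ < w × 0ℤ < w + p × w * (w + p) ≡ P
  integral-root p P e 0≤e disc 0<P with parity (e - p)
  ... | w , inj₂ odd = contradiction (trans (go₀ P) (trans difference (go₁ w p))) (even≢odd (+ 2 * P) (+ 2 * w * w + + 2 * w + + 2 * w * p + p))
    where
    go₀ : ∀ P → + 2 * (+ 2 * P) ≡ + 4 * P
    go₀ = solve-∀
    go₁ : ∀ w p → (+ 2 * w + 1ℤ) * (+ 2 * w + 1ℤ + + 2 * p) ≡
      + 2 * (+ 2 * w * w + + 2 * w + + 2 * w * p + p) + 1ℤ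
    go₁ = solve-∀
    difference : + 4 * P ≡ (+ 2 * w + 1ℤ) * (+ 2 * w + 1ℤ + + 2 * p)
    difference = begin
      + 4 * P                      ≡⟨ go₂ p (+ 4 * P) ⟩
      p * p + + 4 * P - p * p      ≡⟨ cong (_- p * p) disc ⟩
      e * e - p * p                ≡⟨ go₃ e p ⟩
      (e - p) * (e - p + + 2 * p)  ≡⟨ cong (λ t → t * (t + + 2 * p)) odd ⟩
      _ ∎
      where
      open ≡-Reasoning
      go₂ : ∀ p P → P ≡ p * p + P - p * p
      go₂ = solve-∀
      go₃ : ∀ e p → e * e - p * p ≡ (e - p) * (e - p + + 2 * p)
      go₃ = solve-∀
  ... | w , inj₁ even = w , 0<w , *-cancel-pos-< 0<w (subst (0ℤ <_) (sym product) 0<P) , product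
    where
    product : w * (w + p) ≡ P
    product = *-cancel-pos-≡ {+ 4} (+<+ (ℕ.s≤s ℕ.z≤n)) (begin
      + 4 * (w * (w + p))              ≡⟨ go₀ w p ⟩
      + 2 * w * (+ 2 * w + + 2 * p)    ≡⟨ cong (λ t → t * (t + + 2 * p)) even ⟨
      (e - p) * (e - p + + 2 * p)      ≡⟨ go₁ e p ⟩
      e * e - p * p                    ≡⟨ cong (_- p * p) disc ⟨
      p * p + + 4 * P - p * p          ≡⟨ go₂ p (+ 4 * P) ⟩
      + 4 * P                          ∎)
      where
      open ≡-Reasoning
      go₀ : ∀ w p → + 4 * (w * (w + p)) ≡ + 2 * w * (+ 2 * w + + 2 * p)
      go₀ = solve-∀
      go₁ : ∀ e p → (e - p) * (e - p + + 2 * p) ≡ e * e - p * p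
      go₁ = solve-∀
      go₂ : ∀ p P → p * p + P - p * p ≡ P
      go₂ = solve-∀
    e≡ : e ≡ + 2 * w + p
    e≡ = trans (go e p) (cong (_+ p) even)
      where
      go : ∀ e p → e ≡ e - p + p
      go = solve-∀
    -- If w ≤ 0 then w e = w² + P > 0 although e ≥ 0.
    0<w : 0ℤ < w
    0<w = ≰⇒> λ w≤0 → positivity
      (0≤+ (0≤* (i≤j⇒0≤j-i w≤0) 0≤e) (0≤sq w)) 0<P
      (trans (cong₂ (λ s t → (0ℤ - w) * s + w * w + t) e≡ (sym product)) (go w p))
      where
      go : ∀ w p → (0ℤ - w) * (+ 2 * w + p) + w * w + w * (w + p) ≡ 0ℤ
      go = solve-∀

  -- A positive product forces Q ≥ 1, and then F Q ≥ F exceeds the constant. The argument `m` is one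
  -- less than that constant, which is thereby positive.
  no-factorisation : ∀ {F Q} m → 0ℤ < F - +[1+ m ] → F * Q ≢ +[1+ m ]
  no-factorisation {F} {Q} m m<F FQ≡m = positivity (0≤* (<⇒≤ 0<F) (i≤j⇒0≤j-i (0<⇒1≤ 0<Q))) m<F
    (trans (go F Q +[1+ m ]) (i≡j⇒i-j≡0 FQ≡m))
    where
    0<F : 0ℤ < F
    0<F = subst (0ℤ <_) (go₀ F +[1+ m ]) (+-mono-<-≤ m<F (+≤+ {0} {ℕ.suc m} ℕ.z≤n))
      where
      go₀ : ∀ F m → F - m + m ≡ F
      go₀ = solve-∀
    0<Q : 0ℤ < Q
    0<Q = *-cancel-pos-< 0<F (subst (0ℤ <_) (sym FQ≡m) (+<+ (ℕ.s≤s ℕ.z≤n)))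
    go : ∀ F Q m → F * (Q - 1ℤ) + (F - m) ≡ F * Q - m
    go = solve-∀

  -- Eliminating c from the multiplicity equation for p = 1 leaves a factorisation of a
  -- constant.
  no-solution₃ : ∀ X c → 0ℤ < X - + 21 → let Y = + 3 * X + (+ 3 - 1ℤ) * (1ℤ - + 3) in
    -- The factor 16 X - 14 is twice 2 X + 2 Y + 1. Dividing 256 X Y by it leaves the remainder
    -- -308, and 308 is passed as 307.
    1ℤ * X * Y ≢ c * (+ 3 - 1ℤ) * (+ 2 * X + + 2 * Y + 1ℤ)
  no-solution₃ X c 21<X eq = no-factorisation {+ 16 * X - + 14} {+ 48 * X - + 22 - + 256 * c} 307
    (subst (0ℤ <_) (go₀ X) (+-mono-<-≤ (0<* {+ 16} (+<+ (ℕ.s≤s ℕ.z≤n)) 21<X) (+≤+ {0} {14} ℕ.z≤n)))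
    (trans (go X c) (cong (λ t → + 256 * t + + 308) (i≡j⇒i-j≡0 eq)))
    where
    go₀ : ∀ X → + 16 * (X - + 21) + + 14 ≡ + 16 * X - + 14 - + 308
    go₀ = solve-∀
    go : ∀ X c → let Y = + 3 * X + (+ 3 - 1ℤ) * (1ℤ - + 3) in
      (+ 16 * X - + 14) * (+ 48 * X - + 22 - + 256 * c) ≡
      + 256 * (1ℤ * X * Y - c * (+ 3 - 1ℤ) * (+ 2 * X + + 2 * Y + 1ℤ)) + + 308
    go = solve-∀

  no-solution₄ : ∀ X c → 0ℤ < X - + 40 → let Y = + 4 * X + (+ 4 - 1ℤ) * (1ℤ - + 4) in
    -- Here 10 X - 17 is 2 X + 2 Y + 1 itself. Dividing 100 X Y by it leaves -374, and 374 is passed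
    -- as 373.
    1ℤ * X * Y ≢ c * (+ 4 - 1ℤ) * (+ 2 * X + + 2 * Y + 1ℤ)
  no-solution₄ X c 40<X eq = no-factorisation {+ 10 * X - + 17} {+ 40 * X - + 22 - + 300 * c} 373
    (subst (0ℤ <_) (go₀ X) (+-mono-<-≤ (0<* {+ 10} (+<+ (ℕ.s≤s ℕ.z≤n)) 40<X) (+≤+ {0} {9} ℕ.z≤n)))
    (trans (go X c) (cong (λ t → + 100 * t + + 374) (i≡j⇒i-j≡0 eq)))
    where
    go₀ : ∀ X → + 10 * (X - + 40) + + 9 ≡ + 10 * X - + 17 - + 374
    go₀ = solve-∀
    go : ∀ X c → let Y = + 4 * X + (+ 4 - 1ℤ) * (1ℤ - + 4) in
      (+ 10 * X - + 17) * (+ 40 * X - + 22 - + 300 * c) ≡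
      + 100 * (1ℤ * X * Y - c * (+ 4 - 1ℤ) * (+ 2 * X + + 2 * Y + 1ℤ)) + + 374
    go = solve-∀

  -- The first hypothesis of impossible says that θ₂ and θ₃ have equal multiplicities.
  module Irrational (b p c X : ℤ) (3≤b : + 3 ≤ b) (0<c : 0ℤ < c) (0<X : 0ℤ < X)
    (0<a : 0ℤ < X + p - b) where

    -- In the application p = a + b - X, so that Y = (b - 1) a + X. W is the w-coordinate of -b² +
    -- 2, and z / X is the Krein bound for w.
    P Y W z : ℤ
    P = c * (b - 1ℤ)
    Y = b * X + (b - 1ℤ) * (p - b)
    W = b * b - b - + 2
    z = b * (b - 1ℤ) * (X - c)

    0<b : 0ℤ < b
    0<b = <-≤-trans (+<+ (ℕ.s≤s ℕ.z≤n)) 3≤b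

    0<b-1 : 0ℤ < b - 1ℤ
    0<b-1 = i<j⇒0<j-i (<-≤-trans (+<+ (ℕ.s≤s (ℕ.s≤s ℕ.z≤n))) 3≤b)

    0<P : 0ℤ < P
    0<P = 0<* 0<c 0<b-1

    0<Y : 0ℤ < Y
    0<Y = subst (0ℤ <_) (go b p X) (+-mono-< (0<* 0<b-1 0<a) 0<X)
      where
      go : ∀ b p X → (b - 1ℤ) * (X + p - b) + X ≡ b * X + (b - 1ℤ) * (p - b)
      go = solve-∀

    0≤W-4 : 0ℤ ≤ W - + 4
    0≤W-4 = subst (0ℤ ≤_) (go b) (0≤* (i≤j⇒0≤j-i 3≤b) (<⇒≤ (+-mono-< 0<b (+<+ {0} {2} (ℕ.s≤s ℕ.z≤n)))))
      where
      go : ∀ b → (b - + 3) * (b + + 2) ≡ b * b - b - + 2 - + 4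
      go = solve-∀

    impossible : p * X * Y ≡ P * (+ 2 * X + + 2 * Y + p) →
      0ℤ ≤ z * z + p * z * X - P * (X * X) → 0ℤ < P - (W * W + p * W) → 0ℤ ≤ z → ⊥
    impossible multiplicities krein range 0≤z = cases (<-cmp p 1ℤ) (<-cmp (b * p) (p + + 4))
      where
      0<p : 0ℤ < p
      0<p = ≰⇒> λ p≤0 → positivity
        (0≤* (0≤* (i≤j⇒0≤j-i p≤0) (<⇒≤ 0<X)) (<⇒≤ 0<Y))
        (0<* 0<P (+-mono-< (+-mono-< (+-mono-< 0<X (+-mono-< 0<Y 0<Y)) 0<a) 0<b))
        (trans (cong (λ t → (0ℤ - p) * X * Y + t)
            (trans (cong (P *_) (go₀ X Y p b)) (sym multiplicities))) (go₁ p X Y))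
        where
        go₀ : ∀ X Y p b → X + (Y + Y) + (X + p - b) + b ≡ + 2 * X + + 2 * Y + p
        go₀ = solve-∀
        go₁ : ∀ p X Y → (0ℤ - p) * X * Y + p * X * Y ≡ 0ℤ
        go₁ = solve-∀

      1≤p : 0ℤ ≤ p - 1ℤ
      1≤p = i≤j⇒0≤j-i (0<⇒1≤ 0<p)

      0<W : 0ℤ < W
      0<W = subst (0ℤ <_) (go W) (+-mono-≤-< 0≤W-4 (+<+ {0} {4} (ℕ.s≤s ℕ.z≤n)))
        where go : ∀ W → W - + 4 + + 4 ≡ W
              go = solve-∀

      -- The function t² + p t X increases for t ≥ 0. By `krein` its value at z is at least P X²,
      -- which by `range` exceeds its value at W X.
      0<z-WX : 0ℤ < z - W * X
      0<z-WX = ≰⇒> λ z≤WX → positivity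
        (0≤+ krein (0≤+ (0≤* (i≤j⇒0≤j-i z≤WX) (<⇒≤ (+-mono-≤-< 0≤z (0<* 0<W 0<X))))
          (0≤* (0≤* (<⇒≤ 0<p) (<⇒≤ 0<X)) (i≤j⇒0≤j-i z≤WX))))
        (0<* (0<* 0<X 0<X) range)
        (go z p X P W)
        where
        go : ∀ z p X P W →
          z * z + p * z * X - P * (X * X) +
            ((0ℤ - (z - W * X)) * (z + W * X) + p * X * (0ℤ - (z - W * X)))
          + X * X * (P - (W * W + p * W)) ≡ 0ℤ
        go = solve-∀

      -- The same quantity rewritten: b (b - 1) = W + 2 gives z - W X = 2 X - b P.
      0<2X-bP : 0ℤ < + 2 * X - b * P
      0<2X-bP = subst (0ℤ <_) (go b X c) 0<z-WX
        where
        go : ∀ b X c → b * (b - 1ℤ) * (X - c) - (b * b - b - + 2) * X ≡ + 2 * X - b * (c * (b - 1ℤ))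
        go = solve-∀

      -- X > b P / 2 with P > W² + p W.
      0<X-bound : ∀ {t} → 0ℤ ≤ b * (W * W + W) - + 2 * t → 0ℤ < X - t
      0<X-bound {t} 0≤ = *-cancel-pos-< {+ 2} (+<+ (ℕ.s≤s ℕ.z≤n)) (subst (0ℤ <_) (go b p P W X t)
        (+-mono-<-≤ (+-mono-< 0<2X-bP (0<* 0<b range))
          (0≤+ (0≤* (<⇒≤ 0<b) (0≤* 1≤p (<⇒≤ 0<W))) 0≤)))
        where
        go : ∀ b p P W X t → + 2 * X - b * P + b * (P - (W * W + p * W)) +
          (b * ((p - 1ℤ) * W) + (b * (W * W + W) - + 2 * t)) ≡ + 2 * (X - t)
        go = solve-∀

      0<X-[W+4] : 0ℤ < X - (W + + 4)
      0<X-[W+4] = 0<X-bound (subst (0ℤ ≤_) (go b W)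
        (0≤+ (0≤* (i≤j⇒0≤j-i 3≤b) (0≤+ (0≤sq W) (<⇒≤ 0<W)))
          (0≤horner (44 ∷ 25 ∷ 3 ∷ []) 0≤W-4)))
        where
        go : ∀ b W → (b - + 3) * (W * W + W) +
          (+ 44 + (W - + 4) * (+ 25 + (W - + 4) * (+ 3 + (W - + 4) * 0ℤ))) ≡
          b * (W * W + W) - + 2 * (W + + 4)
        go = solve-∀

      -- Multiplying 2 X > b P by 2 X + 2 Y + p and inserting `multiplicities` gives b p Y < 4 X + 4
      -- Y + 2 p. With b p ≥ p + 4 and X > W + 4 this fails.
      large : p + + 4 ≤ b * p → ⊥
      large p+4≤bp = positivity
        (0≤+ (0≤* 0≤bp-4-p (<⇒≤ 0<Y)) (0≤+ (0≤* 0≤bp-4-p (<⇒≤ 0<X))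
          (0≤+ (0≤* (<⇒≤ 0<p) (<⇒≤ 0<X-[W+4])) (0≤* (<⇒≤ 0<b-1) (0≤sq p)))))
        slack (go b p X)
        where
        0≤bp-4-p : 0ℤ ≤ b * p - (p + + 4)
        0≤bp-4-p = i≤j⇒0≤j-i p+4≤bp
        slack : 0ℤ < + 4 * X + + 4 * Y + + 2 * p - b * p * Y
        slack = *-cancel-pos-< 0<X (subst (0ℤ <_)
          (trans (go₀ b P X Y p)
            (trans (cong (λ t → + 2 * X * (+ 2 * X + + 2 * Y + p) - b * t) (sym multiplicities)) (go₁ b p X Y)))
          (0<* 0<2X-bP (+-mono-< (+-mono-< (0<* {+ 2} (+<+ (ℕ.s≤s ℕ.z≤n)) 0<X) (0<* {+ 2} (+<+ (ℕ.s≤s ℕ.z≤n)) 0<Y)) 0<p)))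
          where
          go₀ : ∀ b P X Y p → (+ 2 * X - b * P) * (+ 2 * X + + 2 * Y + p) ≡
            + 2 * X * (+ 2 * X + + 2 * Y + p) - b * (P * (+ 2 * X + + 2 * Y + p))
          go₀ = solve-∀
          go₁ : ∀ b p X Y → + 2 * X * (+ 2 * X + + 2 * Y + p) - b * (p * X * Y) ≡
            X * (+ 4 * X + + 4 * Y + + 2 * p - b * p * Y)
          go₁ = solve-∀
        go : ∀ b p X →
          (b * p - (p + + 4)) * (b * X + (b - 1ℤ) * (p - b)) + ((b * p - (p + + 4)) * X
            + (p * (X - (b * b - b - + 2 + + 4)) + (b - 1ℤ) * (p * p)))
          + (+ 4 * X + + 4 * (b * X + (b - 1ℤ) * (p - b)) + + 2 * p - b * p * (b * X + (b - 1ℤ) * (p - b)))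
          ≡ 0ℤ
        go = solve-∀

      three : p ≡ 1ℤ → b ≡ + 3 → ⊥
      three p≡1 b≡3 = no-solution₃ X c
        (0<X-bound (subst (λ b → 0ℤ ≤ b * ((b * b - b - + 2) * (b * b - b - + 2) + (b * b - b - + 2)) - + 2 * + 21)
          (sym b≡3) (+≤+ ℕ.z≤n)))
        (subst₂ (λ p b → p * X * (b * X + (b - 1ℤ) * (p - b)) ≡
            c * (b - 1ℤ) * (+ 2 * X + + 2 * (b * X + (b - 1ℤ) * (p - b)) + p)) p≡1 b≡3 multiplicities)

      four : p ≡ 1ℤ → b ≡ + 4 → ⊥
      four p≡1 b≡4 = no-solution₄ X c
        (0<X-bound (subst (λ b → 0ℤ ≤ b * ((b * b - b - + 2) * (b * b - b - + 2) + (b * b - b - + 2)) - + 2 * + 40)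
          (sym b≡4) (+≤+ ℕ.z≤n)))
        (subst₂ (λ p b → p * X * (b * X + (b - 1ℤ) * (p - b)) ≡
            c * (b - 1ℤ) * (+ 2 * X + + 2 * (b * X + (b - 1ℤ) * (p - b)) + p)) p≡1 b≡4 multiplicities)

      -- What escapes `large` has (b - 1) p < 4; with b ≥ 3 and p ≥ 1 this leaves p = 1 and b = 3 or
      -- 4.
      cases : Tri (p < 1ℤ) (p ≡ 1ℤ) (p > 1ℤ) →
        Tri (b * p < p + + 4) (b * p ≡ p + + 4) (b * p > p + + 4) → ⊥
      cases _ (tri≈ _ bp≡ _) = large (≤-reflexive (sym bp≡))
      cases _ (tri> _ _ >bp) = large (<⇒≤ >bp)
      cases (tri< p<1 _ _) (tri< _ _ _) = <⇒≱ p<1 (0<⇒1≤ 0<p)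
      cases (tri> _ _ 1<p) (tri< bp< _ _) = positivity
        (0≤+ (0≤* (i≤j⇒0≤j-i 3≤b) (<⇒≤ 0<p)) (0≤* {+ 2} (+≤+ ℕ.z≤n) (i≤j⇒0≤j-i (i<j⇒suc[i]≤j 1<p))))
        (i<j⇒0<j-i bp<) (go b p)
        where
        go : ∀ b p → (b - + 3) * p + + 2 * (p - + 2) + (p + + 4 - b * p) ≡ 0ℤ
        go = solve-∀
      cases (tri≈ _ p≡1 _) (tri< bp< _ _) with <-cmp b (+ 4)
      ... | tri< b<4 _ _ = three p≡1 (≤-antisym (i<j⇒i≤pred[j] b<4) 3≤b)
      ... | tri≈ _ b≡4 _ = four p≡1 b≡4
      ... | tri> _ _ 4<b = positivity (i≤j⇒0≤j-i (i<j⇒suc[i]≤j 4<b))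
        (i<j⇒0<j-i (subst (λ t → b * t < t + + 4) p≡1 bp<)) (go b)
        where
        go : ∀ b → b - + 5 + (1ℤ + + 4 - b * 1ℤ) ≡ 0ℤ
        go = solve-∀

  -- The eigenvalue θ₃ = -(w + b) lies strictly between -b² and -b² + 2.
  root-in-range : ∀ b p c w → 0ℤ < b → 0ℤ < b - 1ℤ → 0ℤ < c → ∀ {X} → 0ℤ < X →
    0ℤ ≤ b * b - b - + 2 → 0ℤ < w → 0ℤ < w + p → w * (w + p) ≡ c * (b - 1ℤ) →
    0ℤ ≤ b * (b - 1ℤ) * (X - c) - w * X →
    0ℤ < c * (b - 1ℤ) - ((b * b - b - + 2) * (b * b - b - + 2) + p * (b * b - b - + 2)) →
    w ≡ b * b - b - 1ℤ
  root-in-range b p c w 0<b 0<b-1 0<c {X} 0<X 0≤W 0<w 0<w+p root krein range = ≤-antisym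
    (subst (w ≤_) (go₀ b) (i<j⇒i≤pred[j] w<W+2)) (subst (_≤ w) (go₁ b) (i<j⇒suc[i]≤j W<w))
    where
    W : ℤ
    W = b * b - b - + 2
    go₀ : ∀ b → -1ℤ + b * (b - 1ℤ) ≡ b * b - b - 1ℤ
    go₀ = solve-∀
    go₁ : ∀ b → 1ℤ + (b * b - b - + 2) ≡ b * b - b - 1ℤ
    go₁ = solve-∀
    W<w : W < w
    W<w = ≰⇒> λ w≤W → positivity
      (0≤* (i≤j⇒0≤j-i w≤W) (0≤+ 0≤W (<⇒≤ 0<w+p))) range
      (trans (cong (λ t → (W - w) * (W + (w + p)) + (t - (W * W + p * W))) (sym root)) (go w p W))
      where
      go : ∀ w p W → (W - w) * (W + (w + p)) + (w * (w + p) - (W * W + p * W)) ≡ 0ℤ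
      go = solve-∀
    w<W+2 : w < b * (b - 1ℤ)
    w<W+2 = ≰⇒> λ W+2≤w → positivity
      (0≤+ krein (0≤* (i≤j⇒0≤j-i W+2≤w) (<⇒≤ 0<X))) (0<* (0<* 0<b 0<b-1) 0<c) (go (b * (b - 1ℤ)) c w X)
      where
      go : ∀ t c w X → t * (X - c) - w * X + (w - t) * X + t * c ≡ 0ℤ
      go = solve-∀

  -- The case θ₃ = -b² + 1: the Krein condition makes a large compared with c₂ = c, contrary
  -- to the local inequality.
  module Rational (a b c y : ℤ) (3≤b : + 3 ≤ b) (0<c : 0ℤ < c)
    (root : (b * b - b - 1ℤ) * y ≡ c * (b - 1ℤ)) where

    w t d : ℤ
    w = b * b - b - 1ℤ
    t = b * y - c
    d = a - b

    0≤b-3 : 0ℤ ≤ b - + 3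
    0≤b-3 = i≤j⇒0≤j-i 3≤b

    0<b : 0ℤ < b
    0<b = <-≤-trans (+<+ (ℕ.s≤s ℕ.z≤n)) 3≤b

    0<b-1 : 0ℤ < b - 1ℤ
    0<b-1 = i<j⇒0<j-i (<-≤-trans (+<+ (ℕ.s≤s (ℕ.s≤s ℕ.z≤n))) 3≤b)

    0<w : 0ℤ < w
    0<w = subst (0ℤ <_) (go b) (+-mono-<-≤ (+<+ {0} {5} (ℕ.s≤s ℕ.z≤n)) (0≤horner (0 ∷ 5 ∷ 1 ∷ []) 0≤b-3))
      where
      go : ∀ b → + 5 + (0ℤ + (b - + 3) * (+ 5 + (b - + 3) * (1ℤ + (b - + 3) * 0ℤ))) ≡ b * b - b - 1ℤ
      go = solve-∀

    -- Because b (b - 1) - w = 1, the relation w y = c (b - 1) is parametrised by t = b y - c, with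
    -- c = w t and y = t (b - 1).
    c≡wt : c ≡ w * t
    c≡wt = sym (begin
      w * (b * y - c)                ≡⟨ go₀ w b y c ⟩
      b * (w * y) - w * c            ≡⟨ cong (λ s → b * s - w * c) root ⟩
      b * (c * (b - 1ℤ)) - w * c     ≡⟨ go₁ b c ⟩
      c                              ∎)
      where
      open ≡-Reasoning
      go₀ : ∀ w b y c → w * (b * y - c) ≡ b * (w * y) - w * c
      go₀ = solve-∀
      go₁ : ∀ b c → b * (c * (b - 1ℤ)) - (b * b - b - 1ℤ) * c ≡ c
      go₁ = solve-∀

    0≤t-1 : 0ℤ ≤ t - 1ℤ
    0≤t-1 = i≤j⇒0≤j-i (0<⇒1≤ (*-cancel-pos-< 0<w (subst (0ℤ <_) c≡wt 0<c)))

    y≡ : y ≡ t * (b - 1ℤ)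
    y≡ = *-cancel-pos-≡ 0<w (trans root (trans (cong (_* (b - 1ℤ)) c≡wt) (*-assoc w t (b - 1ℤ))))

    module _ (krein : 0ℤ ≤ b * (b - 1ℤ) * (a + b + w - y - c) - w * (a + b + w - y)) where

      -- Here a + b + w - y is β + c, and b (b - 1) = w + 1 turns the Krein condition into a + b + w
      -- - y ≥ (w + 1) c. The rest is y = t (b - 1) ≥ b - 1.
      0≤a-[c-1][w+1] : 0ℤ ≤ a - (c - 1ℤ) * (w + 1ℤ)
      0≤a-[c-1][w+1] = subst (0ℤ ≤_)
        (trans (cong (λ s → b * (b - 1ℤ) * (a + b + w - y - c) - w * (a + b + w - y) + s) 
            (trans (go₀ t b) (cong (_- (b - 1ℤ)) (sym y≡))))
          (go₁ a b c y))
        (0≤+ krein (0≤* 0≤t-1 (<⇒≤ 0<b-1)))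
        where
        go₀ : ∀ t b → (t - 1ℤ) * (b - 1ℤ) ≡ t * (b - 1ℤ) - (b - 1ℤ)
        go₀ = solve-∀
        go₁ : ∀ a b c y → b * (b - 1ℤ) * (a + b + (b * b - b - 1ℤ) - y - c) - (b * b - b - 1ℤ) * (a + b + (b * b - b - 1ℤ) - y)
          + (y - (b - 1ℤ)) ≡ a - (c - 1ℤ) * (b * b - b - 1ℤ + 1ℤ)
        go₁ = solve-∀

      -- c = w t ≥ w gives a ≥ (w - 1) (w + 1), which exceeds b² + b for b ≥ 3; the list holds the
      -- coefficients of the difference in powers of b - 3.
      0≤d-b² : 0ℤ ≤ d - b * b
      0≤d-b² = subst (0ℤ ≤_)
        (trans (cong (λ s → a - (c - 1ℤ) * (w + 1ℤ) + ((s - w) * (w + 1ℤ) + horner (12 ∷ 43 ∷ 34 ∷ 10 ∷ 1 ∷ []) (b - + 3)))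
            (sym c≡wt))
          (go₁ a b c))
        (0≤+ 0≤a-[c-1][w+1] (0≤+
          (0≤* (subst (0ℤ ≤_) (go₂ w t) (0≤* (<⇒≤ 0<w) 0≤t-1)) (0≤+ (<⇒≤ 0<w) (+≤+ {0} {1} ℕ.z≤n)))
          (0≤horner (12 ∷ 43 ∷ 34 ∷ 10 ∷ 1 ∷ []) 0≤b-3)))
        where
        go₂ : ∀ w t → w * (t - 1ℤ) ≡ w * t - w
        go₂ = solve-∀
        go₁ : ∀ a b c → a - (c - 1ℤ) * (b * b - b - 1ℤ + 1ℤ) + ((c - (b * b - b - 1ℤ)) * (b * b - b - 1ℤ + 1ℤ) +
            (+ 12 + (b - + 3) * (+ 43 + (b - + 3) * (+ 34 + (b - + 3) * (+ 10 + (b - + 3) * (1ℤ + (b - + 3) * 0ℤ))))))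
          ≡ a - b - b * b
        go₁ = solve-∀

      0<d : 0ℤ < d
      0<d = subst (0ℤ <_) (go d (b * b)) (+-mono-≤-< 0≤d-b² (0<* 0<b 0<b))
        where
        go : ∀ d s → d - s + s ≡ d
        go = solve-∀

      1<g : 1ℤ < b * b - 1ℤ
      1<g = 0<-difference (subst (0ℤ <_) (go b) (+-mono-< 0<w 0<b-1))
        where
        go : ∀ b → b * b - b - 1ℤ + (b - 1ℤ) ≡ b * b - 1ℤ - 1ℤ
        go = solve-∀

      g<ab : b * b - 1ℤ < a * b
      g<ab = 0<-difference (subst (0ℤ <_) (go a b) (+-mono-<-≤ (0<* 0<b 0<d) (+≤+ {0} {1} ℕ.z≤n)))
        where
        go : ∀ a b → b * (a - b) + 1ℤ ≡ a * b - (b * b - 1ℤ)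
        go = solve-∀

      -- Multiplying the local inequality by w + 1 and bounding (w + 1) (c - 1) by a eliminates c
      -- and leaves a polynomial inequality in a and b.
      impossible : let g = b * b - 1ℤ in
        (a - b) * ((a - b + 1ℤ) * g - a * b) ≤ (c - 1ℤ) * (g - 1ℤ) * (a * b - g) → ⊥
      impossible local = positivity
        (0≤+ (0≤* 0≤a-[c-1][w+1] (0≤* (<⇒≤ (i<j⇒0<j-i 1<g)) (<⇒≤ (i<j⇒0<j-i g<ab))))
          (0≤* (0≤+ (<⇒≤ 0<w) (+≤+ {0} {1} ℕ.z≤n)) (i≤j⇒0≤j-i local)))
        0<E (go a b c)
        where
        -- For g = b² - 1 one has (d + 1) g - a b = d w - 1 and a b - g = b d + 1. The expansion in
        -- b - 3 ≥ 0 and d - b² ≥ 0 has nonnegative coefficients and constant term 24.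
        0<E : 0ℤ < b * (b - 1ℤ) * d * (d * w - 1ℤ) - a * (b * b - + 2) * (b * d + 1ℤ)
        0<E = subst (0ℤ <_) (expanded a b) (+-mono-<-≤ (+<+ {0} {24} (ℕ.s≤s ℕ.z≤n))
          (0≤+ (0≤horner (0 ∷ 1958 ∷ 4700 ∷ 4833 ∷ 2745 ∷ 930 ∷ 188 ∷ 21 ∷ 1 ∷ []) 0≤b-3)
            (0≤* 0≤d-b² (0≤+ (0≤horner (86 ∷ 541 ∷ 810 ∷ 534 ∷ 179 ∷ 30 ∷ 2 ∷ []) 0≤b-3)
              (0≤* 0≤d-b² (0≤horner (9 ∷ 30 ∷ 27 ∷ 9 ∷ 1 ∷ []) 0≤b-3))))))
          where
          expanded : ∀ a b → let h = b - + 3 in let δ = a - b - b * b in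
            + 24 + ((0ℤ + h * (+ 1958 + h * (+ 4700 + h * (+ 4833 + h * (+ 2745 + h * (+ 930 + h * (+ 188 + h * (+ 21 + h * (1ℤ + h * 0ℤ)))))))))
              + δ * ((+ 86 + h * (+ 541 + h * (+ 810 + h * (+ 534 + h * (+ 179 + h * (+ 30 + h * (+ 2 + h * 0ℤ)))))))
                + δ * (+ 9 + h * (+ 30 + h * (+ 27 + h * (+ 9 + h * (1ℤ + h * 0ℤ)))))))
            ≡ b * (b - 1ℤ) * (a - b) * ((a - b) * (b * b - b - 1ℤ) - 1ℤ) - a * (b * b - + 2) * (b * (a - b) + 1ℤ)
          expanded = solve-∀
        go : ∀ a b c → let g = b * b - 1ℤ in
          (a - (c - 1ℤ) * (b * b - b - 1ℤ + 1ℤ)) * ((g - 1ℤ) * (a * b - g))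
          + (b * b - b - 1ℤ + 1ℤ) * ((c - 1ℤ) * (g - 1ℤ) * (a * b - g) - (a - b) * ((a - b + 1ℤ) * g - a * b))
          + (b * (b - 1ℤ) * (a - b) * ((a - b) * (b * b - b - 1ℤ) - 1ℤ) - a * (b * b - + 2) * (b * (a - b) + 1ℤ))
          ≡ 0ℤ
        go = solve-∀

  -- q τ ≥ 0 for the quadratic q x = x² - s x + r and τ = -b² + 2; that is, θ₃ ≥ τ.
  module Bound {n : ℕ} {d : Fin n → Fin n → Fin 4} {a b β c : ℤ}
    (scheme : IsScheme d (shillaMatrix a b β c)) (o v : Fin n) (o~v : d o v ≡ 1F)
    (0<a : 0ℤ < a) (3≤b : + 3 ≤ b) (0<β : 0ℤ < β) (0<c : 0ℤ < c) where

    1<b : 1ℤ < b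
    1<b = <-≤-trans (+<+ (ℕ.s≤s (ℕ.s≤s ℕ.z≤n))) 3≤b

    open Conditions scheme o 0<a 1<b 0<β 0<c

    p P W τ : ℤ
    p = a + b - X
    P = c * (b - 1ℤ)
    W = b * b - b - + 2
    τ = - (b * b) + + 2

    0<X : 0ℤ < X
    0<X = +-mono-< 0<β 0<c

    0<P : 0ℤ < P
    0<P = 0<* 0<c 0<b-1

    0<W : 0ℤ < W
    0<W = subst (0ℤ <_) (go b) (+-mono-<-≤ (+<+ {0} {4} (ℕ.s≤s ℕ.z≤n)) (0≤horner (0 ∷ 5 ∷ 1 ∷ []) (i≤j⇒0≤j-i 3≤b)))
      where
      go : ∀ b → + 4 + (0ℤ + (b - + 3) * (+ 5 + (b - + 3) * (1ℤ + (b - + 3) * 0ℤ))) ≡ b * b - b - + 2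
      go = solve-∀

    0≤W : 0ℤ ≤ W
    0≤W = <⇒≤ 0<W

    discriminant : p * p + + 4 * P ≡ D
    discriminant = go a b β c
      where
      go : ∀ a b β c → let p = a + b - (β + c) in let s = a - b - (β + c) in
        p * p + + 4 * (c * (b - 1ℤ)) ≡ s * s - + 4 * (b * β + c - a * b)
      go = solve-∀

    range : τ * τ - s * τ + r < 0ℤ → 0ℤ < P - (W * W + p * W)
    range q<0 = subst (0ℤ <_) (go a b β c) (i<j⇒0<j-i q<0)
      where
      go : ∀ a b β c → let τ = - (b * b) + + 2 in let W = b * b - b - + 2 in
        0ℤ - (τ * τ - (a - b - (β + c)) * τ + (b * β + c - a * b)) ≡
        c * (b - 1ℤ) - (W * W + (a + b - (β + c)) * W)
      go = solve-∀

    rational : ∀ {e} → 0ℤ ≤ e → D ≡ e * e → 0ℤ < P - (W * W + p * W) → ⊥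
    rational {e} 0≤e D≡e² q<0 = from-root (integral-root p P e 0≤e (trans discriminant D≡e²) 0<P)
      where
      from-root : (∃ λ w → 0ℤ < w × 0ℤ < w + p × w * (w + p) ≡ P) → ⊥
      from-root (w , 0<w , 0<w+p , root) = R.impossible krein′ local
        where
        krein-w : 0ℤ ≤ b * (b - 1ℤ) * (X - c) - w * X
        krein-w = subst (0ℤ ≤_) (go₁ b β c w) (krein-root (- (w + b)) -g-root)
          where
          go₁ : ∀ b β c w → (β + c) * (- (w + b)) + b * (b * β + c) ≡ b * (b - 1ℤ) * (β + c - c) - w * (β + c)
          go₁ = solve-∀
          -g-root : - (w + b) * - (w + b) ≡ s * - (w + b) - r
          -g-root = i-j≡0⇒i≡j _ _ (trans (go a b β c w) (i≡j⇒i-j≡0 root))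
            where
            go : ∀ a b β c w → - (w + b) * - (w + b) - ((a - b - (β + c)) * - (w + b) - (b * β + c - a * b)) ≡
              w * (w + (a + b - (β + c))) - c * (b - 1ℤ)
            go = solve-∀

        w≡ : w ≡ b * b - b - 1ℤ
        w≡ = root-in-range b p c w 0<b 0<b-1 0<c 0<X 0≤W 0<w 0<w+p root krein-w q<0

        module R = Rational a b c (w + p) 3≤b 0<c (trans (cong (_* (w + p)) (sym w≡)) root)

        krein′ : 0ℤ ≤ b * (b - 1ℤ) * (a + b + (b * b - b - 1ℤ) - (w + p) - c)
          - (b * b - b - 1ℤ) * (a + b + (b * b - b - 1ℤ) - (w + p))
        krein′ = subst (λ v → 0ℤ ≤ b * (b - 1ℤ) * (a + b + v - (w + p) - c) - v * (a + b + v - (w + p))) w≡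
          (subst (λ x → 0ℤ ≤ b * (b - 1ℤ) * (x - c) - w * x) (go a b w X) krein-w)
          where
          go : ∀ a b w X → X ≡ a + b + w - (w + (a + b - X))
          go = solve-∀

        g-root : (b * b - 1ℤ) * (b * b - 1ℤ) ≡ - (s * (b * b - 1ℤ)) - r
        g-root = i-j≡0⇒i≡j _ _ (trans (go a b β c)
          (i≡j⇒i-j≡0 (subst (λ v → v * (v + p) ≡ P) w≡ root)))
          where
          go : ∀ a b β c → let g = b * b - 1ℤ in let w = b * b - b - 1ℤ in
            g * g - (- ((a - b - (β + c)) * g) - (b * β + c - a * b)) ≡
            w * (w + (a + b - (β + c))) - c * (b - 1ℤ)
          go = solve-∀

        local : let g = b * b - 1ℤ in
          (a - b) * ((a - b + 1ℤ) * g - a * b) ≤ (c - 1ℤ) * (g - 1ℤ) * (a * b - g)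
        local = Root.Edge.local-inequality (b * b - 1ℤ) g-root o v o~v (R.1<g krein′) (R.g<ab krein′)

    irrational : Nonsquare D → 0ℤ < P - (W * W + p * W) → ⊥
    irrational ns q<0 = Irrational.impossible b p c X 3≤b 0<c 0<X (subst (0ℤ <_) (go₀ a b X) 0<a)
      multiplicities krein-z q<0 (<⇒≤ (0<* (0<* 0<b 0<b-1) (subst (0ℤ <_) (go₁ β c) 0<β)))
      where
      go₀ : ∀ a b X → a ≡ X + (a + b - X) - b
      go₀ = solve-∀
      go₁ : ∀ β c → β ≡ β + c - c
      go₁ = solve-∀
      multiplicities : p * X * (b * X + (b - 1ℤ) * (p - b)) ≡
        P * (+ 2 * X + + 2 * (b * X + (b - 1ℤ) * (p - b)) + p)
      multiplicities = i-j≡0⇒i≡j _ _ (trans (go a b β c) (equal-multiplicities ns))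
        where
        go : ∀ a b β c → let X = β + c in let p = a + b - X in let Y = b * X + (b - 1ℤ) * (p - b) in
          p * X * Y - c * (b - 1ℤ) * (+ 2 * X + + 2 * Y + p) ≡
          (a - b - X) * (X * ((b - 1ℤ) * a + X) + c * (b - 1ℤ)) + + 2 * (X * (b * β + c) + a * b * β * (b - 1ℤ))
        go = solve-∀
      z : ℤ
      z = b * (b - 1ℤ) * (X - c)
      -- The norm of X θ + b e is (z - w X) (z - w′ X), where w and w′ are the roots of w² + p w -
      -- P.
      krein-z : 0ℤ ≤ z * z + p * z * X - P * (X * X)
      krein-z = subst (0ℤ ≤_) (go a b β c) (krein-norm ns)
        where
        go : ∀ a b β c → let X = β + c in let e = b * β + c in let z = b * (b - 1ℤ) * (X - c) in
          X * X * (b * β + c - a * b) + X * (a - b - X) * (b * e) + b * e * (b * e) ≡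
          z * z + (a + b - X) * z * X - c * (b - 1ℤ) * (X * X)
        go = solve-∀

    quadratic-nonneg : 0ℤ ≤ τ * τ - s * τ + r
    quadratic-nonneg = ≮⇒≥ λ q<0 → decide (square? D) (range q<0)
      where
      decide : (∃ λ e → 0ℤ ≤ e × D ≡ e * e) ⊎ Nonsquare D → 0ℤ < P - (W * W + p * W) → ⊥
      decide (inj₁ (e , 0≤e , D≡e²)) = rational 0≤e D≡e²
      decide (inj₂ ns)               = irrational ns

    -- (τ + b) (τ - b - s) = q τ - q (-b) > 0, and s - 2 τ = s + b - τ + (-b - τ).
    slope : 1ℤ ≤ s - (τ + τ)
    slope = ≤-trans (0<⇒1≤ (*-cancel-pos-< 0<W (subst (0ℤ <_)
        (trans (cong (λ t → τ * τ - s * τ + r - t) (sym quadratic-at-b)) (go₀ b s r))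
        (subst (0ℤ <_) (cong (λ t → τ * τ - s * τ + r + t) (sym (neg-involutive P)))
          (+-mono-≤-< quadratic-nonneg 0<P)))))
      (≤-by W 0≤W (go₁ b s))
      where
      go₀ : ∀ b s r → let τ = - (b * b) + + 2 in
        τ * τ - s * τ + r - (- b * - b - s * - b + r) ≡ (b * b - b - + 2) * (s + b - τ)
      go₀ = solve-∀
      go₁ : ∀ b s → let τ = - (b * b) + + 2 in s - (τ + τ) ≡ s + b - τ + (b * b - b - + 2)
      go₁ = solve-∀

  -- Intersection numbers of the graph

  ∣∣-sum : ∀ {n} (S : Subset n) {g : Vector ℤ n} →
    (∀ z → z Subset.∈ S → g z ≡ 1ℤ) → (∀ z → z ∉ S → g z ≡ 0ℤ) → sum g ≡ + Subset.∣ S ∣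
  ∣∣-sum []            _  _  = refl
  ∣∣-sum (inside  ∷ S) g₁ g₀ = cong₂ _+_ (g₁ zero Vec.here)
    (∣∣-sum S (λ z z∈S → g₁ (suc z) (Vec.there z∈S)) (λ z z∉S → g₀ (suc z) (z∉S ∘ drop-there)))
  ∣∣-sum (outside ∷ S) g₁ g₀ = trans (cong₂ _+_ (g₀ zero λ ())
    (∣∣-sum S (λ z z∈S → g₁ (suc z) (Vec.there z∈S)) (λ z z∉S → g₀ (suc z) (z∉S ∘ drop-there))))
    (+-identityˡ _)

  cardinality-sum : ∀ {n} {Q : Fin n → Set} {m} → HasCardinality Q m → {g : Vector ℤ n} →
    (∀ z → Q z → g z ≡ 1ℤ) → (∀ z → ¬ Q z → g z ≡ 0ℤ) → sum g ≡ + m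
  cardinality-sum (S , S⇔Q , ∣S∣≡m) g₁ g₀ = trans
    (∣∣-sum S (λ z z∈S → g₁ z (Equivalence.to (S⇔Q z) z∈S)) (λ z z∉S → g₀ z (z∉S ∘ Equivalence.from (S⇔Q z))))
    (cong +_ ∣S∣≡m)

  module Metric {n : ℕ} (Γ : Graph n) (connected : Graph.Connected Γ)
    (diameter : ∀ x y i → Graph.Distance Γ x y i → i ℕ.≤ 3) where

    open Graph Γ

    walk? : ∀ l x y → Dec (Walk l x y)
    walk? ℕ.zero  x y = map′ (λ { refl → [] }) (λ { [] → refl }) (x Fin.≟ y)
    walk? (suc l) x y = map′ (λ (_ , e , w) → e ∷ w) (λ { (e ∷ w) → _ , e , w })
      (Fin.any? λ z → (x ~? z) ×-dec walk? l z y)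

    -- Connectedness bounds the search: some walk exists, and testing the lengths up to its own in
    -- increasing order finds the least one.
    distance : ∀ x y → ∃ (Distance x y)
    distance x y = found (search (suc (proj₁ (connected x y))))
      where
      search : ∀ m → ∃ (Distance x y) ⊎ (∀ j → j ℕ.< m → ¬ Walk j x y)
      search ℕ.zero = inj₂ λ _ ()
      search (suc m) = extend (search m) (walk? m x y)
        where
        extend : ∃ (Distance x y) ⊎ (∀ j → j ℕ.< m → ¬ Walk j x y) → Dec (Walk m x y) →
          ∃ (Distance x y) ⊎ (∀ j → j ℕ.< suc m → ¬ Walk j x y)
        extend (inj₁ i)    _       = inj₁ i
        extend (inj₂ none) (yes w) = inj₁ (m , w , λ j v → ℕ.≮⇒≥ λ j<m → none j j<m v)
        extend (inj₂ none) (no ¬w) = inj₂ λ j j<1+m v → cases j v (ℕ.m≤n⇒m<n∨m≡n (ℕ.s≤s⁻¹ j<1+m))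
          where
          cases : ∀ j → Walk j x y → j ℕ.< m ⊎ j ≡ m → ⊥
          cases j v (inj₁ j<m)  = none j j<m v
          cases j v (inj₂ refl) = ¬w v
      found : ∃ (Distance x y) ⊎ (∀ j → j ℕ.< suc (proj₁ (connected x y)) → ¬ Walk j x y) → ∃ (Distance x y)
      found (inj₁ i)    = i
      found (inj₂ none) = contradiction (proj₂ (connected x y)) (none _ (ℕ.n<1+n _))

    d : Fin n → Fin n → Fin 4
    d x y = fromℕ< (ℕ.s≤s (diameter x y _ (proj₂ (distance x y))))

    d-distance : ∀ x y → Distance x y (toℕ (d x y))
    d-distance x y = subst (Distance x y) (sym (Fin.toℕ-fromℕ< _)) (proj₂ (distance x y))

    distance-unique : ∀ {x y i j} → Distance x y i → Distance x y j → i ≡ j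
    distance-unique (v , v-min) (w , w-min) = ℕ.≤-antisym (v-min _ w) (w-min _ v)

    d-unique : ∀ {x y l} → Distance x y (toℕ l) → d x y ≡ l
    d-unique dist = Fin.toℕ-injective (distance-unique (d-distance _ _) dist)

    snoc : ∀ {l x y z} → Walk l x y → y ~ z → Walk (suc l) x z
    snoc []       y~z = y~z ∷ []
    snoc (e ∷ w) y~z = e ∷ snoc w y~z

    reverse : ∀ {l x y} → Walk l x y → Walk l y x
    reverse []       = []
    reverse (e ∷ w) = snoc (reverse w) (~-sym e)

    distance-sym : ∀ {x y i} → Distance x y i → Distance y x i
    distance-sym (w , minimal) = reverse w , λ j v → minimal j (reverse v)

    d-sym : ∀ x y → d x y ≡ d y x
    d-sym x y = d-unique (distance-sym (d-distance y x))

    distance-refl : ∀ x → Distance x x 0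
    distance-refl x = [] , λ _ _ → ℕ.z≤n

    d-refl : ∀ x → d x x ≡ 0F
    d-refl x = d-unique (distance-refl x)

    d≡⇒distance : ∀ {x y l} → d x y ≡ l → Distance x y (toℕ l)
    d≡⇒distance {x} {y} refl = d-distance x y

    d-zero : ∀ x y → d x y ≡ 0F → x ≡ y
    d-zero x y d≡0 with d≡⇒distance d≡0
    ... | [] , _ = refl

    d≡1⇒~ : ∀ {x y} → d x y ≡ 1F → x ~ y
    d≡1⇒~ d≡1 with d≡⇒distance d≡1
    ... | e ∷ [] , _ = e

    ~⇒d≡1 : ∀ {x y} → x ~ y → d x y ≡ 1F
    ~⇒d≡1 {x} {y} x~y = d-unique (x~y ∷ [] , minimal)
      where
      minimal : ∀ j → Walk j x y → 1 ℕ.≤ j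
      minimal _ []      = contradiction x~y (~-irrefl refl)
      minimal _ (_ ∷ _) = ℕ.s≤s ℕ.z≤n

    triangle : ∀ {x z} y → x ~ z → toℕ (d z y) ℕ.≤ suc (toℕ (d x y))
    triangle {x} {z} y x~z = proj₂ (d-distance z y) _ (~-sym x~z ∷ proj₁ (d-distance x y))

  module Intersection {n : ℕ} {Γ : Graph n} (regular : IsDistanceRegular Γ 3) where

    open Graph Γ public
    open IsDistanceRegular regular public
    open Metric Γ connected (proj₁ diameter) public

    -- The roles of the vertices are exchanged with respect to `b-count` and `c-count`: z runs over
    -- the neighbours of x and is measured from y. Symmetry of the distance relates the two.
    N : Fin n → Fin n → Fin 4 → ℤ
    N x y j = ∑[ z < n ] (δ₁ (d x z) * unit j (d z y))

    term-1 : ∀ {x y z} j → x ~ z → d z y ≡ j → δ₁ (d x z) * unit j (d z y) ≡ 1ℤ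
    term-1 j x~z dzy≡j = trans (cong₂ (λ l m → δ₁ l * unit j m) (~⇒d≡1 x~z) dzy≡j)
      (trans (*-identityˡ (unit j j)) (unit-diagonal j))

    term-0 : ∀ {x y z} j → ¬ (x ~ z × d z y ≡ j) → δ₁ (d x z) * unit j (d z y) ≡ 0ℤ
    term-0 {x} {y} {z} j ¬both with unit-cases 1F (d x z) | unit-cases j (d z y)
    ... | inj₂ p           | _                = cong (_* unit j (d z y)) p
    ... | inj₁ _           | inj₂ q           = trans (cong (δ₁ (d x z) *_) q) (*-zeroʳ (δ₁ (d x z)))
    ... | inj₁ (dxz≡1 , _) | inj₁ (dzy≡j , _) = contradiction (d≡1⇒~ dxz≡1 , dzy≡j) ¬both

    N-b : ∀ {x y} i j → toℕ j ≡ suc (toℕ i) → d x y ≡ i → N x y j ≡ + b i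
    N-b {x} {y} i j j≡1+i dxy≡i = cardinality-sum (b-count i y x (distance-sym (d≡⇒distance dxy≡i)))
      (λ z (x~z , dist) → term-1 j x~z (trans (d-sym z y) (d-unique (subst (Distance y z) (sym j≡1+i) dist))))
      (λ z ¬Q → term-0 j λ (x~z , dzy≡j) → ¬Q (x~z ,
        subst (Distance y z) j≡1+i (distance-sym (d≡⇒distance dzy≡j))))

    N-c : ∀ {x y} i j → suc (toℕ j) ≡ toℕ i → d x y ≡ i → N x y j ≡ + c i
    N-c {x} {y} i j 1+j≡i dxy≡i = cardinality-sum (c-count i y x (distance-sym (d≡⇒distance dxy≡i)))
      (λ z (x~z , j′ , 1+j′≡i , dist) → term-1 j x~z (trans (d-sym z y)
        (d-unique (subst (Distance y z) (ℕ.suc-injective (trans 1+j′≡i (sym 1+j≡i))) dist))))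
      (λ z ¬Q → term-0 j λ (x~z , dzy≡j) → ¬Q (x~z , toℕ j , 1+j≡i , distance-sym (d≡⇒distance dzy≡j)))

    N-far : ∀ {x y} i j → suc (toℕ i) ℕ.< toℕ j ⊎ suc (toℕ j) ℕ.< toℕ i → d x y ≡ i → N x y j ≡ 0ℤ
    N-far {x} {y} i j far dxy≡i = sum-zero {f = λ z → δ₁ (d x z) * unit j (d z y)} λ z → term-0 {x} {y} {z} j λ (x~z , dzy≡j) → apart far x~z dzy≡j
      where
      apart : ∀ {z} → suc (toℕ i) ℕ.< toℕ j ⊎ suc (toℕ j) ℕ.< toℕ i → x ~ z → d z y ≡ j → ⊥
      apart (inj₁ i<j) x~z refl = ℕ.<⇒≱ i<j (subst (λ l → _ ℕ.≤ suc (toℕ l)) dxy≡i (triangle y x~z))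
      apart (inj₂ j<i) x~z refl = ℕ.<⇒≱ j<i
        (subst (λ l → toℕ l ℕ.≤ _) dxy≡i (triangle y (~-sym x~z)))

    k : ℤ
    k = + valency

    degree : ∀ x → ∑[ z < n ] δ₁ (d x z) ≡ k
    degree x = cardinality-sum (b-count 0F x x (distance-refl x))
      (λ z (x~z , _) → cong δ₁ (~⇒d≡1 x~z))
      (λ z ¬Q → off z (unit-cases 1F (d x z)) λ dxz≡1 → ¬Q (d≡1⇒~ dxz≡1 , d≡⇒distance dxz≡1))
      where
      off : ∀ z → (d x z ≡ 1F × δ₁ (d x z) ≡ 1ℤ) ⊎ δ₁ (d x z) ≡ 0ℤ → ¬ d x z ≡ 1F → δ₁ (d x z) ≡ 0ℤ
      off z (inj₁ (dxz≡1 , _)) ¬d≡1 = contradiction dxz≡1 ¬d≡1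
      off z (inj₂ p)           _    = p

    expand : ∀ f x y → ∑[ z < n ] (δ₁ (d x z) * f (d z y)) ≡
      f 0F * N x y 0F + f 1F * N x y 1F + (f 2F * N x y 2F + f 3F * N x y 3F)
    expand f x y = begin
      sum (λ z → δ₁ (d x z) * f (d z y))
        ≡⟨ sum-cong-≗ (λ z → trans (cong (δ₁ (d x z) *_) (unit-expand f (d z y)))
             (go (δ₁ (d x z)) (f 0F) (f 1F) (f 2F) (f 3F) (δ₀ (d z y)) (δ₁ (d z y)) (δ₂ (d z y)) (δ₃ (d z y)))) ⟩
      sum (λ z → (f 0F * t 0F z + f 1F * t 1F z) + (f 2F * t 2F z + f 3F * t 3F z))
        ≡⟨ ∑-distrib-+ (λ z → f 0F * t 0F z + f 1F * t 1F z) (λ z → f 2F * t 2F z + f 3F * t 3F z) ⟩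
      _ ≡⟨ cong₂ _+_ (sum-linear (f 0F) (f 1F) (t 0F) (t 1F)) (sum-linear (f 2F) (f 3F) (t 2F) (t 3F)) ⟩
      _ ∎
      where
      open ≡-Reasoning
      t : Fin 4 → Vector ℤ n
      t j z = δ₁ (d x z) * unit j (d z y)
      go : ∀ w p q t v d₀ d₁ d₂ d₃ → w * (p * d₀ + q * d₁ + (t * d₂ + v * d₃)) ≡
        (p * (w * d₀) + q * (w * d₁)) + (t * (w * d₂) + v * (w * d₃))
      go = solve-∀

    total : ∀ x y → N x y 0F + N x y 1F + (N x y 2F + N x y 3F) ≡ k
    total x y = begin
      N x y 0F + N x y 1F + (N x y 2F + N x y 3F)
        ≡⟨ go (N x y 0F) (N x y 1F) (N x y 2F) (N x y 3F) ⟩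
      _ ≡⟨ expand (λ _ → 1ℤ) x y ⟨
      sum (λ z → δ₁ (d x z) * 1ℤ) ≡⟨ sum-cong-≗ (λ z → *-identityʳ (δ₁ (d x z))) ⟩
      sum (λ z → δ₁ (d x z)) ≡⟨ degree x ⟩
      k ∎
      where
      open ≡-Reasoning
      go : ∀ p q t v → p + q + (t + v) ≡ 1ℤ * p + 1ℤ * q + (1ℤ * t + 1ℤ * v)
      go = solve-∀

    0≤N : ∀ x y j → 0ℤ ≤ N x y j
    0≤N x y j = sum-nonneg (λ z → δ₁ (d x z) * unit j (d z y)) (λ z → 0≤* (0≤unit 1F (d x z)) (0≤unit j (d z y)))

    0<N : ∀ {x y z} j → x ~ z → d z y ≡ j → 0ℤ < N x y j
    0<N {x} {y} {z} j x~z dzy≡j = <-≤-trans (subst (0ℤ <_) (sym (term-1 j x~z dzy≡j)) (+<+ (ℕ.s≤s ℕ.z≤n)))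
      (term≤sum (λ z → δ₁ (d x z) * unit j (d z y)) (λ z → 0≤* (0≤unit 1F (d x z)) (0≤unit j (d z y))) z)

    N-0 : ∀ {x y} → d x y ≡ 1F → N x y 0F ≡ 1ℤ
    N-0 {x} {y} dxy≡1 = indicator y (term-1 0F (d≡1⇒~ dxy≡1) (d-refl y))
      (λ z z≢y → term-0 0F λ (_ , dzy≡0) → z≢y (d-zero z y dzy≡0))

    -- A shortest path of length 3. Its vertices witness that k, b₁, b₂ and c₂ are positive, and
    -- supply the pairs from which c₁, b₃ and a₃ are read off.
    record Geodesic : Set where
      field
        {x₀ x₁ x₂ x₃} : Fin n
        x₀~x₁ : x₀ ~ x₁
        x₂~x₃ : x₂ ~ x₃
        d₀₁ : d x₀ x₁ ≡ 1F
        d₂₁ : d x₂ x₁ ≡ 1F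
        d₂₀ : d x₂ x₀ ≡ 2F
        d₃₀ : d x₃ x₀ ≡ 3F

    geodesic : Geodesic
    geodesic = from-diameter (proj₂ diameter)
      where
      from-diameter : (∃ λ x → ∃ λ y → Distance x y 3) → Geodesic
      from-diameter (x , y , (e₁ ∷ e₂ ∷ e₃ ∷ [] , minimal)) = record
        { x₀~x₁ = e₁ ; x₂~x₃ = e₃ ; d₀₁ = ~⇒d≡1 e₁ ; d₂₁ = ~⇒d≡1 (~-sym e₂)
        ; d₂₀ = d-unique (distance-sym (e₁ ∷ e₂ ∷ [] ,
            λ j w → ℕ.≤-pred (subst (3 ℕ.≤_) (ℕ.+-comm j 1) (minimal _ (append w (e₃ ∷ []))))))
        ; d₃₀ = d-unique (distance-sym (e₁ ∷ e₂ ∷ e₃ ∷ [] , minimal)) }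
        where
        append : ∀ {i j x y z} → Walk i x y → Walk j y z → Walk (i ℕ.+ j) x z
        append []      v = v
        append (e ∷ w) v = e ∷ append w v

    open Geodesic geodesic public

    c₁≡1 : + c 1F ≡ 1ℤ
    c₁≡1 = trans (sym (N-c 1F 0F refl d₀₁)) (N-0 d₀₁)

    b₃≡0 : + b 3F ≡ 0ℤ
    b₃≡0 = sym (trans (sym (sum-zero {n} {λ _ → 0ℤ} λ _ → refl))
      (cardinality-sum (b-count 3F _ _ (d≡⇒distance d₃₀))
        (λ z (_ , dist) → contradiction (proj₁ diameter _ _ _ dist) ℕ.1+n≰n) (λ _ _ → refl)))

    intersectionMatrix : Profile → Profile
    intersectionMatrix = tridiagonal k (a 1F) (+ b 1F) (+ c 2F) (a 2F) (+ b 2F) (+ c 3F) (a 3F)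

    1<2 : ∀ {n} → 1 ℕ.< suc (suc n)
    1<2 = ℕ.s≤s (ℕ.s≤s ℕ.z≤n)

    2<3 : ∀ {n} → 2 ℕ.< suc (suc (suc n))
    2<3 = ℕ.s≤s 1<2

    N-3 : ∀ {x y} → d x y ≡ 3F → N x y 3F ≡ a 3F
    N-3 {x} {y} dxy≡3 = begin
      N x y 3F ≡⟨ go (N x y 0F) (N x y 1F) (N x y 2F) (N x y 3F) ⟩
      _ ≡⟨ cong₂ _-_ (cong₂ _-_ (cong₂ _-_ (total x y) (N-c 3F 2F refl dxy≡3))
             (N-far 3F 1F (inj₂ 2<3) dxy≡3)) (N-far 3F 0F (inj₂ 1<2) dxy≡3) ⟩
      k - + c 3F - 0ℤ - 0ℤ ≡⟨ cong (λ t → k - + c 3F - 0ℤ - t) b₃≡0 ⟨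
      k - + c 3F - 0ℤ - + b 3F ≡⟨ go′ k (+ b 3F) (+ c 3F) ⟩
      a 3F ∎
      where
      open ≡-Reasoning
      go : ∀ p q t v → v ≡ p + q + (t + v) - t - q - p
      go = solve-∀
      go′ : ∀ k b c → k - c - 0ℤ - b ≡ k - b - c
      go′ = solve-∀

    -- A neighbour of x is at distance l - 1, l or l + 1 from y. The outer counts are intersection
    -- numbers, and the middle one follows because the four counts add up to k.
    row : ∀ f x y l → d x y ≡ l → ∑[ z < n ] (δ₁ (d x z) * f (d z y)) ≡ intersectionMatrix f l
    row f x y 0F dxy≡0 = trans (expand f x y) (trans
      (cong₂ (λ p q → p + q)
        (cong₂ (λ p q → f 0F * p + f 1F * q) N₀ N₁)
        (cong₂ (λ p q → f 2F * p + f 3F * q) N₂ N₃))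
      (go (f 0F) (f 1F) (f 2F) (f 3F) k))
      where
      N₁ : N x y 1F ≡ k
      N₁ = N-b 0F 1F refl dxy≡0
      N₂ : N x y 2F ≡ 0ℤ
      N₂ = N-far 0F 2F (inj₁ 1<2) dxy≡0
      N₃ : N x y 3F ≡ 0ℤ
      N₃ = N-far 0F 3F (inj₁ 1<2) dxy≡0
      go₀ : ∀ p q t v → p ≡ p + q + (t + v) - q - t - v
      go₀ = solve-∀
      N₀ : N x y 0F ≡ 0ℤ
      N₀ = trans (go₀ (N x y 0F) (N x y 1F) (N x y 2F) (N x y 3F))
        (trans (cong₂ _-_ (cong₂ _-_ (cong₂ _-_ (total x y) N₁) N₂) N₃) (go₁ k))
        where
        go₁ : ∀ k → k - k - 0ℤ - 0ℤ ≡ 0ℤ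
        go₁ = solve-∀
      go : ∀ p q t v k → p * 0ℤ + q * k + (t * 0ℤ + v * 0ℤ) ≡ k * q
      go = solve-∀
    row f x y 1F dxy≡1 = trans (expand f x y) (trans
      (cong₂ (λ p q → p + q)
        (cong₂ (λ p q → f 0F * p + f 1F * q) (N-0 dxy≡1) N₁)
        (cong₂ (λ p q → f 2F * p + f 3F * q) N₂ N₃))
      (go (f 0F) (f 1F) (f 2F) (f 3F) (a 1F) (+ b 1F)))
      where
      N₂ : N x y 2F ≡ + b 1F
      N₂ = N-b 1F 2F refl dxy≡1
      N₃ : N x y 3F ≡ 0ℤ
      N₃ = N-far 1F 3F (inj₁ 2<3) dxy≡1
      go₁ : ∀ p q t v → q ≡ p + q + (t + v) - t - p - v
      go₁ = solve-∀
      N₁ : N x y 1F ≡ a 1F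
      N₁ = trans (go₁ (N x y 0F) (N x y 1F) (N x y 2F) (N x y 3F))
        (trans (cong₂ _-_ (cong₂ _-_ (cong₂ _-_ (total x y) N₂) (N-c 1F 0F refl dxy≡1)) N₃) (+-identityʳ _))
      go : ∀ p q t v a₁ b₁ → p * 1ℤ + q * a₁ + (t * b₁ + v * 0ℤ) ≡ p + a₁ * q + b₁ * t
      go = solve-∀
    row f x y 2F dxy≡2 = trans (expand f x y) (trans
      (cong₂ (λ p q → p + q)
        (cong₂ (λ p q → f 0F * p + f 1F * q) N₀ N₁)
        (cong₂ (λ p q → f 2F * p + f 3F * q) N₂ N₃))
      (go (f 0F) (f 1F) (f 2F) (f 3F) (a 2F) (+ b 2F) (+ c 2F)))
      where
      N₀ : N x y 0F ≡ 0ℤ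
      N₀ = N-far 2F 0F (inj₂ 1<2) dxy≡2
      N₁ : N x y 1F ≡ + c 2F
      N₁ = N-c 2F 1F refl dxy≡2
      N₃ : N x y 3F ≡ + b 2F
      N₃ = N-b 2F 3F refl dxy≡2
      go₁ : ∀ p q t v → t ≡ p + q + (t + v) - v - q - p
      go₁ = solve-∀
      N₂ : N x y 2F ≡ a 2F
      N₂ = trans (go₁ (N x y 0F) (N x y 1F) (N x y 2F) (N x y 3F))
        (trans (cong₂ _-_ (cong₂ _-_ (cong₂ _-_ (total x y) N₃) N₁) N₀) (+-identityʳ _))
      go : ∀ p q t v a₂ b₂ c₂ → p * 0ℤ + q * c₂ + (t * a₂ + v * b₂) ≡ c₂ * q + a₂ * t + b₂ * v
      go = solve-∀
    row f x y 3F dxy≡3 = trans (expand f x y) (trans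
      (cong₂ (λ p q → p + q)
        (cong₂ (λ p q → f 0F * p + f 1F * q) (N-far 3F 0F (inj₂ 1<2) dxy≡3)
          (N-far 3F 1F (inj₂ 2<3) dxy≡3))
        (cong₂ (λ p q → f 2F * p + f 3F * q) (N-c 3F 2F refl dxy≡3) (N-3 dxy≡3)))
      (go (f 0F) (f 1F) (f 2F) (f 3F) (a 3F) (+ c 3F)))
      where
      go : ∀ p q t v a₃ c₃ → p * 0ℤ + q * 0ℤ + (t * c₃ + v * a₃) ≡ c₃ * t + a₃ * v
      go = solve-∀

    scheme : IsScheme d intersectionMatrix
    scheme = record
      { d-sym = d-sym ; d-refl = d-refl ; d-zero = d-zero ; A·M = λ f x y → row f x y (d x y) refl }

    0<k : 0ℤ < k
    0<k = subst (0ℤ <_) (N-b 0F 1F refl (d-refl x₀)) (0<N 1F x₀~x₁ (trans (d-sym x₁ x₀) d₀₁))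

    0<b₁ : 0ℤ < + b 1F
    0<b₁ = subst (0ℤ <_) (N-b 1F 2F refl (trans (d-sym x₁ x₀) d₀₁))
      (0<N 2F (d≡1⇒~ (trans (d-sym x₁ x₂) d₂₁)) d₂₀)

    0<b₂ : 0ℤ < + b 2F
    0<b₂ = subst (0ℤ <_) (N-b 2F 3F refl d₂₀) (0<N 3F x₂~x₃ d₃₀)

    0<c₂ : 0ℤ < + c 2F
    0<c₂ = subst (0ℤ <_) (N-c 2F 1F refl d₂₀) (0<N 1F (d≡1⇒~ d₂₁) (trans (d-sym x₁ x₀) d₀₁))

    0≤a₃ : 0ℤ ≤ a 3F
    0≤a₃ = subst (0ℤ ≤_) (N-3 d₃₀) (0≤N x₃ x₀ 3F)

    -- Once k = b a₃ with b = a₃ - a₁, all parameters are functions of a₃, b, b₂ and c₂.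
    module Parametrized (k≡ : k ≡ a 3F * (a 3F - a 1F)) where

      a₃ b⟨Γ⟩ : ℤ
      a₃   = a 3F
      b⟨Γ⟩ = a 3F - a 1F

      0<a₃ : 0ℤ < a₃
      0<a₃ = ≤∧≢⇒< 0≤a₃ λ 0≡a₃ → <-irrefl (sym (trans k≡ (cong (_* b⟨Γ⟩) (sym 0≡a₃)))) 0<k

      b₁≡ : + b 1F ≡ (b⟨Γ⟩ - 1ℤ) * (a₃ + 1ℤ)
      b₁≡ = trans (go₀ k (+ b 1F) (+ c 1F)) (trans
        (cong₂ (λ s t → s - t - a 1F) k≡ c₁≡1) (go₁ (a 3F) (a 1F)))
        where
        go₀ : ∀ k b₁ c₁ → b₁ ≡ k - c₁ - (k - b₁ - c₁)
        go₀ = solve-∀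
        go₁ : ∀ a₃ a₁ → a₃ * (a₃ - a₁) - 1ℤ - a₁ ≡ (a₃ - a₁ - 1ℤ) * (a₃ + 1ℤ)
        go₁ = solve-∀

      1<b⟨Γ⟩ : 1ℤ < b⟨Γ⟩
      1<b⟨Γ⟩ = 0<-difference (*-cancel-pos-< (+-mono-<-≤ 0<a₃ (+≤+ {0} {1} ℕ.z≤n))
        (subst (0ℤ <_) (trans b₁≡ (*-comm (b⟨Γ⟩ - 1ℤ) (a₃ + 1ℤ))) 0<b₁))

      matrix≡ : intersectionMatrix ≡ shillaMatrix a₃ b⟨Γ⟩ (+ b 2F) (+ c 2F)
      matrix≡ = trans
        (cong₂ (λ k a₁ → tridiagonal k a₁ (+ b 1F) (+ c 2F) (a 2F) (+ b 2F) (+ c 3F) (a 3F)) k≡ (a₁≡ (a 3F) (a 1F)))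
        (trans (cong₂ (λ b₁ a₂ → tridiagonal (a₃ * b⟨Γ⟩) (a₃ - b⟨Γ⟩) b₁ (+ c 2F) a₂ (+ b 2F) (+ c 3F) a₃) b₁≡
          (cong (λ t → t - + b 2F - + c 2F) k≡))
          (cong (λ c₃ → tridiagonal (a₃ * b⟨Γ⟩) (a₃ - b⟨Γ⟩) ((b⟨Γ⟩ - 1ℤ) * (a₃ + 1ℤ)) (+ c 2F)
            (a₃ * b⟨Γ⟩ - + b 2F - + c 2F) (+ b 2F) c₃ a₃) c₃≡))
        where
        a₁≡ : ∀ a₃ a₁ → a₁ ≡ a₃ - (a₃ - a₁)
        a₁≡ = solve-∀
        c₃≡ : + c 3F ≡ (b⟨Γ⟩ - 1ℤ) * a₃
        c₃≡ = trans (go₀ k (+ b 3F) (+ c 3F)) (trans (cong₂ (λ s t → s - t - a 3F) k≡ b₃≡0) (go₁ (a 3F) b⟨Γ⟩))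
          where
          go₀ : ∀ k b₃ c₃ → c₃ ≡ k - b₃ - (k - b₃ - c₃)
          go₀ = solve-∀
          go₁ : ∀ a b → a * b - 0ℤ - a ≡ (b - 1ℤ) * a
          go₁ = solve-∀

      shillaScheme : IsScheme d (shillaMatrix a₃ b⟨Γ⟩ (+ b 2F) (+ c 2F))
      shillaScheme = subst (IsScheme d) matrix≡ scheme

open import Defs
open import Algebra.Bundles using (CommutativeSemiring)
open import Algebra.Structures using (IsCommutativeSemiring)
import Algebra.Properties.Semiring.Sum as Sum
open import Data.Fin.Base using (Fin; zero; suc)
open import Data.Fin.Patterns using (0F; 1F; 2F; 3F)
open import Data.Fin.Properties using (suc-injective)
open import Data.Integer.Base as ℤ using (ℤ; +_; 0ℤ; 1ℤ)
import Data.Integer.Properties as ℤ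
import Data.Integer.Tactic.RingSolver as ℤSolver
open import Data.Maybe.Base using (Maybe; just; nothing)
open import Data.Nat.Base as ℕ using (ℕ)
import Data.Nat.Properties as ℕ
open import Data.Product.Base using (∃; ∃₂; _×_; _,_; proj₁; proj₂)
open import Data.Rational.Base as ℚ using (ℚ; 0ℚ; 1ℚ; ½; ∣_∣; toℚᵘ)
import Data.Rational.Properties as ℚ
open import Data.Rational.Unnormalised.Base as ℚᵘ using (mkℚᵘ; *≡*; *≤*)
import Data.Rational.Unnormalised.Properties as ℚᵘ
open import Data.Sum.Base using (_⊎_; inj₁; inj₂)
open import Data.Vec.Functional using (Vector)
open import Function.Bundles using (_⇔_; mk⇔)
open import Level using (0ℓ)
import Relation.Binary.Reasoning.Setoid as SetoidReasoning
open import Relation.Binary.PropositionalEquality using (_≡_; _≢_; refl; sym; trans; cong; cong₂; subst; module ≡-Reasoning)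
open import Relation.Binary.Structures using (IsEquivalence)
open import Relation.Nullary using (¬_; yes; no; contradiction)
open import Tactic.RingSolver using (solve-∀)
import Tactic.RingSolver.Core.AlmostCommutativeRing as ACR
open Integral using (≤-by; 0≤*; 0<*; i<j⇒0<j-i; 0<⇒1≤; *-cancel-pos-<; Profile; δ₀; δ₁; unit-cases; shillaMatrix; tridiagonal-defect; IsScheme; module Spectral; module Bound; module Intersection) renaming (sum to sumᶻ)


-- Cauchy reals

ℚ-ring : ACR.AlmostCommutativeRing 0ℓ 0ℓ
ℚ-ring = ACR.fromCommutativeRing ℚ.+-*-commutativeRing zero?
  where
  zero? : ∀ x → Maybe (0ℚ ≡ x)
  zero? (ℚ.mkℚ (+ 0) 0 _) = just refl
  zero? _                 = nothing

⌈_⌉ : ℤ → ℚ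
⌈ i ⌉ = i ℚ./ 1

toℚᵘ-⌈⌉ : ∀ i → toℚᵘ ⌈ i ⌉ ℚᵘ.≃ mkℚᵘ i 0
toℚᵘ-⌈⌉ i = ℚ.toℚᵘ-fromℚᵘ (mkℚᵘ i 0)

⌈⌉-+ : ∀ i j → ⌈ i ℤ.+ j ⌉ ≡ ⌈ i ⌉ ℚ.+ ⌈ j ⌉
⌈⌉-+ i j = ℚ.toℚᵘ-injective (begin
  toℚᵘ ⌈ i ℤ.+ j ⌉              ≈⟨ toℚᵘ-⌈⌉ (i ℤ.+ j) ⟩
  mkℚᵘ (i ℤ.+ j) 0              ≈⟨ *≡* (go i j) ⟩
  mkℚᵘ i 0 ℚᵘ.+ mkℚᵘ j 0        ≈⟨ ℚᵘ.+-cong (toℚᵘ-⌈⌉ i) (toℚᵘ-⌈⌉ j) ⟨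
  toℚᵘ ⌈ i ⌉ ℚᵘ.+ toℚᵘ ⌈ j ⌉    ≈⟨ ℚ.toℚᵘ-homo-+ ⌈ i ⌉ ⌈ j ⌉ ⟨
  toℚᵘ (⌈ i ⌉ ℚ.+ ⌈ j ⌉)        ∎)
  where
  open ℚᵘ.≃-Reasoning
  go : ∀ i j → (i ℤ.+ j) ℤ.* + 1 ≡ (i ℤ.* + 1 ℤ.+ j ℤ.* + 1) ℤ.* + 1
  go = ℤSolver.solve-∀

⌈⌉-* : ∀ i j → ⌈ i ℤ.* j ⌉ ≡ ⌈ i ⌉ ℚ.* ⌈ j ⌉
⌈⌉-* i j = ℚ.toℚᵘ-injective (begin
  toℚᵘ ⌈ i ℤ.* j ⌉              ≈⟨ toℚᵘ-⌈⌉ (i ℤ.* j) ⟩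
  mkℚᵘ i 0 ℚᵘ.* mkℚᵘ j 0        ≈⟨ ℚᵘ.*-cong (toℚᵘ-⌈⌉ i) (toℚᵘ-⌈⌉ j) ⟨
  toℚᵘ ⌈ i ⌉ ℚᵘ.* toℚᵘ ⌈ j ⌉    ≈⟨ ℚ.toℚᵘ-homo-* ⌈ i ⌉ ⌈ j ⌉ ⟨
  toℚᵘ (⌈ i ⌉ ℚ.* ⌈ j ⌉)        ∎)
  where open ℚᵘ.≃-Reasoning

⌈⌉-neg : ∀ i → ⌈ ℤ.- i ⌉ ≡ ℚ.- ⌈ i ⌉
⌈⌉-neg i = ℚ.toℚᵘ-injective (begin
  toℚᵘ ⌈ ℤ.- i ⌉      ≈⟨ toℚᵘ-⌈⌉ (ℤ.- i) ⟩
  ℚᵘ.- mkℚᵘ i 0       ≈⟨ ℚᵘ.-‿cong (toℚᵘ-⌈⌉ i) ⟨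
  ℚᵘ.- toℚᵘ ⌈ i ⌉     ≈⟨ ℚ.toℚᵘ-homo‿- ⌈ i ⌉ ⟨
  toℚᵘ (ℚ.- ⌈ i ⌉)    ∎)
  where open ℚᵘ.≃-Reasoning

⌈⌉-mono : ∀ {i j} → i ℤ.≤ j → ⌈ i ⌉ ℚ.≤ ⌈ j ⌉
⌈⌉-mono {i} {j} i≤j = ℚ.toℚᵘ-cancel-≤ (begin
  toℚᵘ ⌈ i ⌉    ≃⟨ toℚᵘ-⌈⌉ i ⟩
  mkℚᵘ i 0      ≤⟨ *≤* (ℤ.*-monoʳ-≤-nonNeg (+ 1) i≤j) ⟩
  mkℚᵘ j 0      ≃⟨ toℚᵘ-⌈⌉ j ⟨
  toℚᵘ ⌈ j ⌉    ∎)
  where open ℚᵘ.≤-Reasoning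

p≤∣p∣ : ∀ p → p ℚ.≤ ∣ p ∣
p≤∣p∣ p with ℚ.≤-total 0ℚ p
... | inj₁ 0≤p = ℚ.≤-reflexive (sym (ℚ.0≤p⇒∣p∣≡p 0≤p))
... | inj₂ p≤0 = ℚ.≤-trans p≤0 (ℚ.0≤∣p∣ p)

∣p-q∣≡∣q-p∣ : ∀ p q → ∣ p ℚ.- q ∣ ≡ ∣ q ℚ.- p ∣
∣p-q∣≡∣q-p∣ p q = trans (sym (ℚ.∣-p∣≡∣p∣ (p ℚ.- q))) (cong ∣_∣ (go p q))
  where
  go : ∀ p q → ℚ.- (p ℚ.- q) ≡ q ℚ.- p
  go = solve-∀ ℚ-ring

0≤p*q : ∀ {p q} → 0ℚ ℚ.≤ p → 0ℚ ℚ.≤ q → 0ℚ ℚ.≤ p ℚ.* q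
0≤p*q {p} {q} 0≤p 0≤q = ℚ.nonNegative⁻¹ (p ℚ.* q)
  {{ℚ.nonNeg*nonNeg⇒nonNeg p {{ℚ.nonNegative 0≤p}} q {{ℚ.nonNegative 0≤q}}}}

0<p*q : ∀ {p q} → 0ℚ ℚ.< p → 0ℚ ℚ.< q → 0ℚ ℚ.< p ℚ.* q
0<p*q {p} {q} 0<p 0<q = ℚ.positive⁻¹ (p ℚ.* q)
  {{ℚ.pos*pos⇒pos p {{ℚ.positive 0<p}} q {{ℚ.positive 0<q}}}}

reciprocal : ∀ {p} → 0ℚ ℚ.< p → ∃ λ q → 0ℚ ℚ.< q × p ℚ.* q ≡ 1ℚ
reciprocal {p} 0<p = ℚ.1/_ p {{p≢0}} ,
  ℚ.positive⁻¹ _ {{ℚ.1/pos⇒pos p {{ℚ.positive 0<p}}}} , ℚ.*-inverseʳ p {{p≢0}}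
  where
  p≢0 : ℚ.NonZero p
  p≢0 = ℚ.pos⇒nonZero p {{ℚ.positive 0<p}}

0<½p : ∀ {p} → 0ℚ ℚ.< p → 0ℚ ℚ.< ½ ℚ.* p
0<½p = 0<p*q (ℚ.positive⁻¹ ½)

½+½ : ∀ p → ½ ℚ.* p ℚ.+ ½ ℚ.* p ≡ p
½+½ = solve-∀ ℚ-ring

-- `x ≈ y` amounts to `Null` of the difference of the two sequences, so equalities of reals reduce
-- to ring identities between null sequences.
Null : (ℕ → ℚ) → Set
Null f = ∀ ε → 0ℚ ℚ.< ε → ∃ λ N → ∀ n → N ℕ.≤ n → ∣ f n ∣ ℚ.≤ ε

Bounded : (ℕ → ℚ) → Set
Bounded f = ∃₂ λ B N → 0ℚ ℚ.< B × ∀ n → N ℕ.≤ n → ∣ f n ∣ ℚ.≤ B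

null-cong : ∀ {f g} → (∀ n → f n ≡ g n) → Null f → Null g
null-cong f≡g null ε 0<ε with null ε 0<ε
... | N , small = N , λ n N≤n → subst (λ p → ∣ p ∣ ℚ.≤ ε) (f≡g n) (small n N≤n)

null-zero : ∀ {f} → (∀ n → f n ≡ 0ℚ) → Null f
null-zero f≡0 ε 0<ε = 0 , λ n _ → subst (λ p → ∣ p ∣ ℚ.≤ ε) (sym (f≡0 n)) (ℚ.<⇒≤ 0<ε)

null-+ : ∀ {f g} → Null f → Null g → Null (λ n → f n ℚ.+ g n)
null-+ {f} {g} null-f null-g ε 0<ε with null-f (½ ℚ.* ε) (0<½p 0<ε) | null-g (½ ℚ.* ε) (0<½p 0<ε)
... | M , small-f | N , small-g = M ℕ.⊔ N , λ n M⊔N≤n → begin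
  ∣ f n ℚ.+ g n ∣          ≤⟨ ℚ.∣p+q∣≤∣p∣+∣q∣ (f n) (g n) ⟩
  ∣ f n ∣ ℚ.+ ∣ g n ∣      ≤⟨ ℚ.+-mono-≤ (small-f n (ℕ.m⊔n≤o⇒m≤o M N M⊔N≤n)) (small-g n (ℕ.m⊔n≤o⇒n≤o M N M⊔N≤n)) ⟩
  ½ ℚ.* ε ℚ.+ ½ ℚ.* ε      ≡⟨ ½+½ ε ⟩
  ε                        ∎
  where open ℚ.≤-Reasoning

null-neg : ∀ {f} → Null f → Null (λ n → ℚ.- f n)
null-neg {f} null ε 0<ε with null ε 0<ε
... | N , small = N , λ n N≤n → subst (ℚ._≤ ε) (sym (ℚ.∣-p∣≡∣p∣ (f n))) (small n N≤n)

null-* : ∀ {f g} → Bounded f → Null g → Null (λ n → f n ℚ.* g n)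
null-* {f} {g} (B , M , 0<B , bound) null ε 0<ε with reciprocal 0<B
... | C , 0<C , BC≡1 with null (C ℚ.* ε) (0<p*q 0<C 0<ε)
... | N , small = M ℕ.⊔ N , λ n M⊔N≤n → begin
  ∣ f n ℚ.* g n ∣          ≡⟨ ℚ.∣p*q∣≡∣p∣*∣q∣ (f n) (g n) ⟩
  ∣ f n ∣ ℚ.* ∣ g n ∣      ≤⟨ ℚ.*-monoʳ-≤-nonNeg ∣ g n ∣ {{ℚ.nonNegative (ℚ.0≤∣p∣ (g n))}} (bound n (ℕ.m⊔n≤o⇒m≤o M N M⊔N≤n)) ⟩
  B ℚ.* ∣ g n ∣            ≤⟨ ℚ.*-monoˡ-≤-nonNeg B {{ℚ.nonNegative (ℚ.<⇒≤ 0<B)}} (small n (ℕ.m⊔n≤o⇒n≤o M N M⊔N≤n)) ⟩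
  B ℚ.* (C ℚ.* ε)          ≡⟨ ℚ.*-assoc B C ε ⟨
  B ℚ.* C ℚ.* ε            ≡⟨ cong (ℚ._* ε) BC≡1 ⟩
  1ℚ ℚ.* ε                 ≡⟨ ℚ.*-identityˡ ε ⟩
  ε                        ∎
  where open ℚ.≤-Reasoning

cauchy-bounded : ∀ x → Bounded (seq x)
cauchy-bounded x with cauchy x 1ℚ (ℚ.positive⁻¹ 1ℚ)
... | N , close = 1ℚ ℚ.+ ∣ seq x N ∣ , N , ℚ.+-mono-<-≤ (ℚ.positive⁻¹ 1ℚ) (ℚ.0≤∣p∣ (seq x N)) , λ n N≤n → begin
  ∣ seq x n ∣                                ≡⟨ cong ∣_∣ (go (seq x n) (seq x N)) ⟩
  ∣ (seq x n ℚ.- seq x N) ℚ.+ seq x N ∣      ≤⟨ ℚ.∣p+q∣≤∣p∣+∣q∣ (seq x n ℚ.- seq x N) (seq x N) ⟩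
  ∣ seq x n ℚ.- seq x N ∣ ℚ.+ ∣ seq x N ∣    ≤⟨ ℚ.+-monoˡ-≤ ∣ seq x N ∣ (close n N N≤n ℕ.≤-refl) ⟩
  1ℚ ℚ.+ ∣ seq x N ∣                         ∎
  where
  open ℚ.≤-Reasoning
  go : ∀ p q → p ≡ (p ℚ.- q) ℚ.+ q
  go = solve-∀ ℚ-ring

pointwise : ∀ {x y} → (∀ n → seq x n ≡ seq y n) → x ≈ y
pointwise {x} {y} x≡y = mk≈ (null-zero λ n → trans (cong (ℚ._- seq y n) (x≡y n)) (ℚ.+-inverseʳ (seq y n)))

≈-refl : ∀ {x} → x ≈ x
≈-refl = pointwise λ _ → refl

≈-sym : ∀ {x y} → x ≈ y → y ≈ x
≈-sym {x} {y} x≈y = mk≈ (null-cong (λ n → go (seq x n) (seq y n)) (null-neg (_≈_.close x≈y)))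
  where
  go : ∀ p q → ℚ.- (p ℚ.- q) ≡ q ℚ.- p
  go = solve-∀ ℚ-ring

≈-trans : ∀ {x y z} → x ≈ y → y ≈ z → x ≈ z
≈-trans {x} {y} {z} x≈y y≈z = mk≈ (null-cong (λ n → go (seq x n) (seq y n) (seq z n))
  (null-+ (_≈_.close x≈y) (_≈_.close y≈z)))
  where
  go : ∀ p q r → (p ℚ.- q) ℚ.+ (q ℚ.- r) ≡ p ℚ.- r
  go = solve-∀ ℚ-ring

≈-isEquivalence : IsEquivalence _≈_
≈-isEquivalence = record { refl = ≈-refl ; sym = ≈-sym ; trans = ≈-trans }

+-cong : ∀ {x y u v} → x ≈ y → u ≈ v → x + u ≈ y + v
+-cong {x} {y} {u} {v} x≈y u≈v = mk≈ (null-cong (λ n → go (seq x n) (seq y n) (seq u n) (seq v n))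
  (null-+ (_≈_.close x≈y) (_≈_.close u≈v)))
  where
  go : ∀ p q r s → (p ℚ.- q) ℚ.+ (r ℚ.- s) ≡ (p ℚ.+ r) ℚ.- (q ℚ.+ s)
  go = solve-∀ ℚ-ring

*-cong : ∀ {x y u v} → x ≈ y → u ≈ v → x * u ≈ y * v
*-cong {x} {y} {u} {v} x≈y u≈v = mk≈ (null-cong (λ n → go (seq x n) (seq y n) (seq u n) (seq v n))
  (null-+ (null-* (cauchy-bounded x) (_≈_.close u≈v)) (null-* (cauchy-bounded v) (_≈_.close x≈y))))
  where
  go : ∀ p q r s → p ℚ.* (r ℚ.- s) ℚ.+ s ℚ.* (p ℚ.- q) ≡ p ℚ.* r ℚ.- q ℚ.* s
  go = solve-∀ ℚ-ring

ℝ-isCommutativeSemiring : IsCommutativeSemiring _≈_ _+_ _*_ 0ℝ 1ℝ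
ℝ-isCommutativeSemiring = record
  { isSemiring = record
    { isSemiringWithoutAnnihilatingZero = record
      { +-isCommutativeMonoid = record
        { isMonoid = record
          { isSemigroup = record
            { isMagma = record { isEquivalence = ≈-isEquivalence ; ∙-cong = +-cong }
            ; assoc = λ x y z → pointwise λ n → ℚ.+-assoc (seq x n) (seq y n) (seq z n) }
          ; identity = (λ x → pointwise λ n → ℚ.+-identityˡ (seq x n)) , (λ x → pointwise λ n → ℚ.+-identityʳ (seq x n)) }
        ; comm = λ x y → pointwise λ n → ℚ.+-comm (seq x n) (seq y n) }
      ; *-cong = *-cong
      ; *-assoc = λ x y z → pointwise λ n → ℚ.*-assoc (seq x n) (seq y n) (seq z n)
      ; *-identity = (λ x → pointwise λ n → ℚ.*-identityˡ (seq x n)) , (λ x → pointwise λ n → ℚ.*-identityʳ (seq x n))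
      ; distrib = (λ x y z → pointwise λ n → ℚ.*-distribˡ-+ (seq x n) (seq y n) (seq z n))
                , (λ x y z → pointwise λ n → ℚ.*-distribʳ-+ (seq x n) (seq y n) (seq z n)) }
    ; zero = (λ x → pointwise λ n → ℚ.*-zeroˡ (seq x n)) , (λ x → pointwise λ n → ℚ.*-zeroʳ (seq x n)) }
  ; *-comm = λ x y → pointwise λ n → ℚ.*-comm (seq x n) (seq y n) }

ℝ-commutativeSemiring : CommutativeSemiring 0ℓ 0ℓ
ℝ-commutativeSemiring = record { isCommutativeSemiring = ℝ-isCommutativeSemiring }

fromℤ-+ : ∀ i j → fromℤ (i ℤ.+ j) ≈ fromℤ i + fromℤ j
fromℤ-+ i j = pointwise λ _ → ⌈⌉-+ i j

fromℤ-* : ∀ i j → fromℤ (i ℤ.* j) ≈ fromℤ i * fromℤ j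
fromℤ-* i j = pointwise λ _ → ⌈⌉-* i j

<-separation : ∀ {x y} → x < y → ∃ λ ε → 0ℚ ℚ.< ε × ∃ λ N → ∀ n → N ℕ.≤ n → ε ℚ.≤ seq y n ℚ.- seq x n
<-separation {x} {y} (mk< (ε , 0<ε , N , gap)) = ε , 0<ε , N , λ n N≤n →
  subst (ℚ._≤ seq y n ℚ.- seq x n) (go (seq x n) ε) (ℚ.+-monoˡ-≤ (ℚ.- seq x n) (gap n N≤n))
  where
  go : ∀ p ε → p ℚ.+ ε ℚ.- p ≡ ε
  go = solve-∀ ℚ-ring

divide-bound : ∀ {δ ε} p q r → 0ℚ ℚ.< δ → δ ℚ.≤ q ℚ.- p →
  ∣ p ℚ.* r ℚ.- q ℚ.* r ∣ ℚ.≤ δ ℚ.* ε → ∣ r ∣ ℚ.≤ ε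
divide-bound {δ} {ε} p q r 0<δ δ≤q-p close = ℚ.*-cancelˡ-≤-pos δ {{ℚ.positive 0<δ}} (begin
  δ ℚ.* ∣ r ∣                     ≤⟨ ℚ.*-monoʳ-≤-nonNeg ∣ r ∣ {{ℚ.nonNegative (ℚ.0≤∣p∣ r)}}
                                      (ℚ.≤-trans δ≤q-p (p≤∣p∣ (q ℚ.- p))) ⟩
  ∣ q ℚ.- p ∣ ℚ.* ∣ r ∣           ≡⟨ ℚ.∣p*q∣≡∣p∣*∣q∣ (q ℚ.- p) r ⟨
  ∣ (q ℚ.- p) ℚ.* r ∣             ≡⟨ cong ∣_∣ (go p q r) ⟩
  ∣ q ℚ.* r ℚ.- p ℚ.* r ∣         ≡⟨ ∣p-q∣≡∣q-p∣ (q ℚ.* r) (p ℚ.* r) ⟩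
  ∣ p ℚ.* r ℚ.- q ℚ.* r ∣         ≤⟨ close ⟩
  δ ℚ.* ε                         ∎)
  where
  open ℚ.≤-Reasoning
  go : ∀ p q r → (q ℚ.- p) ℚ.* r ≡ q ℚ.* r ℚ.- p ℚ.* r
  go = solve-∀ ℚ-ring

-- Dividing by y - x, which is bounded away from 0.
<-cancel : ∀ {x y} z → x < y → x * z ≈ y * z → z ≈ 0ℝ
<-cancel {x} {y} z x<y xz≈yz = mk≈ (null-cong (λ n → sym (ℚ.+-identityʳ (seq z n)))
  (null (<-separation x<y)))
  where
  null : (∃ λ δ → 0ℚ ℚ.< δ × ∃ λ M → ∀ n → M ℕ.≤ n → δ ℚ.≤ seq y n ℚ.- seq x n) → Null (seq z)
  null (δ , 0<δ , M , gap) ε 0<ε with _≈_.close xz≈yz (δ ℚ.* ε) (0<p*q 0<δ 0<ε)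
  ... | N , close = M ℕ.⊔ N , λ n M⊔N≤n → divide-bound (seq x n) (seq y n) (seq z n) 0<δ
    (gap n (ℕ.m⊔n≤o⇒m≤o M N M⊔N≤n)) (close n (ℕ.m⊔n≤o⇒n≤o M N M⊔N≤n))

#-cancel : ∀ {x y} z → x # y → x * z ≈ y * z → z ≈ 0ℝ
#-cancel z (inj₁ x<y) xz≈yz = <-cancel z x<y xz≈yz
#-cancel z (inj₂ y<x) xz≈yz = <-cancel z y<x (≈-sym xz≈yz)


<-respʳ-≈ : ∀ {x y z} → x < y → y ≈ z → x < z
<-respʳ-≈ {x} {y} {z} (mk< (ε , 0<ε , M , gap)) y≈z with _≈_.close y≈z (½ ℚ.* ε) (0<½p 0<ε)
... | N , close = mk< (½ ℚ.* ε , 0<½p 0<ε , M ℕ.⊔ N , λ n M⊔N≤n → begin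
  seq x n ℚ.+ ½ ℚ.* ε                             ≡⟨ go₀ (seq x n) ε ⟩
  seq x n ℚ.+ ε ℚ.- ½ ℚ.* ε                       ≤⟨ ℚ.+-mono-≤ (gap n (ℕ.m⊔n≤o⇒m≤o M N M⊔N≤n))
       (ℚ.neg-antimono-≤ (ℚ.≤-trans (p≤∣p∣ (seq y n ℚ.- seq z n)) (close n (ℕ.m⊔n≤o⇒n≤o M N M⊔N≤n)))) ⟩
  seq y n ℚ.- (seq y n ℚ.- seq z n)               ≡⟨ go₁ (seq y n) (seq z n) ⟩
  seq z n                                         ∎)
  where
  open ℚ.≤-Reasoning
  go₀ : ∀ p ε → p ℚ.+ ½ ℚ.* ε ≡ p ℚ.+ ε ℚ.- ½ ℚ.* ε
  go₀ = solve-∀ ℚ-ring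
  go₁ : ∀ p q → p ℚ.- (p ℚ.- q) ≡ q
  go₁ = solve-∀ ℚ-ring

<-fromℤ : ∀ {x i j} → x < fromℤ i → i ℤ.≤ j → x < fromℤ j
<-fromℤ (mk< (ε , 0<ε , N , gap)) i≤j = mk< (ε , 0<ε , N , λ n N≤n → ℚ.≤-trans (gap n N≤n) (⌈⌉-mono i≤j))

fromℤ-nonzero : ∀ {i} → + 1 ℤ.≤ i → ¬ Null (λ _ → ⌈ i ⌉)
fromℤ-nonzero {i} 1≤i null with null ½ (ℚ.positive⁻¹ ½)
... | N , small = ℚ.<-irrefl refl
  (ℚ.<-≤-trans ½<1 (ℚ.≤-trans (⌈⌉-mono 1≤i) (ℚ.≤-trans (p≤∣p∣ ⌈ i ⌉) (small N ℕ.≤-refl))))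
  where
  ½<1 : ½ ℚ.< 1ℚ
  ½<1 = ℚ.*<* (ℤ.+<+ (ℕ.s≤s (ℕ.s≤s ℕ.z≤n)))

fromℤ-zero : ∀ {i} → fromℤ i ≈ 0ℝ → i ≡ + 0
fromℤ-zero {i} i≈0 = ℤ.≤-antisym (ℤ.≮⇒≥ λ 0<i → fromℤ-nonzero (ℤ.i<j⇒suc[i]≤j 0<i) null)
  (ℤ.≮⇒≥ λ i<0 → fromℤ-nonzero {ℤ.- i} (ℤ.i<j⇒suc[i]≤j (ℤ.neg-mono-< i<0))
    (null-cong (λ _ → sym (⌈⌉-neg i)) (null-neg null)))
  where
  null : Null (λ _ → ⌈ i ⌉)
  null = null-cong (λ _ → go ⌈ i ⌉) (_≈_.close i≈0)
    where
    go : ∀ p → p ℚ.- 0ℚ ≡ p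
    go = solve-∀ ℚ-ring

open CommutativeSemiring ℝ-commutativeSemiring
  using (setoid; semiring; +-congˡ; +-congʳ; *-congˡ; *-congʳ; *-assoc; *-comm; +-identityʳ; +-identityˡ; zeroˡ; zeroʳ; *-identityˡ; distribʳ)
open Sum semiring using (sum; sum-cong-≋; ∑-distrib-+; ∑-comm; *-distribˡ-sum; *-distribʳ-sum)

fromℤ-sum : ∀ {n} (g : Vector ℤ n) → fromℤ (sumᶻ g) ≈ sum (λ i → fromℤ (g i))
fromℤ-sum {ℕ.zero}  g = ≈-refl
fromℤ-sum {ℕ.suc n} g = ≈-trans (fromℤ-+ (g zero) (sumᶻ (λ i → g (suc i))))
  (+-congˡ (fromℤ-sum (λ i → g (suc i))))

+-cancelˡ : ∀ x z → x + z ≈ x → z ≈ 0ℝ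
+-cancelˡ x z x+z≈x = mk≈ (null-cong (λ n → go (seq x n) (seq z n)) (_≈_.close x+z≈x))
  where
  go : ∀ p q → p ℚ.+ q ℚ.- p ≡ q ℚ.- 0ℚ
  go = solve-∀ ℚ-ring

#-cancelˡ : ∀ {w x y} → w # 0ℝ → w * x ≈ w * y → x ≈ y
#-cancelˡ {w} {x} {y} w#0 wx≈wy = mk≈ (null-cong (λ n → go₀ (seq x n) (seq y n))
  (_≈_.close (#-cancel (x + fromℤ ℤ.-1ℤ * y) w#0
    (mk≈ (null-cong (λ n → go₁ (seq w n) (seq x n) (seq y n)) (_≈_.close wx≈wy))))))
  where
  go₀ : ∀ p q → p ℚ.+ ℚ.- 1ℚ ℚ.* q ℚ.- 0ℚ ≡ p ℚ.- q
  go₀ = solve-∀ ℚ-ring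
  go₁ : ∀ w p q → w ℚ.* p ℚ.- w ℚ.* q ≡ w ℚ.* (p ℚ.+ ℚ.- 1ℚ ℚ.* q) ℚ.- 0ℚ ℚ.* (p ℚ.+ ℚ.- 1ℚ ℚ.* q)
  go₁ = solve-∀ ℚ-ring

-- F f is the value at y of M f applied to an eigenvector v.
module Eigenvector {n : ℕ} {Γ : Graph n} (regular : IsDistanceRegular Γ 3)
  {θ : ℝ} (eigen : IsEigenvalue (Graph.adjacencyMatrix Γ) θ) where

  open Intersection regular using (_~_; _~?_; d; ~⇒d≡1; d≡1⇒~; adjacencyMatrix)
  open IsEigenvalue eigen renaming (vector to v)

  -- A vertex where the eigenvector is apart from 0, so that `F δ₀` ≈ v y can be cancelled.
  y : Fin n
  y = proj₁ nonzero

  A : Fin n → Fin n → ℝ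
  A x z = fromℤ (δ₁ (d x z))

  adjacency : ∀ x z → A x z ≈ adjacencyMatrix x z
  adjacency x z with x ~? z
  ... | yes x~z = pointwise λ _ → cong (λ l → ⌈ δ₁ l ⌉) (~⇒d≡1 x~z)
  ... | no  x≁z = pointwise λ _ → cong ⌈_⌉ (nonadjacent (unit-cases 1F (d x z)))
    where
    nonadjacent : (d x z ≡ 1F × δ₁ (d x z) ≡ 1ℤ) ⊎ δ₁ (d x z) ≡ 0ℤ → δ₁ (d x z) ≡ 0ℤ
    nonadjacent (inj₁ (dxz≡1 , _)) = contradiction (d≡1⇒~ dxz≡1) x≁z
    nonadjacent (inj₂ δ≡0)         = δ≡0

  A·v : ∀ z → sum (λ x → A z x * v x) ≈ θ * v z
  A·v z = ≈-trans (sum-cong-≋ λ x → *-congʳ (adjacency z x)) (equation z)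

  F : Profile → ℝ
  F f = sum (λ x → fromℤ (f (d x y)) * v x)

  F-cong : ∀ {f g} → (∀ l → f l ≡ g l) → F f ≈ F g
  F-cong f≡g = sum-cong-≋ λ x → *-congʳ (pointwise λ _ → cong ⌈_⌉ (f≡g (d x y)))

  F-linear : ∀ i j f g → F (λ l → i ℤ.* f l ℤ.+ j ℤ.* g l) ≈ fromℤ i * F f + fromℤ j * F g
  F-linear i j f g = begin
    sum (λ x → fromℤ (i ℤ.* f (d x y) ℤ.+ j ℤ.* g (d x y)) * v x)
      ≈⟨ sum-cong-≋ (λ x → ≈-trans
           (*-congʳ (≈-trans (fromℤ-+ (i ℤ.* f (d x y)) (j ℤ.* g (d x y)))
             (+-cong (fromℤ-* i (f (d x y))) (fromℤ-* j (g (d x y))))))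
           (≈-trans (distribʳ (v x) _ _) (+-cong (*-assoc _ _ _) (*-assoc _ _ _)))) ⟩
    sum (λ x → fromℤ i * (fromℤ (f (d x y)) * v x) + fromℤ j * (fromℤ (g (d x y)) * v x))
      ≈⟨ ∑-distrib-+ (λ x → fromℤ i * (fromℤ (f (d x y)) * v x)) (λ x → fromℤ j * (fromℤ (g (d x y)) * v x)) ⟩
    _ ≈⟨ +-cong (*-distribˡ-sum (fromℤ i) (λ x → fromℤ (f (d x y)) * v x))
           (*-distribˡ-sum (fromℤ j) (λ x → fromℤ (g (d x y)) * v x)) ⟨
    fromℤ i * F f + fromℤ j * F g ∎
    where open SetoidReasoning setoid

  module _ {L : Profile → Profile} (scheme : IsScheme d L) where
    open IsScheme scheme

    -- A is moved from `M f` onto the eigenvector: by symmetry of A, the sum of (A M f) x y v x over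
    -- x is that of f (d z y) (A v) z over z.
    F-L : ∀ f → F (L f) ≈ θ * F f
    F-L f = begin
      sum (λ x → fromℤ (L f (d x y)) * v x)
        ≈⟨ sum-cong-≋ (λ x → ≈-trans (*-congʳ (row x))
             (*-distribʳ-sum (v x) (λ z → A x z * fromℤ (f (d z y))))) ⟩
      sum (λ x → sum (λ z → A x z * fromℤ (f (d z y)) * v x))
        ≈⟨ ∑-comm (λ x z → A x z * fromℤ (f (d z y)) * v x) ⟩
      sum (λ z → sum (λ x → A x z * fromℤ (f (d z y)) * v x))
        ≈⟨ sum-cong-≋ (λ z → ≈-trans (sum-cong-≋ λ x → commute x z)
             (≈-sym (*-distribˡ-sum (fromℤ (f (d z y))) (λ x → A z x * v x)))) ⟩
      sum (λ z → fromℤ (f (d z y)) * sum (λ x → A z x * v x))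
        ≈⟨ sum-cong-≋ (λ z → ≈-trans (*-congˡ (A·v z))
             (≈-trans (≈-sym (*-assoc _ _ _)) (≈-trans (*-congʳ (*-comm _ _)) (*-assoc _ _ _)))) ⟩
      sum (λ z → θ * (fromℤ (f (d z y)) * v z))
        ≈⟨ *-distribˡ-sum θ (λ z → fromℤ (f (d z y)) * v z) ⟨
      θ * F f ∎
      where
      open SetoidReasoning setoid
      row : ∀ x → fromℤ (L f (d x y)) ≈ sum (λ z → A x z * fromℤ (f (d z y)))
      row x = ≈-trans (pointwise λ _ → cong ⌈_⌉ (sym (A·M f x y)))
        (≈-trans (fromℤ-sum (λ z → δ₁ (d x z) ℤ.* f (d z y)))
          (sum-cong-≋ λ z → fromℤ-* (δ₁ (d x z)) (f (d z y))))
      commute : ∀ x z → A x z * fromℤ (f (d z y)) * v x ≈ fromℤ (f (d z y)) * (A z x * v x)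
      commute x z = ≈-trans (*-congʳ (≈-trans (*-comm _ _)
        (*-congˡ (pointwise λ _ → cong (λ l → ⌈ δ₁ l ⌉) (d-sym x z))))) (*-assoc _ _ _)

    F-δ₀ : F δ₀ ≈ v y
    F-δ₀ = ≈-trans (sum-cong-≋ λ x → *-congʳ (pointwise λ _ → cong (λ l → ⌈ δ₀ l ⌉) (d-sym x y)))
      (go y (λ x → δ₀ (d y x)) (cong δ₀ (d-refl y)) off)
      where
      off : ∀ x → x ≢ y → δ₀ (d y x) ≡ 0ℤ
      off x x≢y with d y x in eq
      ... | 0F = contradiction (sym (d-zero y x eq)) x≢y
      ... | 1F = refl
      ... | 2F = refl
      ... | 3F = refl
      vanishing : ∀ {m} (g : Vector ℤ m) (w : Vector ℝ m) → (∀ x → g x ≡ 0ℤ) → sum (λ x → fromℤ (g x) * w x) ≈ 0ℝ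
      vanishing {ℕ.zero}  g w g≡0 = ≈-refl
      vanishing {ℕ.suc m} g w g≡0 = ≈-trans (+-cong
        (≈-trans (*-congʳ (pointwise λ _ → cong ⌈_⌉ (g≡0 zero))) (zeroˡ (w zero)))
        (vanishing (λ x → g (suc x)) (λ x → w (suc x)) (λ x → g≡0 (suc x)))) (+-identityˡ 0ℝ)
      go : ∀ {m} {w : Vector ℝ m} (i : Fin m) (g : Vector ℤ m) → g i ≡ 1ℤ → (∀ x → x ≢ i → g x ≡ 0ℤ) →
        sum (λ x → fromℤ (g x) * w x) ≈ w i
      go {w = w} zero g gᵢ g₀ = ≈-trans (+-cong
        (≈-trans (*-congʳ (pointwise λ _ → cong ⌈_⌉ gᵢ)) (*-identityˡ (w zero)))
        (vanishing (λ x → g (suc x)) (λ x → w (suc x)) (λ x → g₀ (suc x) λ ()))) (+-identityʳ (w zero))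
      go {w = w} (suc i) g gᵢ g₀ = ≈-trans (+-cong
        (≈-trans (*-congʳ (pointwise λ _ → cong ⌈_⌉ (g₀ zero λ ()))) (zeroˡ (w zero)))
        (go i (λ x → g (suc x)) gᵢ (λ x x≢i → g₀ (suc x) (λ eq → x≢i (suc-injective eq)))))
        (+-identityˡ (w (suc i)))

    -- A profile f with L f = i f + m δ₀ shows that i is an eigenvalue only if m = 0.
    defect-zero : ∀ f i m → (∀ l → L f l ≡ i ℤ.* f l ℤ.+ m ℤ.* δ₀ l) → θ ≈ fromℤ i → m ≡ 0ℤ
    defect-zero f i m Lf θ≈i = fromℤ-zero (#-cancel (fromℤ m) (proj₂ nonzero)
      (≈-trans (*-comm _ _) (≈-trans (*-congˡ (≈-sym F-δ₀)) (≈-trans (+-cancelˡ (fromℤ i * F f) (fromℤ m * F δ₀) (begin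
        fromℤ i * F f + fromℤ m * F δ₀   ≈⟨ F-linear i m f δ₀ ⟨
        F (λ l → i ℤ.* f l ℤ.+ m ℤ.* δ₀ l) ≈⟨ F-cong Lf ⟨
        F (L f)                          ≈⟨ F-L f ⟩
        θ * F f                          ≈⟨ *-congʳ θ≈i ⟩
        fromℤ i * F f                    ∎)) (≈-sym (zeroˡ (fromℤ m)))))))
      where open SetoidReasoning setoid

  module _ {a b β c : ℤ} (scheme : IsScheme d (shillaMatrix a b β c)) where

    open Spectral a b β c using (L; s; r; h; 𝟙; L-h; L-𝟙; h-δ₀)

    -- F vanishes on 𝟙 since θ is apart from k = a b, and then on h since θ is apart from a.
    -- Applying F to `h-δ₀` leaves (θ² - s θ + r) v y = 0.
    quadratic-root : θ # fromℤ a → θ # fromℤ (a ℤ.* b) → θ * θ + fromℤ r ≈ fromℤ s * θ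
    quadratic-root θ#a θ#k = #-cancelˡ (proj₂ nonzero) (begin
      v y * (θ * θ + fromℤ r)
        ≈⟨ ≈-trans (*-comm _ _) (distribʳ (v y) (θ * θ) (fromℤ r)) ⟩
      θ * θ * v y + fromℤ r * v y
        ≈⟨ +-cong (≈-trans (*-assoc _ _ _) (*-congˡ (*-congˡ (≈-sym (F-δ₀ scheme))))) (*-congˡ (≈-sym (F-δ₀ scheme))) ⟩
      θ * (θ * F δ₀) + fromℤ r * F δ₀
        ≈⟨ +-congʳ (≈-trans (*-congˡ (≈-sym (F-L scheme δ₀))) (≈-trans (≈-sym (F-L scheme (L δ₀))) (≈-sym (*-identityˡ _)))) ⟩
      fromℤ 1ℤ * F (L (L δ₀)) + fromℤ r * F δ₀
        ≈⟨ F-linear 1ℤ r (L (L δ₀)) δ₀ ⟨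
      F (λ l → 1ℤ ℤ.* L (L δ₀) l ℤ.+ r ℤ.* δ₀ l)
        ≈⟨ F-cong h-δ₀ ⟩
      F (λ l → s ℤ.* L δ₀ l ℤ.+ 1ℤ ℤ.* h l)
        ≈⟨ F-linear s 1ℤ (L δ₀) h ⟩
      fromℤ s * F (L δ₀) + fromℤ 1ℤ * F h
        ≈⟨ +-cong (*-congˡ (≈-trans (F-L scheme δ₀) (*-congˡ (F-δ₀ scheme)))) (≈-trans (*-congˡ F-h) (zeroʳ (fromℤ 1ℤ))) ⟩
      fromℤ s * (θ * v y) + 0ℝ
        ≈⟨ ≈-trans (+-identityʳ _) (≈-trans (≈-sym (*-assoc _ _ _)) (*-comm _ _)) ⟩
      v y * (fromℤ s * θ) ∎)
      where
      open SetoidReasoning setoid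
      eigenprofile : ∀ f g i m → (∀ l → L f l ≡ i ℤ.* f l ℤ.+ m ℤ.* g l) → F g ≈ 0ℝ → θ # fromℤ i → F f ≈ 0ℝ
      eigenprofile f g i m Lf Fg≈0 θ#i = #-cancel (F f) θ#i (begin
        θ * F f                        ≈⟨ F-L scheme f ⟨
        F (L f)                        ≈⟨ F-cong Lf ⟩
        F (λ l → i ℤ.* f l ℤ.+ m ℤ.* g l) ≈⟨ F-linear i m f g ⟩
        fromℤ i * F f + fromℤ m * F g  ≈⟨ +-congˡ (≈-trans (*-congˡ Fg≈0) (zeroʳ (fromℤ m))) ⟩
        fromℤ i * F f + 0ℝ             ≈⟨ +-identityʳ _ ⟩
        fromℤ i * F f                  ∎)
      F-0 : F (λ _ → 0ℤ) ≈ 0ℝ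
      F-0 = ≈-trans (F-linear 0ℤ 0ℤ 𝟙 𝟙) (≈-trans (+-cong (zeroˡ (F 𝟙)) (zeroˡ (F 𝟙))) (+-identityˡ 0ℝ))
      F-𝟙 : F 𝟙 ≈ 0ℝ
      F-𝟙 = eigenprofile 𝟙 (λ _ → 0ℤ) (a ℤ.* b) 0ℤ L-𝟙 F-0 θ#k
      F-h : F h ≈ 0ℝ
      F-h = eigenprofile h 𝟙 a (a ℤ.* (b ℤ.- 1ℤ) ℤ.* c) L-h F-𝟙 θ#a

-- Locating the real roots of an integral quadratic

-∣p∣≤p : ∀ p → ℚ.- ∣ p ∣ ℚ.≤ p
-∣p∣≤p p = subst (ℚ.- ∣ p ∣ ℚ.≤_) (go p)
  (ℚ.neg-antimono-≤ (subst (ℚ.- p ℚ.≤_) (ℚ.∣-p∣≡∣p∣ p) (p≤∣p∣ (ℚ.- p))))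
  where
  go : ∀ p → ℚ.- ℚ.- p ≡ p
  go = solve-∀ ℚ-ring

0≤q-p : ∀ {p q} → p ℚ.≤ q → 0ℚ ℚ.≤ q ℚ.- p
0≤q-p {p} {q} p≤q = subst (ℚ._≤ q ℚ.- p) (ℚ.+-inverseʳ p) (ℚ.+-monoˡ-≤ (ℚ.- p) p≤q)

-- The summands are ordered as in `IsRoot`, so that `root-null` holds by unfolding.
quadratic : ℚ → ℚ → ℚ → ℚ
quadratic s r t = t ℚ.* t ℚ.+ r ℚ.- s ℚ.* t

-- To the left of τ the quadratic decreases with slope at least 1.
no-root-below : ∀ s r τ x {ε} → 0ℚ ℚ.< ε → ε ℚ.≤ τ ℚ.- x → 0ℚ ℚ.≤ quadratic s r τ →
  1ℚ ℚ.≤ s ℚ.- (τ ℚ.+ τ) → ¬ ∣ quadratic s r x ∣ ℚ.≤ ½ ℚ.* ε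
no-root-below s r τ x {ε} 0<ε ε≤δ 0≤qτ slope small = ℚ.<-irrefl refl (begin-strict
  ½ ℚ.* ε                 ≡⟨ ℚ.+-identityʳ (½ ℚ.* ε) ⟨
  ½ ℚ.* ε ℚ.+ 0ℚ          <⟨ ℚ.+-monoʳ-< (½ ℚ.* ε) (0<½p 0<ε) ⟩
  ½ ℚ.* ε ℚ.+ ½ ℚ.* ε     ≡⟨ ½+½ ε ⟩
  ε                       ≤⟨ ε≤δ ⟩
  δ                       ≡⟨ ℚ.+-identityʳ δ ⟨
  δ ℚ.+ 0ℚ                ≤⟨ ℚ.+-monoʳ-≤ δ (ℚ.+-mono-≤ (0≤p*q 0≤δ (0≤q-p slope)) (ℚ.+-mono-≤ (0≤p*q 0≤δ 0≤δ) 0≤qτ)) ⟩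
  δ ℚ.+ (δ ℚ.* (s ℚ.- (τ ℚ.+ τ) ℚ.- 1ℚ) ℚ.+ (δ ℚ.* δ ℚ.+ quadratic s r τ))
                          ≡⟨ go τ x s r ⟩
  quadratic s r x         ≤⟨ p≤∣p∣ (quadratic s r x) ⟩
  ∣ quadratic s r x ∣     ≤⟨ small ⟩
  ½ ℚ.* ε                 ∎)
  where
  open ℚ.≤-Reasoning
  δ : ℚ
  δ = τ ℚ.- x
  0≤δ : 0ℚ ℚ.≤ δ
  0≤δ = ℚ.≤-trans (ℚ.<⇒≤ 0<ε) ε≤δ
  go : ∀ τ x s r → τ ℚ.- x ℚ.+ ((τ ℚ.- x) ℚ.* (s ℚ.- (τ ℚ.+ τ) ℚ.- 1ℚ) ℚ.+
    ((τ ℚ.- x) ℚ.* (τ ℚ.- x) ℚ.+ (τ ℚ.* τ ℚ.+ r ℚ.- s ℚ.* τ))) ≡ x ℚ.* x ℚ.+ r ℚ.- s ℚ.* x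
  go = solve-∀ ℚ-ring

-- If A < 0, then B ≥ -A > 0 and the product is negative.
positive-factor : ∀ A B → 0ℚ ℚ.≤ A ℚ.+ B → 0ℚ ℚ.< A ℚ.* B → 0ℚ ℚ.≤ A
positive-factor A B 0≤A+B 0<AB = ℚ.≮⇒≥ λ A<0 → ℚ.<-irrefl refl (begin-strict
  0ℚ                <⟨ 0<AB ⟩
  A ℚ.* B           ≡⟨ ℚ.+-identityʳ (A ℚ.* B) ⟨
  A ℚ.* B ℚ.+ 0ℚ    ≤⟨ ℚ.+-monoʳ-≤ (A ℚ.* B) (ℚ.+-mono-≤ (0≤p*q (0≤-A A<0) 0≤A+B) (0≤p*q (0≤-A A<0) (0≤-A A<0))) ⟩
  A ℚ.* B ℚ.+ ((0ℚ ℚ.- A) ℚ.* (A ℚ.+ B) ℚ.+ (0ℚ ℚ.- A) ℚ.* (0ℚ ℚ.- A)) ≡⟨ go A B ⟩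
  0ℚ                ∎)
  where
  open ℚ.≤-Reasoning
  0≤-A : A ℚ.< 0ℚ → 0ℚ ℚ.≤ 0ℚ ℚ.- A
  0≤-A A<0 = 0≤q-p (ℚ.<⇒≤ A<0)
  go : ∀ A B → A ℚ.* B ℚ.+ ((0ℚ ℚ.- A) ℚ.* (A ℚ.+ B) ℚ.+ (0ℚ ℚ.- A) ℚ.* (0ℚ ℚ.- A)) ≡ 0ℚ
  go = solve-∀ ℚ-ring

-- With A = τ - x and B = s - τ - x one has A B = q x - q τ, and A + B = s - 2 x is close
-- to y - x because x + y is close to s.
root-gap : ∀ s r τ x y {η K K⁻¹} → 0ℚ ℚ.< η → 0ℚ ℚ.≤ K⁻¹ → K ℚ.* K⁻¹ ≡ 1ℚ →
  quadratic s r τ ℚ.≤ ℚ.- 1ℚ → ∣ quadratic s r x ∣ ℚ.≤ ½ →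
  η ℚ.≤ y ℚ.- x → ∣ x ℚ.+ y ℚ.- s ∣ ℚ.≤ ½ ℚ.* η → s ℚ.- τ ℚ.- x ℚ.≤ K →
  x ℚ.+ ½ ℚ.* K⁻¹ ℚ.≤ τ
root-gap s r τ x y {η} {K} {K⁻¹} 0<η 0≤K⁻¹ KK⁻¹≡1 qτ≤-1 small gap sum-small B≤K = begin
  x ℚ.+ ½ ℚ.* K⁻¹
    ≤⟨ ℚ.+-monoʳ-≤ x (ℚ.*-monoʳ-≤-nonNeg K⁻¹ {{ℚ.nonNegative 0≤K⁻¹}}
         (ℚ.≤-trans ½≤AB (ℚ.*-monoˡ-≤-nonNeg A {{ℚ.nonNegative 0≤A}} B≤K))) ⟩
  x ℚ.+ A ℚ.* K ℚ.* K⁻¹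
    ≡⟨ cong (x ℚ.+_) (trans (ℚ.*-assoc A K K⁻¹) (trans (cong (A ℚ.*_) KK⁻¹≡1) (ℚ.*-identityʳ A))) ⟩
  x ℚ.+ (τ ℚ.- x)
    ≡⟨ go τ x ⟩
  τ ∎
  where
  open ℚ.≤-Reasoning
  A B : ℚ
  A = τ ℚ.- x
  B = s ℚ.- τ ℚ.- x
  ½≤AB : ½ ℚ.≤ A ℚ.* B
  ½≤AB = begin
    ½                     ≡⟨⟩
    ℚ.- ½ ℚ.- ℚ.- 1ℚ
      ≤⟨ ℚ.+-mono-≤ (ℚ.≤-trans (ℚ.neg-antimono-≤ small) (-∣p∣≤p (quadratic s r x))) (ℚ.neg-antimono-≤ qτ≤-1) ⟩
    quadratic s r x ℚ.- quadratic s r τ   ≡⟨ go₀ τ x s r ⟩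
    A ℚ.* B               ∎
    where
    go₀ : ∀ τ x s r → (x ℚ.* x ℚ.+ r ℚ.- s ℚ.* x) ℚ.- (τ ℚ.* τ ℚ.+ r ℚ.- s ℚ.* τ) ≡ (τ ℚ.- x) ℚ.* (s ℚ.- τ ℚ.- x)
    go₀ = solve-∀ ℚ-ring
  0≤A+B : 0ℚ ℚ.≤ A ℚ.+ B
  0≤A+B = begin
    0ℚ                ≤⟨ ℚ.<⇒≤ (0<½p 0<η) ⟩
    ½ ℚ.* η           ≡⟨ go₀ η ⟩
    η ℚ.- ½ ℚ.* η     ≤⟨ ℚ.+-mono-≤ gap (ℚ.neg-antimono-≤ (ℚ.≤-trans (p≤∣p∣ (x ℚ.+ y ℚ.- s)) sum-small)) ⟩
    (y ℚ.- x) ℚ.- (x ℚ.+ y ℚ.- s)   ≡⟨ go₁ τ x y s ⟩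
    A ℚ.+ B           ∎
    where
    go₀ : ∀ η → ½ ℚ.* η ≡ η ℚ.- ½ ℚ.* η
    go₀ = solve-∀ ℚ-ring
    go₁ : ∀ τ x y s → (y ℚ.- x) ℚ.- (x ℚ.+ y ℚ.- s) ≡ (τ ℚ.- x) ℚ.+ (s ℚ.- τ ℚ.- x)
    go₁ = solve-∀ ℚ-ring
  0≤A : 0ℚ ℚ.≤ A
  0≤A = positive-factor A B 0≤A+B (ℚ.<-≤-trans (ℚ.positive⁻¹ ½) ½≤AB)
  go : ∀ τ x → x ℚ.+ (τ ℚ.- x) ≡ τ
  go = solve-∀ ℚ-ring

⌈⌉-quadratic : ∀ s r i → ⌈ i ℤ.* i ℤ.- s ℤ.* i ℤ.+ r ⌉ ≡ quadratic ⌈ s ⌉ ⌈ r ⌉ ⌈ i ⌉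
⌈⌉-quadratic s r i = begin
  ⌈ i ℤ.* i ℤ.- s ℤ.* i ℤ.+ r ⌉                ≡⟨ ⌈⌉-+ (i ℤ.* i ℤ.- s ℤ.* i) r ⟩
  ⌈ i ℤ.* i ℤ.- s ℤ.* i ⌉ ℚ.+ ⌈ r ⌉            ≡⟨ cong (ℚ._+ ⌈ r ⌉) (⌈⌉-+ (i ℤ.* i) (ℤ.- (s ℤ.* i))) ⟩
  ⌈ i ℤ.* i ⌉ ℚ.+ ⌈ ℤ.- (s ℤ.* i) ⌉ ℚ.+ ⌈ r ⌉
    ≡⟨ cong₂ (λ t u → t ℚ.+ u ℚ.+ ⌈ r ⌉) (⌈⌉-* i i) (trans (⌈⌉-neg (s ℤ.* i)) (cong ℚ.-_ (⌈⌉-* s i))) ⟩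
  ⌈ i ⌉ ℚ.* ⌈ i ⌉ ℚ.+ ℚ.- (⌈ s ⌉ ℚ.* ⌈ i ⌉) ℚ.+ ⌈ r ⌉
    ≡⟨ go ⌈ i ⌉ ⌈ s ⌉ ⌈ r ⌉ ⟩
  quadratic ⌈ s ⌉ ⌈ r ⌉ ⌈ i ⌉ ∎
  where
  open ≡-Reasoning
  go : ∀ i s r → i ℚ.* i ℚ.+ ℚ.- (s ℚ.* i) ℚ.+ r ≡ i ℚ.* i ℚ.+ r ℚ.- s ℚ.* i
  go = solve-∀ ℚ-ring

IsRoot : ℤ → ℤ → ℝ → Set
IsRoot s r x = x * x + fromℤ r ≈ fromℤ s * x

root-null : ∀ {s r x} → IsRoot s r x → Null (λ n → quadratic ⌈ s ⌉ ⌈ r ⌉ (seq x n))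
root-null root = _≈_.close root

-- One index suffices: late enough, x is at least ε below τ while the quadratic is at most ε / 2 in
-- absolute value, contrary to `no-root-below`.
root-not-below : ∀ {s r x} τ → IsRoot s r x → 0ℤ ℤ.≤ τ ℤ.* τ ℤ.- s ℤ.* τ ℤ.+ r →
  1ℤ ℤ.≤ s ℤ.- (τ ℤ.+ τ) → ¬ x < fromℤ τ
root-not-below {s} {r} {x} τ root 0≤qτ slope x<τ =
  let ε , 0<ε , M , gap = <-separation x<τ
      N , small = root-null {s} {r} {x} root (½ ℚ.* ε) (0<½p 0<ε)
  in no-root-below ⌈ s ⌉ ⌈ r ⌉ ⌈ τ ⌉ (seq x (M ℕ.⊔ N)) 0<ε
    (gap (M ℕ.⊔ N) (ℕ.m≤m⊔n M N))
    (subst (0ℚ ℚ.≤_) (⌈⌉-quadratic s r τ) (⌈⌉-mono 0≤qτ))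
    (subst (1ℚ ℚ.≤_) (trans (⌈⌉-+ s (ℤ.- (τ ℤ.+ τ)))
      (cong (⌈ s ⌉ ℚ.+_) (trans (⌈⌉-neg (τ ℤ.+ τ)) (cong ℚ.-_ (⌈⌉-+ τ τ))))) (⌈⌉-mono slope))
    (small (M ℕ.⊔ N) (ℕ.m≤n⊔m M N))

-- Vieta's formula: the difference of the two equations is (x - y) (x + y - s) = 0, and x - y is
-- bounded away from 0.
roots-sum : ∀ {s r x y} → x < y → IsRoot s r x → IsRoot s r y → Null (λ n → seq x n ℚ.+ seq y n ℚ.- ⌈ s ⌉)
roots-sum {s} {r} {x} {y} x<y root-x root-y =
  null-cong (λ n → trans (ℚ.+-identityʳ _) (cong (seq x n ℚ.+ seq y n ℚ.+_) (⌈⌉-neg s)))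
    (_≈_.close (<-cancel (x + y + fromℤ (ℤ.- s)) x<y (mk≈ (null-cong difference
      (null-+ (root-null {s} {r} {x} root-x) (null-neg (root-null {s} {r} {y} root-y)))))))
  where
  go : ∀ x y s r → (x ℚ.* x ℚ.+ r ℚ.- s ℚ.* x) ℚ.+ ℚ.- (y ℚ.* y ℚ.+ r ℚ.- s ℚ.* y) ≡
    x ℚ.* (x ℚ.+ y ℚ.+ ℚ.- s) ℚ.- y ℚ.* (x ℚ.+ y ℚ.+ ℚ.- s)
  go = solve-∀ ℚ-ring
  difference : ∀ n → quadratic ⌈ s ⌉ ⌈ r ⌉ (seq x n) ℚ.+ ℚ.- quadratic ⌈ s ⌉ ⌈ r ⌉ (seq y n) ≡
    seq x n ℚ.* (seq x n ℚ.+ seq y n ℚ.+ ⌈ ℤ.- s ⌉) ℚ.- seq y n ℚ.* (seq x n ℚ.+ seq y n ℚ.+ ⌈ ℤ.- s ⌉)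
  difference n = trans (go (seq x n) (seq y n) ⌈ s ⌉ ⌈ r ⌉)
    (cong (λ t → seq x n ℚ.* (seq x n ℚ.+ seq y n ℚ.+ t) ℚ.- seq y n ℚ.* (seq x n ℚ.+ seq y n ℚ.+ t)) (sym (⌈⌉-neg s)))

-- Strict inequality of reals needs one rational gap valid from some index on. It is ½ / K, where K
-- bounds s - τ - x, since (τ - x) (s - τ - x) = q x - q τ is eventually at least ½.
smaller-root-below : ∀ {s r x y} τ → x < y → IsRoot s r x → IsRoot s r y →
  τ ℤ.* τ ℤ.- s ℤ.* τ ℤ.+ r ℤ.≤ ℤ.-1ℤ → x < fromℤ τ
smaller-root-below {s} {r} {x} {y} τ x<y root-x root-y qτ≤-1 =
  let η , 0<η , N₁ , gap = <-separation x<y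
      K , N₂ , 0<K , bound = cauchy-bounded (fromℤ s + fromℤ (ℤ.- τ) + fromℤ ℤ.-1ℤ * x)
      N₃ , small = root-null {s} {r} {x} root-x ½ (ℚ.positive⁻¹ ½)
      N₄ , sum-small = roots-sum {s} {r} x<y root-x root-y (½ ℚ.* η) (0<½p 0<η)
      K⁻¹ , 0<K⁻¹ , KK⁻¹≡1 = reciprocal 0<K
  in mk< (½ ℚ.* K⁻¹ , 0<½p 0<K⁻¹ , (N₁ ℕ.⊔ N₂) ℕ.⊔ (N₃ ℕ.⊔ N₄) , λ n N≤n →
    let N₁₂≤n = ℕ.m⊔n≤o⇒m≤o (N₁ ℕ.⊔ N₂) (N₃ ℕ.⊔ N₄) N≤n
        N₃₄≤n = ℕ.m⊔n≤o⇒n≤o (N₁ ℕ.⊔ N₂) (N₃ ℕ.⊔ N₄) N≤n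
    in root-gap ⌈ s ⌉ ⌈ r ⌉ ⌈ τ ⌉ (seq x n) (seq y n) 0<η (ℚ.<⇒≤ 0<K⁻¹) KK⁻¹≡1
      (subst (ℚ._≤ ℚ.- 1ℚ) (⌈⌉-quadratic s r τ) (⌈⌉-mono qτ≤-1))
      (small n (ℕ.m⊔n≤o⇒m≤o N₃ N₄ N₃₄≤n))
      (gap n (ℕ.m⊔n≤o⇒m≤o N₁ N₂ N₁₂≤n))
      (sum-small n (ℕ.m⊔n≤o⇒n≤o N₃ N₄ N₃₄≤n))
      (ℚ.≤-trans (ℚ.≤-reflexive (bounded-term ⌈ s ⌉ ⌈ τ ⌉ (seq x n) (⌈⌉-neg τ)))
        (ℚ.≤-trans (p≤∣p∣ _) (bound n (ℕ.m⊔n≤o⇒n≤o N₁ N₂ N₁₂≤n)))))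
  where
  bounded-term : ∀ s τ x {τ′} → τ′ ≡ ℚ.- τ → s ℚ.- τ ℚ.- x ≡ s ℚ.+ τ′ ℚ.+ ℚ.- 1ℚ ℚ.* x
  bounded-term s τ x refl = go s τ x
    where
    go : ∀ s τ x → s ℚ.- τ ℚ.- x ≡ s ℚ.+ ℚ.- τ ℚ.+ ℚ.- 1ℚ ℚ.* x
    go = solve-∀ ℚ-ring

-- Conclusion for a Shilla graph

module Shilla {n : ℕ} {Γ : Graph n} (shilla : IsShilla Γ) where

  open IsShilla shilla using (distanceRegular; θ; decreasing; eigenvalue; θ₁≈a₃)
  open Intersection distanceRegular hiding (c; b)
  open IsDistanceRegular distanceRegular using (b; c)

  β c₂ : ℤ
  β  = + b 2F
  c₂ = + c 2F

  -- Derived from θ₁ ≈ a₃: the profile of `tridiagonal-defect` is multiplied by a₃ up to b₂ (k - a₃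
  -- (a₃ - a₁)) δ₀, and this defect must vanish because a₃ is an eigenvalue.
  k≡ : k ≡ a 3F ℤ.* (a 3F ℤ.- a 1F)
  k≡ = ℤ.i-j≡0⇒i≡j k (a 3F ℤ.* (a 3F ℤ.- a 1F)) (zero-factor (ℤ.i*j≡0⇒i≡0∨j≡0 β
    (Eigenvector.defect-zero distanceRegular (eigenvalue 1F) scheme _ (a 3F) _
      (tridiagonal-defect k (a 1F) (+ b 1F) c₂ (a 2F) β (+ c 3F) (a 3F)) θ₁≈a₃)))
    where
    zero-factor : β ≡ 0ℤ ⊎ k ℤ.- a 3F ℤ.* (a 3F ℤ.- a 1F) ≡ 0ℤ → k ℤ.- a 3F ℤ.* (a 3F ℤ.- a 1F) ≡ 0ℤ
    zero-factor (inj₁ β≡0) = contradiction 0<b₂ (ℤ.<-irrefl (sym β≡0))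
    zero-factor (inj₂ eq)  = eq

  open Parametrized k≡ public
  open Spectral a₃ b⟨Γ⟩ β c₂ using (s; r; quadratic-at-b)

  module _ {i} (θᵢ<θ₁ : θ i < θ 1F) where

    θᵢ<a₃ : θ i < fromℤ a₃
    θᵢ<a₃ = <-respʳ-≈ θᵢ<θ₁ θ₁≈a₃

    θᵢ<k : θ i < fromℤ (a₃ ℤ.* b⟨Γ⟩)
    θᵢ<k = <-fromℤ {i = a₃} {a₃ ℤ.* b⟨Γ⟩} θᵢ<a₃ (≤-by (a₃ ℤ.* (b⟨Γ⟩ ℤ.- 1ℤ))
      (0≤* (ℤ.<⇒≤ 0<a₃) (ℤ.<⇒≤ (i<j⇒0<j-i 1<b⟨Γ⟩))) (go a₃ b⟨Γ⟩))
      where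
      go : ∀ a b → a ℤ.* b ≡ a ℤ.+ a ℤ.* (b ℤ.- 1ℤ)
      go = ℤSolver.solve-∀

    θᵢ-root : IsRoot s r (θ i)
    θᵢ-root = Eigenvector.quadratic-root distanceRegular (eigenvalue i) {a₃} {b⟨Γ⟩} {β} {c₂} shillaScheme (inj₁ θᵢ<a₃) (inj₁ θᵢ<k)

  θ₃-root : IsRoot s r (θ 3F)
  θ₃-root = θᵢ-root (decreasing 1F 3F (ℕ.s≤s (ℕ.s≤s ℕ.z≤n)))

  θ₂-root : IsRoot s r (θ 2F)
  θ₂-root = θᵢ-root (decreasing 1F 2F (ℕ.s≤s (ℕ.s≤s ℕ.z≤n)))

  0<c₂[b-1] : 0ℤ ℤ.< c₂ ℤ.* (b⟨Γ⟩ ℤ.- 1ℤ)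
  0<c₂[b-1] = 0<* 0<c₂ (i<j⇒0<j-i 1<b⟨Γ⟩)

  τ : ℤ
  τ = ℤ.- (b⟨Γ⟩ ℤ.* b⟨Γ⟩) ℤ.+ + 2

  θ₃≥τ : + 3 ℤ.≤ b⟨Γ⟩ → ¬ θ 3F < fromℤ τ
  θ₃≥τ 3≤b = root-not-below {s} {r} τ θ₃-root quadratic-nonneg slope
    where open Bound {a = a₃} {b⟨Γ⟩} {β} {c₂} shillaScheme x₀ x₁ d₀₁ 0<a₃ 3≤b 0<b₂ 0<c₂ using (quadratic-nonneg; slope)

  b≡2 : θ 3F < fromℤ τ → b⟨Γ⟩ ≡ + 2
  b≡2 θ₃<τ = ℤ.≤-antisym
    (ℤ.≮⇒≥ λ 2<b → θ₃≥τ (ℤ.i<j⇒suc[i]≤j 2<b) θ₃<τ) (ℤ.i<j⇒suc[i]≤j 1<b⟨Γ⟩)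

  -- By `quadratic-at-b` the quadratic is at most -1 at -b, so -b separates its roots; θ₂ serves as
  -- the larger one.
  θ₃<-b : θ 3F < fromℤ (ℤ.- b⟨Γ⟩)
  θ₃<-b = smaller-root-below {s} {r} (ℤ.- b⟨Γ⟩)
    (decreasing 2F 3F (ℕ.s≤s (ℕ.s≤s (ℕ.s≤s ℕ.z≤n)))) θ₃-root θ₂-root
    (subst (ℤ._≤ ℤ.-1ℤ) (sym quadratic-at-b) (ℤ.neg-mono-≤ (0<⇒1≤ 0<c₂[b-1])))

theorem20 : ∀ {n : ℕ} (Γ : Graph n) (shilla : IsShilla Γ) (b : ℤ) → IsShilla.b⟨Γ⟩ shilla ≡ b →
    (IsShilla.θ₃ shilla < fromℤ (ℤ.- (b ℤ.^ 2) ℤ.+ + 2)) ⇔ (b ≡ + 2)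
theorem20 Γ shilla _ refl = mk⇔
  (λ θ₃<τ → b≡2 (subst (λ t → θ₃ < fromℤ (ℤ.- t ℤ.+ + 2)) square θ₃<τ))
  -- At b = 2 the integers -b and -b² + 2 are both -2.
  (λ b≡2 → subst (λ t → θ₃ < fromℤ t) (trans (cong ℤ.-_ b≡2) (cong (λ t → ℤ.- (t ℤ.^ 2) ℤ.+ + 2) (sym b≡2))) θ₃<-b)
  where
  open IsShilla shilla using (θ₃)
  open Shilla shilla using (b⟨Γ⟩; b≡2; θ₃<-b)
  square : b⟨Γ⟩ ℤ.^ 2 ≡ b⟨Γ⟩ ℤ.* b⟨Γ⟩
  square = cong (b⟨Γ⟩ ℤ.*_) (ℤ.*-identityʳ b⟨Γ⟩)
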